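{- For any $U$, $L$, $\tau$ and $D\in[0,U-L)$ (with $0<L<U$, $\tau\ge 0$, $D+2\tau\le U-L$), there exists a set of SOAD instances whose underlying metric is a weighted star (and which satisfy the bounds with parameters $L,U,\tau,D$ given in the context) on which no online algorithm $\mathrm{ALG}$ can achieve a ratio $\mathrm{ALG}/\mathrm{OPT}$ better than $\eta$; i.e., for every (possibly randomized) online algorithm the supremum over these instances of $\mathrm{ALG}(\mathcal I)/\mathrm{OPT}(\mathcal I)$ (expected cost if randomized) is at least $\eta$, where $$\eta=\left[W\left(\frac{(D+L-U+2\tau)\exp\left(\frac{D-U}{U}\right)}{U}\right)+\frac{U-D}{U}\right]^{ -1}$$ and $W$ is the Lambert $W$ function.
   Context: **SOAD.** $(X,d)$ is an $n$-point metric space and $T\in\mathbb N$ a deadline. Each point $u\in X$ has two states $\mathrm{ON}^{(u)},\mathrm{OFF}^{(u)}$. The allocation set is $\mathcal X=\{\mathbf x\in[0,1]^{2n}: x^{\mathrm{ON}^{(u)}}+x^{\mathrm{OFF}^{(u)}}\in\{0,1\}\ \forall u\in X,\ \|\mathbf x\|_1=1\}$; the location of $\mathbf x_t$ is the point $u_t$ with $x_t^{\mathrm{ON}^{(u_t)}}+x_t^{\mathrm{OFF}^{(u_t)}}=1$. The constraint function is $c(\mathbf x)=\sum_u c^{(u)}x^{\mathrm{ON}^{(u)}}$ with known throughput constants $c^{(u)}\in(0,1]$. The service cost is $f_t(\mathbf x)=\sum_u f_t^{(u)}x^{\mathrm{ON}^{(u)}}$. The switching cost is $g(\mathbf x_t,\mathbf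 x_{t-1})=d(u_{t-1},u_t)+\sum_{u}\beta^{(u)}|x_t^{\mathrm{ON}^{(u)}}-x_{t-1}^{\mathrm{ON}^{(u)}}|$. The player starts ($t=0$) with a full allocation at a given state $\mathrm{OFF}^{(s)}$ and must end ($t=T+1$) with the full allocation at some OFF state. The total cost $\sum_{t=1}^T f_t(\mathbf x_t)+\sum_{t=1}^{T+1}g(\mathbf x_t,\mathbf x_{t-1})$ is to be minimized subject to $\sum_{t=1}^T c(\mathbf x_t)\ge1$, $\mathbf x_t\in\mathcal X$. Online, $f_t$ is revealed at time $t$ and $\mathbf x_t$ is chosen irrevocably without knowledge of $f_{t'}$, $t'>t$; everything else ($d,c,\beta,T,L,U,\tau,D$) is known. $\mathrm{OPT}(\mathcal I)$ is the offline optimal cost on instance $\mathcal I$. **Assumptions on instances.** $f_t^{(u)}\in[c^{(u)}L,c^{(u)}U]$; $\beta^{(u)}\le\tau c^{(u)}$; $D=\sup_{u\ne v}d(u,v)/\min\{c^{(u)},c^{(v)}\}$; $D+2\tau\le U-L$. A weighted star metric is the shortest-path metric on the leaves of a star graph with positive edge weights. -}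

module Defs where

open import Algebra.Apartness.Bundles using (HeytingField; HeytingCommutativeRing)
open import Algebra.Bundles using (CommutativeRing)
import Algebra.Properties.Ring as RingProperties
import Algebra.Apartness.Properties.HeytingCommutativeRing as HeytingProperties
import Algebra.Properties.Semiring.Exp as Exp
import Algebra.Properties.Semiring.Mult as Mult
import Algebra.Properties.Semiring.Sum as Sum
open import Data.Fin.Base using (Fin; zero; suc; fromℕ; inject₁; toℕ)
open import Data.Maybe.Base using (Maybe; just; nothing)
open import Data.Nat.Base as ℕ using (ℕ; zero; suc; NonZero; _!)
open import Data.Nat.Properties using (_!≢0)
open import Data.Product.Base using (∃; ∃-syntax; _×_; _,_; proj₁; proj₂)
open import Data.Sum.Base using (_⊎_; inj₁; inj₂)
open import Data.Vec.Functional using (Vector)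
open import Data.Empty using (⊥-elim)
open import Function.Metric.Structures using (IsGeneralMetric)
open import Level using (0ℓ)
open import Relation.Binary.Core using (Rel)
open import Relation.Binary.Lattice.Structures using (IsLattice)
open import Relation.Binary.PropositionalEquality.Core using (_≡_; _≢_)
open import Relation.Binary.Structures using (IsStrictPartialOrder)
open import Relation.Nullary.Negation.Core using (¬_)
open import Relation.Unary using (Pred)

-- The real numbers, axiomatised as a Cauchy-complete Archimedean ordered
-- field.  These axioms determine ℝ up to isomorphism and are constructively
-- satisfiable (by Bishop's regular sequences of rationals), so assuming them adds
-- neither choice nor excluded middle.
record Reals : Set₁ where
  infix 4 _<_ _≤_
  infixl 6 _⊔_
  infixl 7 _⊓_

  field
    heytingField : HeytingField 0ℓ 0ℓ 0ℓ

  open HeytingField heytingField public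
    renaming (Carrier to ℝ; zero to *-zero)

  heytingRing : HeytingCommutativeRing 0ℓ 0ℓ 0ℓ
  heytingRing = HeytingField.heytingCommutativeRing heytingField

  commutativeRing : CommutativeRing 0ℓ 0ℓ
  commutativeRing = HeytingCommutativeRing.commutativeRing heytingRing

  private
    module CR = CommutativeRing commutativeRing

  open Sum CR.semiring public using (sum)
  open Exp CR.semiring public using (_^_)
  open Mult CR.semiring public using () renaming (_×_ to _·_)

  field
    _<_         : Rel ℝ 0ℓ
    _⊔_ _⊓_     : ℝ → ℝ → ℝ

  _≤_ : Rel ℝ 0ℓ
  x ≤ y = ¬ (y < x)

  ∣_∣ : ℝ → ℝ
  ∣ x ∣ = x ⊔ (- x)

  Converges : (ℕ → ℝ) → ℝ → Set
  Converges s l = ∀ ε → 0# < ε →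
    ∃[ N ] ∀ n → N ℕ.≤ n → ∣ s n - l ∣ < ε

  Cauchy : (ℕ → ℝ) → Set
  Cauchy s = ∀ ε → 0# < ε →
    ∃[ N ] ∀ m n → N ℕ.≤ m → N ℕ.≤ n → ∣ s m - s n ∣ < ε

  field
    <-isStrictPartialOrder : IsStrictPartialOrder _≈_ _<_
    <⇒#         : ∀ {x y} → x < y → x # y
    #⇒<         : ∀ {x y} → x # y → x < y ⊎ y < x
    isLattice   : IsLattice _≈_ _≤_ _⊔_ _⊓_
    +-mono-<    : ∀ {x y} z → x < y → x + z < y + z
    *-pos       : ∀ {x y} → 0# < x → 0# < y → 0# < x * y
    archimedean : ∀ x → ∃[ n ] x < n · 1#
    complete    : ∀ s → Cauchy s → ∃[ l ] Converges s l

  private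
    module SPO = IsStrictPartialOrder <-isStrictPartialOrder
    module Lat = IsLattice isLattice

  <-trans : ∀ {x y z} → x < y → y < z → x < z
  <-trans = SPO.trans

  >⇒#0 : ∀ {x} → 0# < x → x # 0#
  >⇒#0 0<x = #-sym (<⇒# 0<x)

  0<1 : 0# < 1#
  0<1 with #⇒< (HeytingProperties.1#0 heytingRing)
  ... | inj₂ 0<1 = 0<1
  ... | inj₁ 1<0 = SPO.<-respʳ-≈ -1*-1≈1 (*-pos 0<-1 0<-1)
    where
    open RingProperties CR.ring using (-1*x≈-x; -‿involutive)
    0<-1 : 0# < - 1#
    0<-1 = SPO.<-respˡ-≈ (-‿inverseʳ 1#)
             (SPO.<-respʳ-≈ (+-identityˡ (- 1#)) (+-mono-< (- 1#) 1<0))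
    -1*-1≈1 : - 1# * - 1# ≈ 1#
    -1*-1≈1 = trans (-1*x≈-x (- 1#)) (-‿involutive 1#)

  0<n·1 : ∀ n → 0# < suc n · 1#
  0<n·1 zero    = SPO.<-respʳ-≈ (sym (+-identityʳ 1#)) 0<1
  0<n·1 (suc n) = <-trans (0<n·1 n)
    (SPO.<-respˡ-≈ (+-identityˡ (suc n · 1#)) (+-mono-< (suc n · 1#) 0<1))

  ·1#0 : ∀ n .{{_ : NonZero n}} → n · 1# # 0#
  ·1#0 (suc n) = >⇒#0 (0<n·1 n)

  ⊓-pos : ∀ {x y} → 0# < x → 0# < y → 0# < x ⊓ y
  ⊓-pos {x} {y} 0<x 0<y
    with below 0<x (Lat.x∧y≤x x y) | below 0<y (Lat.x∧y≤y x y)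
    where
    below : ∀ {z} → 0# < z → x ⊓ y ≤ z → 0# < x ⊓ y ⊎ x ⊓ y < z
    below 0<z m≤z with #-cotrans (<⇒# 0<z) (x ⊓ y)
    ... | inj₁ 0#m with #⇒< 0#m
    ...   | inj₁ 0<m = inj₁ 0<m
    ...   | inj₂ m<0 = ⊥-elim (Lat.∧-greatest (SPO.asym 0<x) (SPO.asym 0<y) m<0)
    below 0<z m≤z | inj₂ m#z with #⇒< m#z
    ...   | inj₁ m<z = inj₂ m<z
    ...   | inj₂ z<m = ⊥-elim (m≤z z<m)
  ... | inj₁ 0<m | _        = 0<m
  ... | inj₂ _   | inj₁ 0<m = 0<m
  ... | inj₂ m<x | inj₂ m<y = ⊥-elim (Lat.∧-greatest Lat.refl x≤y m<x)
    where
    x≤y : x ≤ y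
    x≤y y<x = Lat.∧-greatest (SPO.asym y<x) Lat.refl m<y

  infixl 7 _/_[_]

  _/_[_] : (x y : ℝ) → y # 0# → ℝ
  x / y [ y#0 ] = x * proj₁ (#⇒invertible y#0)

  IsExp : ℝ → ℝ → Set
  IsExp x e = Converges
    (λ N → sum {N} λ k → x ^ toℕ k / ((toℕ k !) · 1#) [ ·1#0 (toℕ k !) {{toℕ k !≢0}} ]) e

  -- The lower bound -1 ≤ w selects the principal branch.
  IsLambertW : ℝ → ℝ → Set
  IsLambertW x w = - 1# ≤ w × ∃[ e ] (IsExp w e × w * e ≈ x)

  IsGLB : Pred ℝ 0ℓ → ℝ → Set
  IsGLB P b = (∀ x → P x → b ≤ x) × (∀ b′ → (∀ x → P x → b′ ≤ x) → b′ ≤ b)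


-- A probability space presented by its expectation functional on integrable
-- random variables (a Daniell integral on a vector lattice containing the
-- constants).  Every probability measure gives one, with Integrable the usual
-- integrable functions.
record ProbabilitySpace (R : Reals) : Set₁ where
  open Reals R
  field
    Ω          : Set
    Integrable : Pred (Ω → ℝ) 0ℓ
    𝔼          : ∀ X → Integrable X → ℝ

    int-cong  : ∀ {X Y} → (∀ ω → X ω ≈ Y ω) → Integrable X → Integrable Y
    int-const : ∀ a → Integrable (λ _ → a)
    int-+     : ∀ {X Y} → Integrable X → Integrable Y → Integrable (λ ω → X ω + Y ω)
    int-*     : ∀ {X} a → Integrable X → Integrable (λ ω → a * X ω)
    int-∣∣    : ∀ {X} → Integrable X → Integrable (λ ω → ∣ X ω ∣)

    𝔼-mono  : ∀ {X Y} (iX : Integrable X) (iY : Integrable Y) →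
              (∀ ω → X ω ≤ Y ω) → 𝔼 X iX ≤ 𝔼 Y iY
    𝔼-const : ∀ a → 𝔼 (λ _ → a) (int-const a) ≈ a
    𝔼-+     : ∀ {X Y} (iX : Integrable X) (iY : Integrable Y) →
              𝔼 (λ ω → X ω + Y ω) (int-+ iX iY) ≈ 𝔼 X iX + 𝔼 Y iY
    𝔼-*     : ∀ {X} a (iX : Integrable X) →
              𝔼 (λ ω → a * X ω) (int-* a iX) ≈ a * 𝔼 X iX
    -- countable additivity
    𝔼-continuous : ∀ (X : ℕ → Ω → ℝ) (iX : ∀ k → Integrable (X k)) →
                   (∀ k ω → X (suc k) ω ≤ X k ω) →
                   (∀ ω → Converges (λ k → X k ω) 0#) →
                   Converges (λ k → 𝔼 (X k) (iX k)) 0#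


module Star (R : Reals) where
  open Reals R

  -- Walks in the star graph whose centre is `nothing` and whose leaf `just u`
  -- hangs on an edge of weight `w u`.
  data Walk {n} (w : Fin n → ℝ) : Maybe (Fin n) → Maybe (Fin n) → Set where
    stop : ∀ {x} → Walk w x x
    up   : ∀ u {y} → Walk w nothing y → Walk w (just u) y
    down : ∀ u {y} → Walk w (just u) y → Walk w nothing y

  length : ∀ {n} {w : Fin n → ℝ} {x y} → Walk w x y → ℝ
  length         stop       = 0#
  length {w = w} (up u p)   = w u + length p
  length {w = w} (down u p) = w u + length p

  IsWeightedStar : ∀ {n} → (Fin n → Fin n → ℝ) → Set
  IsWeightedStar {n} d = ∃[ w ] ((∀ u → 0# < w u) ×
    (∀ u v → (∃[ p ] d u v ≈ length {w = w} {just u} {just v} p) ×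
             (∀ (p : Walk w (just u) (just v)) → d u v ≤ length p)))


module SOAD (R : Reals) (L U τ D : Reals.ℝ R) where
  open Reals R

  record Allocation (n : ℕ) : Set where
    field
      on off   : Vector ℝ n
      on-range  : ∀ u → 0# ≤ on u × on u ≤ 1#
      off-range : ∀ u → 0# ≤ off u × off u ≤ 1#
      0-or-1   : ∀ u → on u + off u ≈ 0# ⊎ on u + off u ≈ 1#
      norm     : sum (λ u → ∣ on u ∣) + sum (λ u → ∣ off u ∣) ≈ 1#
      -- determined by the other fields
      loc      : Fin n
      loc-full : on loc + off loc ≈ 1#

  open Allocation public

  -- Everything known in advance.
  record Setup : Set where
    field
      n T      : ℕ
      d        : Fin n → Fin n → ℝ
      c β      : Vector ℝ n
      s        : Fin n
      isMetric : IsGeneralMetric _≡_ _≈_ _≤_ 0# _+_ d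
      c-pos    : ∀ u → 0# < c u
      c≤1      : ∀ u → c u ≤ 1#
      β-nonneg : ∀ u → 0# ≤ β u
      β≤τc     : ∀ u → β u ≤ τ * c u

    ratio : Fin n → Fin n → ℝ
    ratio u v = d u v / (c u ⊓ c v) [ >⇒#0 (⊓-pos (c-pos u) (c-pos v)) ]

    field
      -- D is the supremum of the ratios, taken among the nonnegative reals, so
      -- that it is 0 for a one-point space.
      D-upper : ∀ u v → u ≢ v → ratio u v ≤ D
      D-least : ∀ b → 0# ≤ b → (∀ u v → u ≢ v → ratio u v ≤ b) → D ≤ b
      -- Says exactly that some schedule meets the demand constraint.
      solvable : ∃[ u ] 1# ≤ T · c u

  module _ (S : Setup) where
    open Setup S

    -- `price t` is the service cost vector of time step 1 + t.
    record Costs : Set where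
      field
        price : Fin T → Vector ℝ n
        lower : ∀ t u → c u * L ≤ price t u
        upper : ∀ t u → price t u ≤ c u * U

    open Costs

    throughput : Allocation n → ℝ
    throughput x = sum λ u → c u * on x u

    service : Vector ℝ n → Allocation n → ℝ
    service f x = sum λ u → f u * on x u

    switching : Allocation n → Allocation n → ℝ
    switching x x⁻ = d (loc x⁻) (loc x) + sum (λ u → β u * ∣ on x u - on x⁻ u ∣)

    -- Allocations at times 0, 1, …, T + 1.
    record Schedule : Set where
      field
        at : Fin (suc (suc T)) → Allocation n

      step : Fin T → Allocation n
      step t = at (suc (inject₁ t))

      field
        starts : off (at zero) s ≈ 1#
        ends   : ∃[ u ] off (at (fromℕ (suc T))) u ≈ 1#
        demand : 1# ≤ sum (λ t → throughput (step t))

    open Schedule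

    cost : Costs → Schedule → ℝ
    cost f x = sum (λ t → service (price f t) (step x t))
             + sum (λ (t : Fin (suc T)) → switching (at x (suc t)) (at x (inject₁ t)))

    IsOptimalCost : Costs → ℝ → Set
    IsOptimalCost f = IsGLB (λ v → ∃[ x ] v ≈ cost f x)

    record RandomizedAlgorithm : Set₁ where
      field
        space : ProbabilitySpace R

      open ProbabilitySpace space public

      field
        run : Ω → Costs → Schedule

        nonanticipating : ∀ ω t (f f′ : Costs) →
          (∀ i u → suc (toℕ i) ℕ.≤ toℕ t → price f i u ≈ price f′ i u) →
          ∀ u → on  (at (run ω f) t) u ≈ on  (at (run ω f′) t) u
              × off (at (run ω f) t) u ≈ off (at (run ω f′) t) u

        on-integrable   : ∀ f t u → Integrable λ ω → on  (at (run ω f) t) u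
        off-integrable  : ∀ f t u → Integrable λ ω → off (at (run ω f) t) u
        -- Automatic for measurable allocations, as on + off is the indicator of
        -- the location.
        cost-integrable : ∀ f → Integrable λ ω → cost f (run ω f)

      expectedCost : Costs → ℝ
      expectedCost f = 𝔼 (λ ω → cost f (run ω f)) (cost-integrable f)

  open RandomizedAlgorithm public using (expectedCost)

  record Instance : Set where
    field
      setup : Setup
      costs : Costs setup

    open Setup setup public

  open Instance public using (setup; costs)

  -- Deterministic algorithms are those with a one-point sample space.
  OnlineAlgorithm : Set₁
  OnlineAlgorithm = ∀ S → RandomizedAlgorithm S

  ALG : OnlineAlgorithm → Instance → ℝ
  ALG A I = expectedCost (A (setup I)) (costs I)

  -- r is an upper bound of the ratios ALG(I)/OPT(I), as OPT(I) ≥ L > 0.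
  RatioBound : (Instance → ℝ) → OnlineAlgorithm → Pred Instance 0ℓ → ℝ → Set
  RatioBound OPT A 𝓕 r = ∀ I → 𝓕 I → ALG A I ≤ r * OPT I

-- In a space whose points have throughput c, switching constant τ c and mutual distance D c,
-- stage k offers the price U - D - 2τ - u k at few points and U elsewhere, and the instance
-- ends with the price U after an arbitrary stage.  The reduced price is placed where the
-- player is hardly ever found, so that a unit of work at this price costs the player D + 2τ
-- more, up to a small error; the player's expected behaviour in a stage does not depend on
-- when the instance ends.  The optimum moves only once, to a point where the price is reduced
-- throughout a stage, and pays about U - D - u k.  If D > 0, then c is small, the points are
-- strings of digits, and step t reduces the price at the points with a given t-th digit,
-- selected against the player.  If D = 0, then the star has a single point, and a stage waits
-- for a moment at which the player is probably OFF.
--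
-- If x k is the expected work done at the reduced price of stage k, a ratio r thus forces
-- U max(1, x 0 + … + x k) - (u 0 x 0 + … + u k x k) ≤ r (U - D - u k) for all k, up to a small
-- error.  For a geometric sequence u that grows to U - D - L - 2τ, summation by parts
-- eliminates x.  Refining the sequence turns its powers into exponentials, and the definition
-- of W contradicts r < η.
module Submission where

open import Defs
open import Algebra.Bundles using (CommutativeRing)
import Algebra.Properties.CommutativeSemiring.Exp as Exp
import Algebra.Properties.Ring as RingProperties
import Algebra.Properties.Semiring.Mult as Mult
import Algebra.Properties.Semiring.Mult.TCOptimised as TCMult
import Algebra.Properties.Semiring.Sum as Sum
import Algebra.Solver.Ring as RingSolver
open import Algebra.Solver.Ring.AlmostCommutativeRing
  using (AlmostCommutativeRing; fromCommutativeRing; _-Raw-AlmostCommutative⟶_)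
open import Data.Bool.Base using (Bool; true; false; if_then_else_; _∧_; not; T)
import Data.Bool.Properties as Bool
open import Data.Empty using (⊥; ⊥-elim)
open import Data.Fin.Base as Fin
  using (Fin; zero; suc; inject₁; fromℕ; fromℕ<; toℕ; _↑ˡ_; _↑ʳ_; combine; remQuot; finToFun;
    funToFin)
import Data.Fin.Properties as Fin
open import Data.Integer.Base as ℤ using (ℤ; 0ℤ; 1ℤ; +_; -[1+_])
import Data.Integer.Properties as ℤ
open import Data.Maybe.Base using (Maybe; just; nothing)
open import Data.Nat.Base as ℕ using (ℕ; zero; suc; NonZero; _!)
import Data.Nat.DivMod as ℕ
import Data.Nat.Properties as ℕ
open import Data.Product.Base using (∃; ∃-syntax; _×_; _,_; proj₁; proj₂)
open import Data.Sum.Base using (_⊎_; inj₁; inj₂; [_,_]′)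
open import Data.Vec.Functional using (Vector; updateAt)
open import Data.Vec.Functional.Properties using (updateAt-updates; updateAt-minimal)
open import Data.Vec.N-ary using (N-ary; Eq; curryⁿ; curryⁿ-cong)
open import Function.Base using (_∘_)
open import Function.Bundles using (Equivalence)
open import Level using (0ℓ)
open import Relation.Binary.Lattice.Structures using (IsLattice)
open import Relation.Binary.PropositionalEquality.Core as ≡ using (_≡_; _≢_)
import Relation.Binary.PropositionalEquality.Properties as ≡
import Relation.Binary.Reflection as Reflection
open import Relation.Binary.Structures using (IsStrictPartialOrder)
open import Relation.Nullary.Decidable using (Dec; does; yes; no; dec-true; dec-false)
open import Relation.Nullary.Negation.Core using (¬_)
open import Relation.Unary using (Pred)

-- The obstacle is that the optimum sits still while the player has to be chased: the cheap sets
-- must avoid the player at every step, however it reacts, and still share a point for a whole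
-- stage. With one digit per step, any choice of digits is realised by a point, and the digits can
-- be chosen one after the other. The optimum pays its travel cost D c once for a unit of work,
-- which is negligible for small c; the player pays it for every step of cheap work, thus D per
-- unit. Distinct points have positive distance, so D = 0 forces a single point and leaves nowhere
-- to hide. Waiting is harmless there: a player that is ON for long works a lot, while a finite
-- ratio limits its cost.
--
-- The sign of D cannot be decided. But `η ≤ r` is a negation, so the cases 0 < D and D = 0 can be
-- refuted in turn, and doubly negated existence suffices.
--
-- Exponentials are needed only where the statement supplies them, at (D - U) / U and at w; both
-- arguments lie in [-1, 0], where exp is obtained as a limit of powers.

module RealRing (R : Reals) where
  open Reals R
  open RingProperties (CommutativeRing.ring commutativeRing)
    using (-‿involutive; -0#≈0#; -‿distribˡ-*; -‿+-comm)
  private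
    module T = TCMult (CommutativeRing.semiring commutativeRing)
    open T using () renaming (_×_ to _×′_)

    ℝᵃ : AlmostCommutativeRing _ _
    ℝᵃ = fromCommutativeRing commutativeRing

    -- Coefficients are integers because equality of reals is undecidable. The optimised multiple
    -- makes `1ℤ` denote `1#` itself, so that `con 1ℤ` fits goals that mention `1#`.
    ⟦_⟧ℤ : ℤ → ℝ
    ⟦ + n ⟧ℤ      = n ×′ 1#
    ⟦ -[1+ n ] ⟧ℤ = - (suc n ×′ 1#)

    cancel-suc : ∀ a b → (1# + a) - (1# + b) ≈ a - b
    cancel-suc a b = begin
      (1# + a) + - (1# + b)      ≈⟨ +-cong (+-comm 1# a) (sym (-‿+-comm 1# b)) ⟩
      (a + 1#) + (- 1# + - b)    ≈⟨ +-assoc a 1# _ ⟩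
      a + (1# + (- 1# + - b))    ≈⟨ +-congˡ (+-assoc 1# (- 1#) (- b)) ⟨
      a + ((1# + - 1#) + - b)    ≈⟨ +-congˡ (+-congʳ (-‿inverseʳ 1#)) ⟩
      a + (0# + - b)             ≈⟨ +-congˡ (+-identityˡ (- b)) ⟩
      a - b                      ∎
      where open import Relation.Binary.Reasoning.Setoid setoid

    ⊖-homo : ∀ m n → ⟦ m ℤ.⊖ n ⟧ℤ ≈ m ×′ 1# - n ×′ 1#
    ⊖-homo zero    zero    = sym (-‿inverseʳ 0#)
    ⊖-homo zero    (suc n) = sym (+-identityˡ _)
    ⊖-homo (suc m) zero    = sym (trans (+-congˡ -0#≈0#) (+-identityʳ _))
    ⊖-homo (suc m) (suc n) rewrite ℤ.[1+m]⊖[1+n]≡m⊖n m n =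
      trans (⊖-homo m n) (sym (trans
        (+-cong (T.1+× m 1#) (-‿cong (T.1+× n 1#))) (cancel-suc _ _)))

    ℤ+-homo : ∀ i j → ⟦ i ℤ.+ j ⟧ℤ ≈ ⟦ i ⟧ℤ + ⟦ j ⟧ℤ
    ℤ+-homo (+ m)    (+ n)    = T.×-homo-+ 1# m n
    ℤ+-homo (+ m)    -[1+ n ] = ⊖-homo m (suc n)
    ℤ+-homo -[1+ m ] (+ n)    = trans (⊖-homo n (suc m)) (+-comm _ _)
    ℤ+-homo -[1+ m ] -[1+ n ] =
      trans (reflexive (≡.cong (λ k → - (suc k ×′ 1#)) (≡.sym (ℕ.+-suc m n))))
        (trans (-‿cong (T.×-homo-+ 1# (suc m) (suc n))) (sym (-‿+-comm _ _)))

    neg-homo : ∀ i → ⟦ ℤ.- i ⟧ℤ ≈ - ⟦ i ⟧ℤ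
    neg-homo (+ zero)  = sym -0#≈0#
    neg-homo (+ suc n) = refl
    neg-homo -[1+ n ]  = sym (-‿involutive _)

    pos*-homo : ∀ m j → ⟦ + m ℤ.* j ⟧ℤ ≈ ⟦ + m ⟧ℤ * ⟦ j ⟧ℤ
    pos*-homo zero j rewrite ℤ.*-zeroˡ j = sym (zeroˡ _)
    pos*-homo (suc m) j rewrite ℤ.suc-* (+ m) j = begin
      ⟦ j ℤ.+ + m ℤ.* j ⟧ℤ           ≈⟨ ℤ+-homo j (+ m ℤ.* j) ⟩
      ⟦ j ⟧ℤ + ⟦ + m ℤ.* j ⟧ℤ        ≈⟨ +-cong (sym (*-identityˡ _)) (pos*-homo m j) ⟩
      1# * ⟦ j ⟧ℤ + m ×′ 1# * ⟦ j ⟧ℤ ≈⟨ distribʳ _ _ _ ⟨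
      (1# + m ×′ 1#) * ⟦ j ⟧ℤ        ≈⟨ *-congʳ (T.1+× m 1#) ⟨
      suc m ×′ 1# * ⟦ j ⟧ℤ           ∎
      where open import Relation.Binary.Reasoning.Setoid setoid

    ℤ*-homo : ∀ i j → ⟦ i ℤ.* j ⟧ℤ ≈ ⟦ i ⟧ℤ * ⟦ j ⟧ℤ
    ℤ*-homo (+ m)    j = pos*-homo m j
    ℤ*-homo -[1+ m ] j rewrite ≡.sym (ℤ.neg-distribˡ-* (+ suc m) j) =
      trans (neg-homo (+ suc m ℤ.* j))
        (trans (-‿cong (pos*-homo (suc m) j)) (-‿distribˡ-* _ _))

    ℤ⟶ℝ : ℤ.+-*-rawRing -Raw-AlmostCommutative⟶ ℝᵃ
    ℤ⟶ℝ = record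
      { ⟦_⟧    = ⟦_⟧ℤ
      ; +-homo = ℤ+-homo
      ; *-homo = ℤ*-homo
      ; -‿homo = neg-homo
      ; 0-homo = refl
      ; 1-homo = refl
      }

    _≟′_ : ∀ i j → Maybe (⟦ i ⟧ℤ ≈ ⟦ j ⟧ℤ)
    i ≟′ j with i ℤ.≟ j
    ... | yes i≡j = just (reflexive (≡.cong ⟦_⟧ℤ i≡j))
    ... | no _    = nothing

  private
    module Solver = RingSolver ℤ.+-*-rawRing ℝᵃ ℤ⟶ℝ _≟′_
    open Solver using (Polynomial; normalise; correct; ⟦_⟧; ⟦_⟧↓)
    open Reflection setoid Solver.var ⟦_⟧ ⟦_⟧↓ correct using (close)

  open Solver public using (_:=_; _:+_; _:*_; _:-_; :-_; con)

  -- Comparing the closed normal forms is much cheaper than comparing their values,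
  -- as Solver.solve does.
  ring : ∀ n (f : N-ary n (Polynomial n) (Polynomial n × Polynomial n)) →
         normalise (proj₁ (close n f)) ≡ normalise (proj₂ (close n f)) →
         Eq n _≈_ (curryⁿ ⟦ proj₁ (close n f) ⟧) (curryⁿ ⟦ proj₂ (close n f) ⟧)
  ring n f eq = curryⁿ-cong _≈_ ⟦ p ⟧ ⟦ q ⟧ λ ρ →
    trans (sym (correct p ρ))
      (trans (reflexive (≡.cong (λ r → Solver.⟦_⟧N r ρ) eq)) (correct q ρ))
    where
    p = proj₁ (close n f)
    q = proj₂ (close n f)

-- Order, absolute value and two-sided approximation

module RealOrder (R : Reals) where
  open Reals R
  open RealRing R
  private
    module SPO = IsStrictPartialOrder <-isStrictPartialOrder
    module Lat = IsLattice isLattice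

  open SPO public using (<-respˡ-≈; <-respʳ-≈) renaming (asym to <-asym)
  open Lat public using (x≤x∨y; y≤x∨y; ∨-least; x∧y≤x; x∧y≤y; ∧-greatest)
    renaming (refl to ≤-refl; trans to ≤-trans; reflexive to ≤-reflexive; antisym to ≤-antisym;
              isPartialOrder to ≤-isPartialOrder)

  <-irrefl : ∀ {x} → ¬ (x < x)
  <-irrefl = SPO.irrefl refl

  <⇒≤ : ∀ {x y} → x < y → x ≤ y
  <⇒≤ = <-asym

  ≤-respˡ-≈ : ∀ {x y z} → x ≈ y → x ≤ z → y ≤ z
  ≤-respˡ-≈ p q = ≤-trans (≤-reflexive (sym p)) q

  ≤-respʳ-≈ : ∀ {x y z} → x ≈ y → z ≤ x → z ≤ y
  ≤-respʳ-≈ p q = ≤-trans q (≤-reflexive p)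

  -- As `≤` is only a negation, strictness is recovered from cotransitivity, by comparing z with
  -- both ends of x < y.
  <-≤-trans : ∀ {x y z} → x < y → y ≤ z → x < z
  <-≤-trans {x} {y} {z} x<y y≤z with #-cotrans (<⇒# x<y) z
  ... | inj₁ x#z with #⇒< x#z
  ...   | inj₁ x<z = x<z
  ...   | inj₂ z<x = ⊥-elim (y≤z (<-trans z<x x<y))
  <-≤-trans {x} {y} {z} x<y y≤z | inj₂ z#y with #⇒< z#y
  ...   | inj₁ z<y = ⊥-elim (y≤z z<y)
  ...   | inj₂ y<z = <-trans x<y y<z

  +-mono-≤ˡ : ∀ {x y} z → x ≤ y → x + z ≤ y + z
  +-mono-≤ˡ {x} {y} z x≤y y+z<x+z =
    x≤y (<-respˡ-≈ (shift y) (<-respʳ-≈ (shift x) (+-mono-< (- z) y+z<x+z)))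
    where
    shift : ∀ w → w + z - z ≈ w
    shift w = ring 2 (λ w z → w :+ z :- z := w) ≡.refl w z

  0≤⇒≤ : ∀ {x y} → 0# ≤ y - x → x ≤ y
  0≤⇒≤ {x} {y} p = ≤-respˡ-≈ (+-identityˡ x)
    (≤-respʳ-≈ (ring 2 (λ x y → y :- x :+ x := y) ≡.refl x y) (+-mono-≤ˡ x p))

  ≤⇒0≤ : ∀ {x y} → x ≤ y → 0# ≤ y - x
  ≤⇒0≤ {x} {y} p = ≤-respˡ-≈ (-‿inverseʳ x) (+-mono-≤ˡ (- x) p)

  <⇒0< : ∀ {x y} → x < y → 0# < y - x
  <⇒0< {x} {y} p = <-respˡ-≈ (-‿inverseʳ x) (+-mono-< (- x) p)

  0<⇒< : ∀ {x y} → 0# < y - x → x < y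
  0<⇒< {x} {y} p = <-respˡ-≈ (+-identityˡ x)
    (<-respʳ-≈ (ring 2 (λ x y → y :- x :+ x := y) ≡.refl x y) (+-mono-< x p))

  -- Inequalities are derived from a certificate: the difference of the two sides as
  -- a combination of quantities of known sign.
  ≤-by : ∀ {x y z} → 0# ≤ z → z ≈ y - x → x ≤ y
  ≤-by p q = 0≤⇒≤ (≤-respʳ-≈ q p)

  <-by : ∀ {x y z} → 0# < z → z ≈ y - x → x < y
  <-by p q = 0<⇒< (<-respʳ-≈ q p)

  +-nonneg : ∀ {x y} → 0# ≤ x → 0# ≤ y → 0# ≤ x + y
  +-nonneg {x} {y} p q = ≤-trans q (≤-respˡ-≈ (+-identityˡ y) (+-mono-≤ˡ y p))

  +-mono-≤ : ∀ {a b c d} → a ≤ b → c ≤ d → a + c ≤ b + d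
  +-mono-≤ {a} {b} {c} {d} p q = ≤-by (+-nonneg (≤⇒0≤ p) (≤⇒0≤ q))
    (ring 4 (λ a b c d → (b :- a) :+ (d :- c) := (b :+ d) :- (a :+ c)) ≡.refl a b c d)

  +-pos-nonneg : ∀ {x y} → 0# < x → 0# ≤ y → 0# < x + y
  +-pos-nonneg {x} {y} p q = <-≤-trans p (≤-by q (ring 2 (λ x y → y := (x :+ y) :- x) ≡.refl x y))

  invertible⇒#0 : ∀ {x y} → x * y ≈ 1# → x # 0#
  invertible⇒#0 {x} {y} p = invertible⇒#
    ( y , trans (ring 2 (λ x y → y :* (x :- con 0ℤ) := x :* y) ≡.refl x y) p
    , trans (ring 2 (λ x y → (x :- con 0ℤ) :* y := x :* y) ≡.refl x y) p)

  *-#0ˡ : ∀ {x y} → x * y # 0# → x # 0#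
  *-#0ˡ {x} {y} p with #⇒invertible p
  ... | i , _ , r = invertible⇒#0 (trans (ring 3
    (λ x y i → x :* (y :* i) := (x :* y :- con 0ℤ) :* i) ≡.refl x y i) r)

  *-#0ʳ : ∀ {x y} → x * y # 0# → y # 0#
  *-#0ʳ {x} {y} p with #⇒invertible p
  ... | i , _ , r = invertible⇒#0 (trans (ring 3
    (λ x y i → y :* (x :* i) := (x :* y :- con 0ℤ) :* i) ≡.refl x y i) r)

  -- Once x y < 0 is assumed, x y is apart from 0, hence so are both factors, and their signs can be
  -- decided.
  *-nonneg : ∀ {x y} → 0# ≤ x → 0# ≤ y → 0# ≤ x * y
  *-nonneg {x} {y} 0≤x 0≤y xy<0 =
    [ 0≤x , (λ 0<x → [ 0≤y , (λ 0<y → <-asym xy<0 (*-pos 0<x 0<y)) ]′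
      (#⇒< (*-#0ʳ (<⇒# xy<0)))) ]′ (#⇒< (*-#0ˡ (<⇒# xy<0)))

  *-monoˡ-≤ : ∀ {x y z} → 0# ≤ z → x ≤ y → z * x ≤ z * y
  *-monoˡ-≤ {x} {y} {z} p q = ≤-by (*-nonneg p (≤⇒0≤ q))
    (ring 3 (λ x y z → z :* (y :- x) := z :* y :- z :* x) ≡.refl x y z)

  neg-nonneg : ∀ {x} → x ≤ 0# → 0# ≤ - x
  neg-nonneg {x} p = ≤-respʳ-≈ (ring 1 (λ x → con 0ℤ :- x := :- x) ≡.refl x) (≤⇒0≤ p)

  0≤1 : 0# ≤ 1#
  0≤1 = <⇒≤ 0<1

  *-cancel-pos : ∀ {x y} → 0# < x → 0# ≤ x * y → 0# ≤ y
  *-cancel-pos {x} {y} 0<x p y<0 = p (<-by (*-pos 0<x (<⇒0< y<0))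
    (ring 2 (λ x y → x :* (con 0ℤ :- y) := con 0ℤ :- x :* y) ≡.refl x y))

  *-cancel-pos-≤ : ∀ {x y z} → 0# < x → x * y ≤ x * z → y ≤ z
  *-cancel-pos-≤ {x} {y} {z} 0<x p = 0≤⇒≤ (*-cancel-pos 0<x
    (≤-respʳ-≈ (ring 3 (λ x y z → x :* z :- x :* y := x :* (z :- y)) ≡.refl x y z) (≤⇒0≤ p)))

  infix 8 _⁻¹[_]
  _⁻¹[_] : ∀ x → x # 0# → ℝ
  x ⁻¹[ p ] = proj₁ (#⇒invertible p)

  *-inverseʳ : ∀ {x} (p : x # 0#) → x * x ⁻¹[ p ] ≈ 1#
  *-inverseʳ {x} p = trans (ring 2 (λ x i → x :* i := (x :- con 0ℤ) :* i) ≡.refl x (x ⁻¹[ p ]))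
                           (proj₂ (proj₂ (#⇒invertible p)))

  inverse-pos : ∀ {x y} → 0# < x → x * y ≈ 1# → 0# < y
  inverse-pos {x} {y} 0<x xy≈1 =
    [ (λ y<0 → ⊥-elim (<-asym 0<1 (<-by (*-pos 0<x (<⇒0< y<0))
        (trans (ring 2 (λ x y → x :* (con 0ℤ :- y) := con 0ℤ :- x :* y) ≡.refl x y)
          (+-congˡ (-‿cong xy≈1))))))
    , (λ 0<y → 0<y) ]′ (#⇒< (invertible⇒#0 (trans (*-comm y x) xy≈1)))

  fromℕ-nonneg : ∀ n → 0# ≤ n · 1#
  fromℕ-nonneg zero    = ≤-refl
  fromℕ-nonneg (suc n) = <⇒≤ (0<n·1 n)

  fromℕ-mono : ∀ {m n} → m ℕ.≤ n → m · 1# ≤ n · 1#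
  fromℕ-mono {n = n} ℕ.z≤n   = fromℕ-nonneg n
  fromℕ-mono (ℕ.s≤s p) = +-mono-≤ ≤-refl (fromℕ-mono p)

  1≤fromℕ-suc : ∀ n → 1# ≤ suc n · 1#
  1≤fromℕ-suc n = ≤-by (fromℕ-nonneg n) (ring 1 (λ n → n := (con 1ℤ :+ n) :- con 1ℤ)
    ≡.refl (n · 1#))

  ½ : ℝ
  ½ = (2 · 1#) ⁻¹[ ·1#0 2 ]

  ½+½≈1 : ½ + ½ ≈ 1#
  ½+½≈1 = trans (ring 1 (λ h → h :+ h := (con 1ℤ :+ (con 1ℤ :+ con 0ℤ)) :* h) ≡.refl ½)
    (*-inverseʳ (·1#0 2))

  0<½ : 0# < ½
  0<½ = inverse-pos (0<n·1 1) (*-inverseʳ (·1#0 2))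

  half+half : ∀ x → ½ * x + ½ * x ≈ x
  half+half x = trans (ring 2 (λ h x → h :* x :+ h :* x := (h :+ h) :* x) ≡.refl ½ x)
                      (trans (*-congʳ ½+½≈1) (*-identityˡ x))

  -- If y < x, then ε = (x - y) / (1 + c) gives c ε < x - y. The denominator 1 + c is positive also
  -- for c = 0.
  ≤-limit : ∀ {x y c} → 0# ≤ c → (∀ ε → 0# < ε → x ≤ y + c * ε) → x ≤ y
  ≤-limit {x} {y} {c} 0≤c f y<x = f (gap * j) (*-pos 0<gap 0<j)
    (<-by (*-pos 0<gap 0<j) (trans
      (ring 3 (λ g j c → g :* j := g :* (j :* (con 1ℤ :+ c)) :- c :* (g :* j)) ≡.refl gap j c)
      (trans (+-congʳ (trans (*-congˡ j*[1+c]≈1) (*-identityʳ gap)))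
        (ring 3 (λ x y z → x :- y :- z := x :- (y :+ z)) ≡.refl x y (c * (gap * j))))))
    where
    gap = x - y
    0<gap = <⇒0< y<x
    0<1+c = +-pos-nonneg 0<1 0≤c
    j = (1# + c) ⁻¹[ >⇒#0 0<1+c ]
    j*[1+c]≈1 : j * (1# + c) ≈ 1#
    j*[1+c]≈1 = trans (*-comm _ _) (*-inverseʳ (>⇒#0 0<1+c))
    0<j = inverse-pos 0<1+c (*-inverseʳ (>⇒#0 0<1+c))

  -- Turns a required accuracy into a number of steps or digits, which has to be positive.
  archimedean′ : ∀ c {ε} → 0# < ε → ∃[ n ] c ≤ (suc n · 1#) * ε
  archimedean′ c {ε} 0<ε with archimedean (c * i)
    where i = ε ⁻¹[ >⇒#0 0<ε ]
  ... | n , p = n , ≤-by (+-nonneg (<⇒≤ (*-pos 0<ε (<⇒0< p))) (<⇒≤ 0<ε))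
      (trans (ring 4 (λ c ε i n → ε :* (n :- c :* i) :+ ε := (con 1ℤ :+ n) :* ε :- c :* (ε :* i))
        ≡.refl c ε i (n · 1#))
        (+-congˡ (-‿cong (trans (*-congˡ (*-inverseʳ (>⇒#0 0<ε))) (*-identityʳ c)))))
    where i = ε ⁻¹[ >⇒#0 0<ε ]

  ≤∣∣ : ∀ x → x ≤ ∣ x ∣
  ≤∣∣ x = x≤x∨y x (- x)

  neg≤∣∣ : ∀ x → - x ≤ ∣ x ∣
  neg≤∣∣ x = y≤x∨y x (- x)

  ∣∣≤ : ∀ {x y} → x ≤ y → - x ≤ y → ∣ x ∣ ≤ y
  ∣∣≤ = ∨-least

  0≤∣∣ : ∀ x → 0# ≤ ∣ x ∣
  0≤∣∣ x = ≤-respʳ-≈ (half+half ∣ x ∣) (≤-respˡ-≈ (zeroʳ ½)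
    (≤-respʳ-≈ (distribˡ ½ ∣ x ∣ ∣ x ∣) (*-monoˡ-≤ (<⇒≤ 0<½)
      (≤-respˡ-≈ (-‿inverseʳ x) (+-mono-≤ (≤∣∣ x) (neg≤∣∣ x))))))

  nonneg⇒∣∣≈ : ∀ {x} → 0# ≤ x → ∣ x ∣ ≈ x
  nonneg⇒∣∣≈ {x} p = ≤-antisym
    (∣∣≤ ≤-refl (≤-by (+-nonneg p p) (ring 1 (λ x → x :+ x := x :- (:- x)) ≡.refl x))) (≤∣∣ x)

  -- Two inequalities instead of a bound on an absolute value, as each of them enters a certificate
  -- as it is.
  Near : ℝ → ℝ → ℝ → Set
  Near x y ε = (x ≤ y + ε) × (y ≤ x + ε)

  Near-refl : ∀ {x y} → x ≈ y → Near x y 0#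
  Near-refl p = ≤-reflexive (trans p (sym (+-identityʳ _)))
              , ≤-reflexive (trans (sym p) (sym (+-identityʳ _)))

  Near-sym : ∀ {x y ε} → Near x y ε → Near y x ε
  Near-sym (p , q) = q , p

  Near-trans : ∀ {x y z ε δ} → Near x y ε → Near y z δ → Near x z (ε + δ)
  Near-trans {x} {y} {z} {ε} {δ} (p , q) (p′ , q′) =
      ≤-by (+-nonneg (≤⇒0≤ p) (≤⇒0≤ p′))
        (ring 5 (λ x y z ε δ → (y :+ ε :- x) :+ (z :+ δ :- y) := (z :+ (ε :+ δ)) :- x)
          ≡.refl x y z ε δ)
    , ≤-by (+-nonneg (≤⇒0≤ q) (≤⇒0≤ q′))
        (ring 5 (λ x y z ε δ → (x :+ ε :- y) :+ (y :+ δ :- z) := (x :+ (ε :+ δ)) :- z)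
          ≡.refl x y z ε δ)

  Near-+ : ∀ {x y z w ε δ} → Near x y ε → Near z w δ → Near (x + z) (y + w) (ε + δ)
  Near-+ {x} {y} {z} {w} {ε} {δ} (p , q) (p′ , q′) =
      ≤-by (+-nonneg (≤⇒0≤ p) (≤⇒0≤ p′))
        (ring 6 (λ x y z w ε δ → (y :+ ε :- x) :+ (w :+ δ :- z)
          := (y :+ w :+ (ε :+ δ)) :- (x :+ z)) ≡.refl x y z w ε δ)
    , ≤-by (+-nonneg (≤⇒0≤ q) (≤⇒0≤ q′))
        (ring 6 (λ x y z w ε δ → (x :+ ε :- y) :+ (z :+ δ :- w)
          := (x :+ z :+ (ε :+ δ)) :- (y :+ w)) ≡.refl x y z w ε δ)

  Near-weaken : ∀ {x y ε δ} → ε ≤ δ → Near x y ε → Near x y δ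
  Near-weaken ε≤δ (p , q) = ≤-trans p (+-mono-≤ ≤-refl ε≤δ)
                          , ≤-trans q (+-mono-≤ ≤-refl ε≤δ)

  Near-* : ∀ {a x y ε} → 0# ≤ a → Near x y ε → Near (a * x) (a * y) (a * ε)
  Near-* {a} {x} {y} {ε} 0≤a (p , q) =
      ≤-respʳ-≈ (distribˡ a y ε) (*-monoˡ-≤ 0≤a p)
    , ≤-respʳ-≈ (distribˡ a x ε) (*-monoˡ-≤ 0≤a q)

  Near-neg : ∀ {x y ε} → Near x y ε → Near (- x) (- y) ε
  Near-neg {x} {y} {ε} (p , q) =
      ≤-by (≤⇒0≤ q) (ring 3 (λ x y ε → x :+ ε :- y := (:- y :+ ε) :- (:- x)) ≡.refl x y ε)
    , ≤-by (≤⇒0≤ p) (ring 3 (λ x y ε → y :+ ε :- x := (:- x :+ ε) :- (:- y)) ≡.refl x y ε)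

  Near-resp : ∀ {x x′ y y′ ε ε′} → x ≈ x′ → y ≈ y′ → ε ≈ ε′ → Near x y ε → Near x′ y′ ε′
  Near-resp p q r (s , t) = ≤-respˡ-≈ p (≤-respʳ-≈ (+-cong q r) s)
                          , ≤-respˡ-≈ q (≤-respʳ-≈ (+-cong p r) t)

  -- Division by a ≥ 1 can only reduce the error.
  Near-cancel : ∀ {a x y ε} → 1# ≤ a → 0# ≤ ε → Near (a * x) (a * y) ε → Near x y ε
  Near-cancel {a} {x} {y} {ε} 1≤a 0≤ε (p , q) = half p , half q
    where
    0<a = <-≤-trans 0<1 1≤a
    half : ∀ {x y} → a * x ≤ a * y + ε → x ≤ y + ε
    half {x} {y} p = *-cancel-pos-≤ 0<a (≤-by (+-nonneg (≤⇒0≤ p) (*-nonneg (≤⇒0≤ 1≤a) 0≤ε))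
      (ring 4 (λ a x y ε → (a :* y :+ ε :- a :* x) :+ (a :- con 1ℤ) :* ε
        := a :* (y :+ ε) :- a :* x) ≡.refl a x y ε))

  converges⇒Near : ∀ {s l} → Converges s l → ∀ ε → 0# < ε →
    ∃[ N ] ∀ n → N ℕ.≤ n → Near (s n) l ε
  converges⇒Near {s} {l} conv ε 0<ε with conv ε 0<ε
  ... | N , f = N , λ n N≤n →
      ≤-by (≤⇒0≤ (≤-trans (≤∣∣ _) (<⇒≤ (f n N≤n))))
        (ring 3 (λ x l ε → ε :- (x :- l) := (l :+ ε) :- x) ≡.refl (s n) l ε)
    , ≤-by (≤⇒0≤ (≤-trans (neg≤∣∣ _) (<⇒≤ (f n N≤n))))
        (ring 3 (λ x l ε → ε :- (:- (x :- l)) := (x :+ ε) :- l) ≡.refl (s n) l ε)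

  converges-resp : ∀ {s s′ l} → (∀ n → s n ≈ s′ n) → Converges s l → Converges s′ l
  converges-resp {s} {s′} {l} eq conv ε 0<ε with conv ε 0<ε
  ... | N , f = N , λ n N≤n → <-respˡ-≈ (∣∣-cong (+-congʳ (eq n))) (f n N≤n)
    where
    ∣∣-cong : ∀ {x y} → x ≈ y → ∣ x ∣ ≈ ∣ y ∣
    ∣∣-cong {x} {y} p = ≤-antisym (half p) (half (sym p))
      where
      half : ∀ {x y} → x ≈ y → ∣ x ∣ ≤ ∣ y ∣
      half {x} {y} p = ∣∣≤ (≤-trans (≤-reflexive p) (≤∣∣ y))
                           (≤-trans (≤-reflexive (-‿cong p)) (neg≤∣∣ y))

-- Finite sums and indicators

module RealSum (R : Reals) where
  open Reals R
  open RealRing R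
  open RealOrder R
  open Sum (CommutativeRing.semiring commutativeRing) public
    using (∑-comm; sum-init-last)
  private
    module S = Sum (CommutativeRing.semiring commutativeRing)

  sum-cong : ∀ {n} {f g : Fin n → ℝ} → (∀ i → f i ≈ g i) → sum f ≈ sum g
  sum-cong = S.sum-cong-≋

  sum-+ : ∀ {n} (f g : Fin n → ℝ) → sum (λ i → f i + g i) ≈ sum f + sum g
  sum-+ = S.∑-distrib-+

  sum-* : ∀ {n} c (f : Fin n → ℝ) → sum (λ i → c * f i) ≈ c * sum f
  sum-* c f = sym (S.*-distribˡ-sum c f)

  sum-const : ∀ n c → sum {n} (λ _ → c) ≈ (n · 1#) * c
  sum-const zero    c = sym (zeroˡ c)
  sum-const (suc n) c = trans (+-congˡ (sum-const n c))
    (ring 2 (λ c n → c :+ n :* c := (con 1ℤ :+ n) :* c) ≡.refl c (n · 1#))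

  sum-mono : ∀ {n} {f g : Fin n → ℝ} → (∀ i → f i ≤ g i) → sum f ≤ sum g
  sum-mono {zero}  p = ≤-refl
  sum-mono {suc n} p = +-mono-≤ (p zero) (sum-mono (p ∘ suc))

  sum-0 : ∀ {n} {f : Fin n → ℝ} → (∀ i → f i ≈ 0#) → sum f ≈ 0#
  sum-0 {n} p = trans (sum-cong p) (trans (sum-const n 0#) (zeroʳ _))

  sum-nonneg : ∀ {n} {f : Fin n → ℝ} → (∀ i → 0# ≤ f i) → 0# ≤ sum f
  sum-nonneg {n} p = ≤-respˡ-≈ (sum-0 {n} (λ _ → refl)) (sum-mono p)

  ≤-sum : ∀ {n} {f : Fin n → ℝ} → (∀ i → 0# ≤ f i) → ∀ i → f i ≤ sum f
  ≤-sum {f = f} p zero    = ≤-by (sum-nonneg (p ∘ suc))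
    (ring 2 (λ a b → b := a :+ b :- a) ≡.refl (f zero) (sum (f ∘ suc)))
  ≤-sum {f = f} p (suc i) = ≤-trans (≤-sum (p ∘ suc) i) (≤-by (p zero)
    (ring 2 (λ a b → a := a :+ b :- b) ≡.refl (f zero) (sum (f ∘ suc))))

  sum-linear : ∀ {n} a (f : Fin n → ℝ) b (g : Fin n → ℝ) →
    sum (λ i → a * f i + b * g i) ≈ a * sum f + b * sum g
  sum-linear a f b g = trans (sum-+ (λ i → a * f i) (λ i → b * g i))
    (+-cong (sum-* a f) (sum-* b g))

  sum-neg : ∀ {n} (f : Fin n → ℝ) → sum (λ i → - f i) ≈ - sum f
  sum-neg f = trans (sum-cong (λ i → ring 1 (λ x → :- x := (:- con 1ℤ) :* x) ≡.refl (f i)))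
    (trans (sum-* (- 1#) f) (ring 1 (λ x → (:- con 1ℤ) :* x := :- x) ≡.refl (sum f)))

  sum-minus : ∀ {n} (f g : Fin n → ℝ) → sum (λ i → f i - g i) ≈ sum f - sum g
  sum-minus f g = trans (sum-+ f (-_ ∘ g)) (+-congˡ (sum-neg g))

  sum-telescope : ∀ {n} (h : Fin (suc n) → ℝ) →
    sum (λ (t : Fin n) → h (suc t) - h (inject₁ t)) ≈ h (fromℕ n) - h zero
  sum-telescope {zero}  h = sym (-‿inverseʳ (h zero))
  sum-telescope {suc n} h = trans (+-congˡ (sum-telescope (h ∘ suc)))
    (ring 3 (λ a b c → (b :- a) :+ (c :- b) := c :- a)
      ≡.refl (h zero) (h (suc zero)) (h (fromℕ (suc n))))

  sum-↑ : ∀ m {n} (f : Fin (m ℕ.+ n) → ℝ) →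
    sum f ≈ sum (λ i → f (i ↑ˡ n)) + sum (λ j → f (m ↑ʳ j))
  sum-↑ zero    f = sym (+-identityˡ _)
  sum-↑ (suc m) f = trans (+-congˡ (sum-↑ m (f ∘ suc))) (sym (+-assoc _ _ _))

  sum-combine : ∀ m {n} (f : Fin (m ℕ.* n) → ℝ) →
    sum f ≈ sum (λ (i : Fin m) → sum (λ (j : Fin n) → f (combine i j)))
  sum-combine zero        f = refl
  sum-combine (suc m) {n} f = trans (sum-↑ n f) (+-congˡ (sum-combine m (λ i → f (n ↑ʳ i))))

  -- The Iverson bracket: sums over a decidable set become weighted sums over all indices.
  ⟦_⟧ : Bool → ℝ
  ⟦ b ⟧ = if b then 1# else 0#

  ⟦⟧-nonneg : ∀ b → 0# ≤ ⟦ b ⟧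
  ⟦⟧-nonneg true  = 0≤1
  ⟦⟧-nonneg false = ≤-refl

  ⟦⟧-≤1 : ∀ b → ⟦ b ⟧ ≤ 1#
  ⟦⟧-≤1 true  = ≤-refl
  ⟦⟧-≤1 false = 0≤1

  ⟦∧⟧ : ∀ a b → ⟦ a ∧ b ⟧ ≈ ⟦ a ⟧ * ⟦ b ⟧
  ⟦∧⟧ true  b = sym (*-identityˡ _)
  ⟦∧⟧ false b = sym (zeroˡ _)

  ⟦⟧*≤ : ∀ b {x} → 0# ≤ x → ⟦ b ⟧ * x ≤ x
  ⟦⟧*≤ true  p = ≤-reflexive (*-identityˡ _)
  ⟦⟧*≤ false p = ≤-respˡ-≈ (sym (zeroˡ _)) p

  ⟦≟-suc⟧ : ∀ {n} (i j : Fin n) → ⟦ does (suc i Fin.≟ suc j) ⟧ ≈ ⟦ does (i Fin.≟ j) ⟧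
  ⟦≟-suc⟧ i j with i Fin.≟ j
  ... | yes _ = refl
  ... | no  _ = refl

  sum-pick : ∀ {n} (j : Fin n) (f : Fin n → ℝ) →
    sum (λ i → ⟦ does (i Fin.≟ j) ⟧ * f i) ≈ f j
  sum-pick {suc n} zero f = trans (+-cong (*-identityˡ _) (sum-0 {n} (λ i → zeroˡ (f (suc i)))))
    (+-identityʳ _)
  sum-pick (suc j) f = trans (+-cong (zeroˡ _)
      (trans (sum-cong (λ i → *-congʳ (⟦≟-suc⟧ i j))) (sum-pick j (f ∘ suc))))
    (+-identityˡ _)

  sum-≟ : ∀ {n} (j : Fin n) → sum (λ i → ⟦ does (i Fin.≟ j) ⟧) ≈ 1#
  sum-≟ {n} j = trans (sum-cong {n} (λ i → sym (*-identityʳ _))) (sum-pick j (λ _ → 1#))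

  sum-≟ʳ : ∀ {n} (j : Fin n) → sum (λ i → ⟦ does (j Fin.≟ i) ⟧) ≈ 1#
  sum-≟ʳ j = trans (sum-cong (λ i → swap i)) (sum-≟ j)
    where
    swap : ∀ i → ⟦ does (j Fin.≟ i) ⟧ ≈ ⟦ does (i Fin.≟ j) ⟧
    swap i with j Fin.≟ i | i Fin.≟ j
    ... | yes _ | yes _ = refl
    ... | no  _ | no  _ = refl
    ... | yes p | no q with () ← q (≡.sym p)
    ... | no p  | yes q with () ← p (≡.sym q)

  sum-<ᵇ : ∀ n {k} → k ℕ.≤ n → sum (λ (i : Fin n) → ⟦ toℕ i ℕ.<ᵇ k ⟧) ≈ k · 1#
  sum-<ᵇ n       {zero}  p          = sum-0 {n} (λ i → refl)
  sum-<ᵇ (suc n) {suc k} (ℕ.s≤s p) = +-congˡ (sum-<ᵇ n p)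

  ⟦<ᵇ-suc⟧ : ∀ j k → ⟦ j ℕ.<ᵇ suc k ⟧ ≈ ⟦ j ℕ.<ᵇ k ⟧ + ⟦ j ℕ.≡ᵇ k ⟧
  ⟦<ᵇ-suc⟧ zero    zero    = sym (+-identityˡ _)
  ⟦<ᵇ-suc⟧ zero    (suc k) = sym (+-identityʳ _)
  ⟦<ᵇ-suc⟧ (suc j) zero    = sym (+-identityˡ _)
  ⟦<ᵇ-suc⟧ (suc j) (suc k) = ⟦<ᵇ-suc⟧ j k

-- The exponential series on [-1, 0] as a limit of powers

module Exponential (R : Reals) where
  open Reals R
  open RealRing R
  open RealOrder R
  open RealSum R
  open Exp (CommutativeRing.commutativeSemiring commutativeRing) using (^-congˡ)
  open Mult (CommutativeRing.semiring commutativeRing) using (×1-homo-*)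

  fact : ℕ → ℝ
  fact k = (k !) · 1#

  fact#0 : ∀ k → fact k # 0#
  fact#0 k = ·1#0 (k !) {{k ℕ.!≢0}}

  1/fact : ℕ → ℝ
  1/fact k = fact k ⁻¹[ fact#0 k ]

  fact*1/fact : ∀ k → fact k * 1/fact k ≈ 1#
  fact*1/fact k = *-inverseʳ (fact#0 k)

  1≤fact : ∀ k → 1# ≤ fact k
  1≤fact k = ≤-respˡ-≈ (+-identityʳ 1#) (fromℕ-mono (ℕ.1≤n! k))

  0≤1/fact : ∀ k → 0# ≤ 1/fact k
  0≤1/fact k = <⇒≤ (inverse-pos (<-≤-trans 0<1 (1≤fact k)) (fact*1/fact k))

  1/fact≤1 : ∀ k → 1/fact k ≤ 1#
  1/fact≤1 k = ≤-by (*-nonneg (0≤1/fact k) (≤⇒0≤ (1≤fact k)))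
    (trans (ring 2 (λ i f → i :* (f :- con 1ℤ) := f :* i :- i) ≡.refl (1/fact k) (fact k))
      (+-congʳ (fact*1/fact k)))

  1/fact-suc : ∀ k → (suc k · 1#) * 1/fact (suc k) ≈ 1/fact k
  1/fact-suc k = trans
    (sym (trans (*-congˡ (fact*1/fact k)) (*-identityʳ _)))
    (trans (ring 4 (λ a j f i → a :* j :* (f :* i) := a :* f :* j :* i)
      ≡.refl (suc k · 1#) (1/fact (suc k)) (fact k) (1/fact k))
      (trans (*-congʳ (trans (*-congʳ (sym (×1-homo-* (suc k) (k !)))) (fact*1/fact (suc k))))
        (*-identityˡ _)))

  1/fact0 : 1/fact 0 ≈ 1#
  1/fact0 = trans (sym (trans (*-congʳ (+-identityʳ 1#)) (*-identityˡ _))) (fact*1/fact 0)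

  expTerm : ℝ → ℕ → ℝ
  expTerm x k = x ^ k * 1/fact k

  expSum : ℝ → ℕ → ℝ
  expSum x N = sum {N} (λ k → expTerm x (toℕ k))

  expTerm-cong : ∀ {x y} k → x ≈ y → expTerm x k ≈ expTerm y k
  expTerm-cong k p = *-congʳ (^-congˡ k p)

  expSum-cong : ∀ {x y} N → x ≈ y → expSum x N ≈ expSum y N
  expSum-cong N p = sum-cong {N} (λ k → expTerm-cong (toℕ k) p)

  IsExp-resp : ∀ {x y e} → x ≈ y → IsExp x e → IsExp y e
  IsExp-resp p = converges-resp (λ N → expSum-cong N p)

  expTerm-0 : ∀ x → expTerm x 0 ≈ 1#
  expTerm-0 x = trans (*-identityˡ _) 1/fact0

  expTerm-suc : ∀ x k → (suc k · 1#) * expTerm x (suc k) ≈ x * expTerm x k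
  expTerm-suc x k = trans
    (ring 4 (λ a x p i → a :* (x :* p :* i) := x :* (p :* (a :* i)))
      ≡.refl (suc k · 1#) x (x ^ k) (1/fact (suc k)))
    (*-congˡ (*-congˡ (1/fact-suc k)))

  expSum-suc : ∀ x N → expSum x (suc N) ≈ expSum x N + expTerm x N
  expSum-suc x N = trans (sum-init-last {N} (expTerm x ∘ toℕ))
    (+-cong (sum-cong {N} (λ i → reflexive (≡.cong (expTerm x) (Fin.toℕ-inject₁ i))))
            (reflexive (≡.cong (expTerm x) (Fin.toℕ-fromℕ N))))

  expSum-at-0 : ∀ N → expSum 0# (suc N) ≈ 1#
  expSum-at-0 N = trans (+-cong (expTerm-0 0#)
      (sum-0 {N} (λ i → trans (*-congʳ (zeroˡ _)) (zeroˡ _))))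
    (+-identityʳ 1#)

  ^-nonneg : ∀ {x} → 0# ≤ x → ∀ n → 0# ≤ x ^ n
  ^-nonneg p zero    = 0≤1
  ^-nonneg p (suc n) = *-nonneg p (^-nonneg p n)

  1≤exp : ∀ {x e} → 0# ≤ x → IsExp x e → 1# ≤ e
  1≤exp {x} {e} 0≤x isExp = ≤-limit 0≤1 λ ε 0<ε →
    let N , near = converges⇒Near isExp ε 0<ε in
    ≤-trans (≤-trans (≤-reflexive (sym (expTerm-0 x)))
        (≤-sum {suc N} {λ k → expTerm x (toℕ k)}
          (λ k → *-nonneg (^-nonneg 0≤x (toℕ k)) (0≤1/fact (toℕ k))) zero))
      (≤-trans (proj₁ (near (suc N) (ℕ.n≤1+n N))) (≤-reflexive (+-congˡ (sym (*-identityˡ ε)))))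

  bernoulli : ∀ {δ} → 0# ≤ δ → δ ≤ 1# → ∀ n → 1# - (n · 1#) * δ ≤ (1# - δ) ^ n
  bernoulli {δ} 0≤δ δ≤1 zero = ≤-reflexive (ring 1 (λ δ → con 1ℤ :- con 0ℤ :* δ := con 1ℤ) ≡.refl δ)
  bernoulli {δ} 0≤δ δ≤1 (suc n) = ≤-by
    (+-nonneg (*-nonneg (≤⇒0≤ δ≤1) (≤⇒0≤ (bernoulli 0≤δ δ≤1 n)))
              (*-nonneg (fromℕ-nonneg n) (*-nonneg 0≤δ 0≤δ)))
    (ring 3 (λ δ n p → (con 1ℤ :- δ) :* (p :- (con 1ℤ :- n :* δ)) :+ n :* (δ :* δ)
      := (con 1ℤ :- δ) :* p :- (con 1ℤ :- (con 1ℤ :+ n) :* δ)) ≡.refl δ (n · 1#) ((1# - δ) ^ n))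

  expTerm-bound : ∀ {y} → 0# ≤ y → y ≤ 1# → ∀ k → Near (expTerm (- y) k) 0# (1/fact k)
  expTerm-bound {y} 0≤y y≤1 k =
    Near-resp (*-comm _ _) (zeroʳ _) (*-identityʳ _) (Near-* (0≤1/fact k) (power k))
    where
    power : ∀ k → Near ((- y) ^ k) 0# 1#
    power zero    = ≤-reflexive (sym (+-identityˡ 1#))
                  , ≤-by (+-nonneg 0≤1 0≤1) (ring 0
                    (con 1ℤ :+ con 1ℤ := con 1ℤ :+ con 1ℤ :- con 0ℤ) ≡.refl)
    power (suc k) = Near-weaken (≤-respˡ-≈ (sym (*-identityʳ y)) y≤1)
      (Near-resp (ring 2 (λ y p → :- (y :* p) := (:- y) :* p) ≡.refl y ((- y) ^ k))
                 (ring 1 (λ y → :- (y :* con 0ℤ) := con 0ℤ) ≡.refl y) refl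
                   (Near-neg (Near-* 0≤y (power k))))

  module _ {y δ : ℝ} (0≤y : 0# ≤ y) (0≤δ : 0# ≤ δ) (y+δ≤1 : y + δ ≤ 1#) where
    private
      0≤y+δ = +-nonneg 0≤y 0≤δ
      y≤1 : y ≤ 1#
      y≤1 = ≤-trans (≤-by 0≤δ (ring 2 (λ y δ → δ := y :+ δ :- y) ≡.refl y δ)) y+δ≤1
      0≤δδ = *-nonneg 0≤δ 0≤δ

    -- First-order Taylor expansion of a single term, whose derivative is the preceding term. The
    -- induction multiplies by k + 2 and applies `expTerm-suc`. As y + δ ≤ 1, the old error does not
    -- grow; the new one is δ² times a term of size at most 1/k! ≤ 1.
    expTerm-taylor : ∀ k → Near (expTerm (- (y + δ)) (suc k))
      (expTerm (- y) (suc k) - δ * expTerm (- y) k) ((k · 1#) * (δ * δ))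
    expTerm-taylor zero = Near-resp refl (sym eq) (sym (zeroˡ _)) (Near-refl refl)
      where
      eq : expTerm (- y) 1 - δ * expTerm (- y) 0 ≈ expTerm (- (y + δ)) 1
      eq = trans (+-congˡ (-‿cong (*-congˡ (*-congˡ (sym (1/fact-suc 0))))))
        (ring 3 (λ y δ i → (:- y) :* con 1ℤ :* i :- δ :* (con 1ℤ :* ((con 1ℤ :+ con 0ℤ) :* i))
          := (:- (y :+ δ)) :* con 1ℤ :* i) ≡.refl y δ (1/fact 1))
    expTerm-taylor (suc k) = Near-cancel (1≤fromℕ-suc (suc k))
      (*-nonneg (fromℕ-nonneg (suc k)) 0≤δδ)
      (Near-weaken error
        (Near-resp (trans (ring 3 (λ a d t → :- (a :* t) :+ (:- (d :* con 0ℤ)) := (:- a) :* t)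
          ≡.refl (y + δ) (δ * δ) t′₁)
                          (sym (expTerm-suc (- (y + δ)) (suc k))))
                   (sym rhs) refl
          (Near-+ (Near-neg (Near-* 0≤y+δ (expTerm-taylor k)))
                  (Near-neg (Near-* 0≤δδ (Near-sym (expTerm-bound 0≤y y≤1 k)))))))
      where
      t₀ = expTerm (- y) k
      t₁ = expTerm (- y) (suc k)
      t₂ = expTerm (- y) (suc (suc k))
      t′₁ = expTerm (- (y + δ)) (suc k)
      rhs : (suc (suc k) · 1#) * (t₂ - δ * t₁)
            ≈ - ((y + δ) * (t₁ - δ * t₀)) + - ((δ * δ) * t₀)
      rhs = trans
        (ring 4 (λ n t₂ t₁ δ → (con 1ℤ :+ (con 1ℤ :+ n)) :* (t₂ :- δ :* t₁)
          := (con 1ℤ :+ (con 1ℤ :+ n)) :* t₂ :- δ :* ((con 1ℤ :+ n) :* t₁ :+ t₁))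
          ≡.refl (k · 1#) t₂ t₁ δ)
        (trans (+-cong (expTerm-suc (- y) (suc k))
                       (-‿cong (*-congˡ (+-congʳ (expTerm-suc (- y) k)))))
          (ring 4 (λ y δ t₁ t₀ → (:- y) :* t₁ :- δ :* ((:- y) :* t₀ :+ t₁)
            := :- ((y :+ δ) :* (t₁ :- δ :* t₀)) :+ (:- ((δ :* δ) :* t₀))) ≡.refl y δ t₁ t₀))
      error : (y + δ) * ((k · 1#) * (δ * δ)) + (δ * δ) * 1/fact k ≤ (suc k · 1#) * (δ * δ)
      error = ≤-by
        (+-nonneg (*-nonneg (≤⇒0≤ y+δ≤1) (*-nonneg (fromℕ-nonneg k) 0≤δδ))
                  (*-nonneg (≤⇒0≤ (1/fact≤1 k)) 0≤δδ))
        (ring 4 (λ a n d i → (con 1ℤ :- a) :* (n :* d) :+ (con 1ℤ :- i) :* d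
          := (con 1ℤ :+ n) :* d :- (a :* (n :* d) :+ d :* i))
          ≡.refl (y + δ) (k · 1#) (δ * δ) (1/fact k))

    expSum-taylor : ∀ M → Near (expSum (- (y + δ)) (suc M))
      (expSum (- y) (suc M) - δ * expSum (- y) M) (sum {M} (λ k → toℕ k · 1#) * (δ * δ))
    expSum-taylor zero = Near-resp refl
      (trans (+-congʳ (trans (expTerm-0 (- (y + δ))) (sym (expTerm-0 (- y)))))
        (ring 2 (λ t δ → t :+ con 0ℤ := t :+ con 0ℤ :- δ :* con 0ℤ) ≡.refl (expTerm (- y) 0) δ))
      (sym (zeroˡ _)) (Near-refl refl)
    expSum-taylor (suc M) = Near-resp
      (sym (expSum-suc (- (y + δ)) (suc M)))
      (trans
        (ring 5 (λ a b t s δ → a :- δ :* b :+ (t :- δ :* s) := (a :+ t) :- δ :* (b :+ s))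
          ≡.refl (expSum (- y) (suc M)) (expSum (- y) M) (expTerm (- y) (suc M)) (expTerm (- y) M)
          δ)
        (+-cong (sym (expSum-suc (- y) (suc M)))
                (-‿cong (*-congˡ (sym (expSum-suc (- y) M))))))
      (trans (sym (distribʳ _ _ _)) (*-congʳ (sym
        (trans (sum-init-last {M} (λ k → toℕ k · 1#))
          (+-cong (sum-cong {M} (λ i → reflexive (≡.cong (_· 1#) (Fin.toℕ-inject₁ i))))
                  (reflexive (≡.cong (_· 1#) (Fin.toℕ-fromℕ M))))))))
      (Near-+ (expSum-taylor M) (expTerm-taylor M))

    -- Completes the shorter sum in `expSum-taylor` by its missing term, of size at most 1/M!. The
    -- result is one step of Euler's method for exp.
    expSum-step : ∀ M → Near (expSum (- (y + δ)) (suc M)) ((1# - δ) * expSum (- y) (suc M))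
      (sum {M} (λ k → toℕ k · 1#) * (δ * δ) + δ * 1/fact M)
    expSum-step M = Near-resp (+-identityʳ _)
      (trans (ring 4 (λ a b t δ → a :- δ :* b :+ (:- (δ :* t)) := a :- δ :* (b :+ t))
        ≡.refl (expSum (- y) (suc M)) (expSum (- y) M) (expTerm (- y) M) δ)
        (trans (+-congˡ (-‿cong (*-congˡ (sym (expSum-suc (- y) M)))))
          (ring 2 (λ a δ → a :- δ :* a := (con 1ℤ :- δ) :* a) ≡.refl (expSum (- y) (suc M)) δ)))
      refl
      (Near-+ (expSum-taylor M)
        (Near-resp (ring 1 (λ δ → :- (δ :* con 0ℤ) := con 0ℤ) ≡.refl δ) refl refl
          (Near-neg (Near-* 0≤δ (Near-sym (expTerm-bound 0≤y y≤1 M))))))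

  -- Euler's method started at 0. Each step multiplies the accumulated error by 1 - δ ≤ 1, so n
  -- steps cost at most n times the error of one.
  expSum-iterate : ∀ M {δ} → 0# ≤ δ → δ ≤ 1# → ∀ n → (n · 1#) * δ ≤ 1# →
    Near (expSum (- ((n · 1#) * δ)) (suc M)) ((1# - δ) ^ n)
      ((n · 1#) * (sum {M} (λ k → toℕ k · 1#) * (δ * δ) + δ * 1/fact M))
  expSum-iterate M {δ} 0≤δ δ≤1 zero _ = Near-resp
    (sym (trans (expSum-cong (suc M) (ring 1 (λ δ → :- (con 0ℤ :* δ) := con 0ℤ) ≡.refl δ))
      (expSum-at-0 M)))
    refl (sym (zeroˡ _)) (Near-refl refl)
  expSum-iterate M {δ} 0≤δ δ≤1 (suc n) nδ≤1 = Near-weaken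
    (≤-by (*-nonneg 0≤δ (*-nonneg (fromℕ-nonneg n) 0≤err))
      (ring 3 (λ err δ n → δ :* (n :* err) := (con 1ℤ :+ n) :* err :-
        (err :+ (con 1ℤ :- δ) :* (n :* err))) ≡.refl err δ (n · 1#)))
    (Near-trans
      (Near-resp (expSum-cong (suc M) (-‿cong split)) refl refl
        (expSum-step (*-nonneg (fromℕ-nonneg n) 0≤δ) 0≤δ (≤-respˡ-≈ (sym split) nδ≤1) M))
      (Near-* (≤⇒0≤ δ≤1) (expSum-iterate M 0≤δ δ≤1 n
        (≤-trans (≤-by 0≤δ (ring 2 (λ δ n → δ := (con 1ℤ :+ n) :* δ :- n :* δ) ≡.refl δ (n · 1#)))
          nδ≤1))))
    where
    err = sum {M} (λ k → toℕ k · 1#) * (δ * δ) + δ * 1/fact M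
    0≤err = +-nonneg (*-nonneg (sum-nonneg {M} (λ k → fromℕ-nonneg (toℕ k))) (*-nonneg 0≤δ 0≤δ))
                     (*-nonneg 0≤δ (0≤1/fact M))
    split : (n · 1#) * δ + δ ≈ (suc n · 1#) * δ
    split = ring 2 (λ δ n → n :* δ :+ δ := (con 1ℤ :+ n) :* δ) ≡.refl δ (n · 1#)

  -- (M + 1) / (M + 1)! = 1 / M! ≤ 1, which bounds 1 / (M + 1)! by 1 / (M + 1).
  1/fact-small : ∀ {ε} → 0# < ε → ∃[ M₀ ] ∀ M → M₀ ℕ.≤ M → 1/fact (suc M) ≤ ε
  1/fact-small {ε} 0<ε = M₀ , λ M M₀≤M → *-cancel-pos-≤ (0<n·1 M)
    (≤-trans (≤-reflexive (1/fact-suc M)) (≤-trans (1/fact≤1 M) (≤-trans (proj₂ arch)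
      (≤-by (*-nonneg (≤⇒0≤ (fromℕ-mono (ℕ.s≤s M₀≤M))) (<⇒≤ 0<ε))
        (ring 3 (λ a b ε → (a :- b) :* ε := a :* ε :- b :* ε)
          ≡.refl (suc M · 1#) (suc M₀ · 1#) ε)))))
    where
    arch = archimedean′ 1# 0<ε
    M₀ = proj₁ arch

  -- Links the series in `IsExp` with the powers that a geometric sequence produces. The truncation
  -- M is fixed first, by the convergence of the series and the size of 1/M!. The discretisation
  -- error is then at most c δ with c = 0 + 1 + ... + (M - 1), which is small for all large n.
  exp≈power : ∀ {y e} → 0# ≤ y → y ≤ 1# → IsExp (- y) e → ∀ ε → 0# < ε →
    ∃[ N₀ ] ∀ n δ → N₀ ℕ.≤ n → 0# ≤ δ → δ ≤ 1# → (n · 1#) * δ ≈ 1# →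
    Near e ((1# - y * δ) ^ n) ε
  exp≈power {y} {e} 0≤y y≤1 isExp ε 0<ε =
    suc (proj₁ arch) , λ n δ N₀≤n 0≤δ δ≤1 nδ≈1 → Near-weaken
      (≤-trans (+-mono-≤ ≤-refl (≤-trans (error n δ N₀≤n 0≤δ nδ≈1)
          (≤-reflexive (half+half (½ * ε)))))
        (≤-reflexive (half+half ε)))
      (Near-trans
        (Near-sym (proj₂ conv (suc M) (ℕ.m≤n⇒m≤1+n (ℕ.m≤n⇒m≤1+n (ℕ.m≤m+n N₁ M₁)))))
        (Near-resp (expSum-cong (suc M) (-‿cong (scale n δ nδ≈1))) refl refl
          (expSum-iterate M (*-nonneg 0≤y 0≤δ)
            (≤-trans (≤-by (*-nonneg (≤⇒0≤ y≤1) 0≤δ)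
              (ring 2 (λ y δ → (con 1ℤ :- y) :* δ := δ :- y :* δ) ≡.refl y δ)) δ≤1)
            n (≤-respˡ-≈ (sym (scale n δ nδ≈1)) y≤1))))
    where
    ε′ = ½ * (½ * ε)
    0<½ε = *-pos 0<½ 0<ε
    0<ε′ = *-pos 0<½ 0<½ε
    conv = converges⇒Near isExp (½ * ε) 0<½ε
    small = 1/fact-small 0<ε′
    N₁ = proj₁ conv
    M₁ = proj₁ small
    M = suc (N₁ ℕ.+ M₁)
    c = sum {M} (λ k → toℕ k · 1#)
    0≤c = sum-nonneg {M} (λ k → fromℕ-nonneg (toℕ k))
    arch = archimedean′ c 0<ε′
    scale : ∀ n δ → (n · 1#) * δ ≈ 1# → (n · 1#) * (y * δ) ≈ y
    scale n δ eq = trans (ring 3 (λ n y δ → n :* (y :* δ) := y :* (n :* δ)) ≡.refl (n · 1#) y δ)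
      (trans (*-congˡ eq) (*-identityʳ y))
    error : ∀ n δ → suc (proj₁ arch) ℕ.≤ n → 0# ≤ δ → (n · 1#) * δ ≈ 1# →
      (n · 1#) * (c * (y * δ * (y * δ)) + y * δ * 1/fact M) ≤ ε′ + ε′
    error n δ N₀≤n 0≤δ nδ≈1 = ≤-trans (≤-reflexive (trans
        (ring 5 (λ n c y δ f → n :* (c :* (y :* δ :* (y :* δ)) :+ y :* δ :* f)
          := (n :* δ) :* (y :* (y :* (c :* δ) :+ f))) ≡.refl (n · 1#) c y δ (1/fact M))
        (trans (*-congʳ nδ≈1) (*-identityˡ _))))
      (≤-trans (shrink (+-nonneg (*-nonneg 0≤y 0≤cδ) (0≤1/fact M)))
        (+-mono-≤ (≤-trans (shrink 0≤cδ) cδ≤ε′) (proj₂ small (N₁ ℕ.+ M₁) (ℕ.m≤n+m M₁ N₁))))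
      where
      0≤cδ = *-nonneg 0≤c 0≤δ
      shrink : ∀ {x} → 0# ≤ x → y * x ≤ x
      shrink {x} 0≤x = ≤-by (*-nonneg (≤⇒0≤ y≤1) 0≤x)
        (ring 2 (λ x y → (con 1ℤ :- y) :* x := x :- y :* x) ≡.refl x y)
      cδ≤ε′ : c * δ ≤ ε′
      cδ≤ε′ = ≤-respʳ-≈ (trans (ring 3 (λ n e δ → (n :* e) :* δ := (n :* δ) :* e)
        ≡.refl (n · 1#) ε′ δ)
                          (trans (*-congʳ nδ≈1) (*-identityˡ _)))
        (≤-by (*-nonneg (≤⇒0≤ (≤-trans (proj₂ arch)
            (≤-by (*-nonneg (≤⇒0≤ (fromℕ-mono N₀≤n)) (<⇒≤ 0<ε′))
              (ring 3 (λ a b e → (a :- b) :* e := a :* e :- b :* e)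
                ≡.refl (n · 1#) (suc (proj₁ arch) · 1#) ε′)))) 0≤δ)
          (ring 4 (λ n e δ c → (n :* e :- c) :* δ := (n :* e) :* δ :- c :* δ)
            ≡.refl (n · 1#) ε′ δ c))

  1/[1+_] : ℕ → ℝ
  1/[1+ n ] = (suc n · 1#) ⁻¹[ ·1#0 (suc n) ]

  *-1/[1+n] : ∀ n → (suc n · 1#) * 1/[1+ n ] ≈ 1#
  *-1/[1+n] n = *-inverseʳ (·1#0 (suc n))

  0<1/[1+n] : ∀ n → 0# < 1/[1+ n ]
  0<1/[1+n] n = inverse-pos (0<n·1 n) (*-1/[1+n] n)

  1/[1+n]≤1 : ∀ n → 1/[1+ n ] ≤ 1#
  1/[1+n]≤1 n = ≤-by (*-nonneg (fromℕ-nonneg n) (<⇒≤ (0<1/[1+n] n)))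
    (trans (ring 2 (λ n i → n :* i := (con 1ℤ :+ n) :* i :- i) ≡.refl (n · 1#) (1/[1+ n ]))
      (+-congʳ (*-1/[1+n] n)))

  -- Bernoulli's inequality for (1 - y/n)^n, passed to the limit. It supplies the signs of the
  -- exponentials.
  1-y≤exp[-y] : ∀ {y e} → 0# ≤ y → y ≤ 1# → IsExp (- y) e → 1# - y ≤ e
  1-y≤exp[-y] {y} {e} 0≤y y≤1 isExp = ≤-limit 0≤1 λ ε 0<ε →
    let N , near = exp≈power 0≤y y≤1 isExp ε 0<ε
        δ = 1/[1+ N ]
        0≤δ = <⇒≤ (0<1/[1+n] N)
        δ≤1 = 1/[1+n]≤1 N
        yδ≤1 = ≤-trans (≤-by (*-nonneg (≤⇒0≤ y≤1) 0≤δ)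
                 (ring 2 (λ y δ → (con 1ℤ :- y) :* δ := δ :- y :* δ) ≡.refl y δ)) δ≤1
    in ≤-trans (≤-reflexive (+-congˡ (-‿cong (sym
         (trans (ring 3 (λ n y δ → n :* (y :* δ) := y :* (n :* δ)) ≡.refl (suc N · 1#) y δ)
           (trans (*-congˡ (*-1/[1+n] N)) (*-identityʳ y)))))))
       (≤-trans (bernoulli (*-nonneg 0≤y 0≤δ) yδ≤1 (suc N))
         (≤-trans (proj₂ (near (suc N) δ (ℕ.n≤1+n N) 0≤δ δ≤1 (*-1/[1+n] N)))
           (≤-reflexive (+-congˡ (sym (*-identityˡ ε))))))

-- From the constraints of all stages to a contradiction with r < η

module Threshold (R : Reals) where
  open Reals R
  open RealRing R
  open RealOrder R
  open RealSum R
  open Exponential R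
  open Exp (CommutativeRing.commutativeSemiring commutativeRing)
    using (^-congˡ; ^-homo-*; ^-distrib-*)

  -- Admits equations into certificates, with a multiplier of either sign.
  ≈⇒0≤* : ∀ c {x y} → x ≈ y → 0# ≤ c * (x - y)
  ≈⇒0≤* c {x} {y} p = ≤-reflexive (sym (trans (*-congˡ (trans (+-congʳ p) (-‿inverseʳ y)))
    (zeroʳ c)))

  -- x k is the work done at the price U - D - 2τ - u k of stage k, S and C accumulate
  -- x k and u k * x k, and M k bounds the total work from below if the prices are U after
  -- the first k stages.
  record Feasible (U B r ε : ℝ) (K : ℕ) (u : ℕ → ℝ) : Set where
    field
      x S C M   : ℕ → ℝ
      S-zero    : S 0 ≈ 0#
      S-suc     : ∀ k → S (suc k) ≈ S k + x k
      C-zero    : C 0 ≈ 0#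
      C-suc     : ∀ k → C (suc k) ≈ C k + u k * x k
      1≤M       : ∀ k → 1# ≤ M k
      M-mono    : ∀ k → M k ≤ M (suc k)
      S≤M       : S K ≤ M K
      constraint : ∀ k → k ℕ.< K → U * M (suc k) - C (suc k) ≤ r * (B - u k) + ε

  module _ {U B r ε κ u₀ : ℝ} {N : ℕ} {u : ℕ → ℝ} (feasible : Feasible U B r ε (suc N) u)
           (0≤κ : 0# ≤ κ) (κ≤1 : κ ≤ 1#) (0≤u₀ : 0# ≤ u₀) (u≤U : ∀ k → u k ≤ U)
           (geometric : ∀ k → k ℕ.≤ N → u₀ ≈ κ ^ k * u k) where
    open Feasible feasible

    private
      u₀≈u-zero : u₀ ≈ u 0
      u₀≈u-zero = trans (geometric 0 ℕ.z≤n) (*-identityˡ _)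

    -- Telescoping with F k = U * M k - C k, which drops by u k * x k, turns Σ x k into
    -- Σ (F k - F (suc k)) / u k; summing by parts exposes the constraints on F.  The common
    -- factor u₀ avoids the division, as u may vanish.
    potential : ∀ k → k ℕ.≤ N →
      U - (r * B + ε) * (1# - κ ^ k) + r * u₀ * ((k · 1#) * (1# - κ))
        ≤ u₀ * (S (suc k) + 1# - M (suc k)) + κ ^ k * (U * M (suc k) - C (suc k))
    potential zero _ = ≤-by
      (+-nonneg (+-nonneg (*-nonneg (≤⇒0≤ (u≤U 0)) (≤⇒0≤ (1≤M 1)))
        (+-nonneg (≈⇒0≤* u₀ (trans (S-suc 0) (+-congʳ S-zero)))
                  (≈⇒0≤* (- 1#) (trans (C-suc 0) (+-congʳ C-zero)))))
        (≈⇒0≤* (1# + x 0 - M 1) u₀≈u-zero))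
      (ring 11 (λ U r B ε κ u₀ u x M S C → (U :- u) :* (M :- con 1ℤ) :+
        (u₀ :* (S :- (con 0ℤ :+ x)) :+ (:- con 1ℤ) :* (C :- (con 0ℤ :+ u :* x))) :+
        (con 1ℤ :+ x :- M) :* (u₀ :- u) := (u₀ :* (S :+ con 1ℤ :- M) :+ con 1ℤ :* (U :* M :- C))
        :- (U :- (r :* B :+ ε) :* (con 1ℤ :- con 1ℤ) :+ r :* u₀ :* (con 0ℤ :* (con 1ℤ :- κ))))
        ≡.refl U r B ε κ u₀ (u 0) (x 0) (M 1) (S 1) (C 1))
    potential (suc k) k<N = ≤-by
      (+-nonneg
        (+-nonneg
          (+-nonneg (≤⇒0≤ (potential k (ℕ.<⇒≤ k<N)))
            (*-nonneg (≤⇒0≤ (M-mono (suc k))) (*-nonneg (^-nonneg 0≤κ (suc k))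
              (≤⇒0≤ (u≤U (suc k))))))
          -- The weight κ^k (1 - κ) stands for u₀ (1 / u k - 1 / u (k + 1)), as summation by parts
          -- requires. Since κ^k u k = u₀, every stage contributes the same amount r u₀ (1 - κ);
          -- this is the origin of the term linear in k.
          (*-nonneg (*-nonneg (^-nonneg 0≤κ k) (≤⇒0≤ κ≤1)) (≤⇒0≤ (constraint k (ℕ.m<n⇒m<1+n k<N)))))
        (+-nonneg
          (+-nonneg (≈⇒0≤* u₀ (S-suc (suc k))) (≈⇒0≤* (- (κ * κ ^ k)) (C-suc (suc k))))
          (+-nonneg (≈⇒0≤* (x (suc k) - (M (suc (suc k)) - M (suc k))) (geometric (suc k) k<N))
                    (≈⇒0≤* (- (r * (1# - κ))) (geometric k (ℕ.<⇒≤ k<N))))))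
      (ring 17 (λ U r B ε κ u₀ p n u v x M M′ S S′ C C′ →
        (((u₀ :* (S :+ con 1ℤ :- M) :+ p :* (U :* M :- C)) :-
        (U :- (r :* B :+ ε) :* (con 1ℤ :- p) :+ r :* u₀ :* (n :* (con 1ℤ :- κ))) :+ (M′ :- M) :*
        (κ :* p :* (U :- v))) :+ p :* (con 1ℤ :- κ) :* (r :* (B :- u) :+ ε :- (U :* M :- C))) :+
        ((u₀ :* (S′ :- (S :+ x)) :+ (:- (κ :* p)) :* (C′ :- (C :+ v :* x))) :+
        ((x :- (M′ :- M)) :* (u₀ :- κ :* p :* v) :+ (:- (r :* (con 1ℤ :- κ))) :* (u₀ :- p :* u)))
        := (u₀ :* (S′ :+ con 1ℤ :- M′) :+ κ :* p :* (U :* M′ :- C′)) :-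
        (U :- (r :* B :+ ε) :* (con 1ℤ :- κ :* p) :+ r :* u₀ :* ((con 1ℤ :+ n) :* (con 1ℤ :- κ))))
        ≡.refl U r B ε κ u₀ (κ ^ k) (k · 1#) (u k) (u (suc k)) (x (suc k)) (M (suc k))
        (M (suc (suc k))) (S (suc k)) (S (suc (suc k))) (C (suc k)) (C (suc (suc k))))

    -- The last constraint receives the remaining weight κ^N, so that the weights add up to 1; `S≤M`
    -- then removes the unknown work.
    threshold-bound : U - (r * B + ε) + r * u₀ + r * u₀ * ((N · 1#) * (1# - κ)) ≤ u₀
    threshold-bound = ≤-by
      (+-nonneg
        (+-nonneg (≤⇒0≤ (potential N ℕ.≤-refl)) (*-nonneg 0≤u₀ (≤⇒0≤ S≤M)))
        (+-nonneg (*-nonneg (^-nonneg 0≤κ N) (≤⇒0≤ (constraint N ℕ.≤-refl)))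
                  (≈⇒0≤* (- r) (geometric N ℕ.≤-refl))))
      (ring 12 (λ U r B ε κ u₀ p n u M S C → ((u₀ :* (S :+ con 1ℤ :- M) :+ p :* (U :* M :- C)) :-
        (U :- (r :* B :+ ε) :* (con 1ℤ :- p) :+ r :* u₀ :* (n :* (con 1ℤ :- κ))) :+ u₀ :*
        (M :- S)) :+ (p :* (r :* (B :- u) :+ ε :- (U :* M :- C)) :+ (:- r) :* (u₀ :- p :* u))
        := u₀ :- (U :- (r :* B :+ ε) :+ r :* u₀ :+ r :* u₀ :* (n :* (con 1ℤ :- κ))))
        ≡.refl U r B ε κ u₀ (κ ^ N) (N · 1#) (u N) (M (suc N)) (S (suc N)) (C (suc N)))

  ^-≤1 : ∀ {x} → 0# ≤ x → x ≤ 1# → ∀ n → x ^ n ≤ 1#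
  ^-≤1 p q zero    = ≤-refl
  ^-≤1 {x} p q (suc n) = ≤-by (+-nonneg (≤⇒0≤ q) (*-nonneg p (≤⇒0≤ (^-≤1 p q n))))
    (ring 2 (λ x p → (con 1ℤ :- x) :+ x :* (con 1ℤ :- p) := con 1ℤ :- x :* p) ≡.refl x (x ^ n))

  -- The sign of s is not decidable. Twice the slack is (∣ s ∣ - s) (x + ε - y) + (∣ s ∣ + s) (y + ε
  -- - x), where all four factors are nonnegative.
  Near-scale : ∀ s {x y ε} → Near x y ε → s * x ≤ s * y + ∣ s ∣ * ε
  Near-scale s {x} {y} {ε} (p , q) = ≤-by
    (*-nonneg (<⇒≤ 0<½) (+-nonneg
      (*-nonneg (≤-respˡ-≈ (-‿inverseʳ s) (+-mono-≤ (≤∣∣ s) ≤-refl)) (≤⇒0≤ q))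
      (*-nonneg (≤-respˡ-≈ (-‿inverseʳ s) (≤-trans (≤-reflexive (+-comm s (- s)))
        (+-mono-≤ (neg≤∣∣ s) ≤-refl))) (≤⇒0≤ p))))
    (trans (*-congˡ (ring 5 (λ s a x y ε → (a :+ (:- s)) :* (x :+ ε :- y) :+ (a :+ s) :*
      (y :+ ε :- x) := (s :* y :+ a :* ε :- s :* x) :+ (s :* y :+ a :* ε :- s :* x))
      ≡.refl s (∣ s ∣) x y ε))
      (trans (distribˡ ½ _ _) (half+half _)))

  module _ {U V B y b r η e eʷ : ℝ}
           (0<U : 0# < U) (0≤V : 0# ≤ V) (V≤U : V ≤ U) (B≈Ub : B ≈ U * b)
           (0≤b : 0# ≤ b) (b≤1 : b ≤ 1#) (0≤y : 0# ≤ y) (0≤r : 0# ≤ r)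
           (η[b-y]≈1 : η * (b - y) ≈ 1#) (r<η : r < η)
           (exp-b : IsExp (- b) e) (exp-y : IsExp (- y) eʷ) (lambert : y * eʷ * U ≈ V * e)
           where
    private
      0<η : 0# < η
      0<η = <-by (+-pos-nonneg (<⇒0< r<η) 0≤r)
        (ring 2 (λ r η → η :- r :+ r := η :- con 0ℤ) ≡.refl r η)
      -- η > r ≥ 0 makes its reciprocal b - y positive, which puts y below b ≤ 1.
      0<b-y : 0# < b - y
      0<b-y = inverse-pos 0<η η[b-y]≈1
      0<1-y : 0# < 1# - y
      0<1-y = <-by (+-pos-nonneg 0<b-y (≤⇒0≤ b≤1))
        (ring 2 (λ b y → (b :- y) :+ (con 1ℤ :- b) := con 1ℤ :- y :- con 0ℤ) ≡.refl b y)
      y≤1 : y ≤ 1#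
      y≤1 = 0≤⇒≤ (<⇒≤ 0<1-y)
      0<eʷ : 0# < eʷ
      0<eʷ = <-≤-trans 0<1-y (1-y≤exp[-y] 0≤y y≤1 exp-y)
      θ = r * (b - y)
      0<1-θ : 0# < 1# - θ
      0<1-θ = <-respʳ-≈ (trans (ring 3 (λ η r d → (η :- r) :* d := η :* d :- r :* d)
        ≡.refl η r (b - y)) (+-congʳ η[b-y]≈1))
        (*-pos (<⇒0< r<η) 0<b-y)
      -- As N (1 - κ) will be at least b - y, `threshold-bound` yields U - r B - ε ≤ u₀ lam.
      lam = 1# - r - θ

      product≤1 : ∀ {δ} → 0# ≤ δ → δ ≤ 1# → ∀ {z} → 0# ≤ z → z ≤ 1# → z * δ ≤ 1#
      product≤1 {δ} 0≤δ δ≤1 {z} 0≤z z≤1 = ≤-trans (≤-by (*-nonneg (≤⇒0≤ z≤1) 0≤δ)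
        (ring 2 (λ z δ → (con 1ℤ :- z) :* δ := δ :- z :* δ) ≡.refl z δ)) δ≤1

    module _ (game : ∀ N (u : ℕ → ℝ) ε → (∀ k → 0# ≤ u k) → (∀ k → u k ≤ V) → 0# < ε →
                     ¬ ¬ Feasible U B r ε (suc N) u) where
      private
        -- This is `threshold-bound` multiplied by (1 - y δ)^(n + 1), so that no quotient of powers
        -- remains. `bad` is the strict inequality to be refuted; the goal being a refutation,
        -- feasibility is only needed up to double negation.
        discretised : ∀ n → ∀ ε → 0# < ε → let δ = 1/[1+ n ] in
          (U - r * B - ε) * (1# - y * δ) ^ suc n ≤ V * (1# - b * δ) ^ suc n * lam
        discretised n ε 0<ε bad = game N u ε 0≤u u≤V 0<ε λ feasible → ≤-by
          (+-nonneg
            (*-nonneg (^-nonneg (<⇒≤ 0<1-yδ) N)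
              (+-nonneg (≤⇒0≤ (threshold-bound feasible 0≤κ κ≤1 0≤u₀ (λ k → ≤-trans (u≤V k) V≤U)
                geometric))
                        (*-nonneg (*-nonneg 0≤r 0≤u₀) (≤⇒0≤ b-y≤N[1-κ]))))
            (≈⇒0≤* lam power))
          (ring 10 (λ U r B ε u₀ a c V d n → a :*
            (u₀ :- (U :- (r :* B :+ ε) :+ r :* u₀ :+ r :* u₀ :* n) :+ r :* u₀ :* (n :- d)) :+
            (con 1ℤ :- r :- r :* d) :* (V :* c :- u₀ :* a)
            := V :* c :* (con 1ℤ :- r :- r :* d) :- (U :- r :* B :- ε) :* a)
            ≡.refl U r B ε u₀ ((1# - y * δ) ^ N) ((1# - b * δ) ^ N) V (b - y)
            ((N · 1#) * (1# - κ))) bad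
          where
          N = suc n
          δ = 1/[1+ n ]
          0≤δ = <⇒≤ (0<1/[1+n] n)
          δ≤1 = 1/[1+n]≤1 n
          0<1-yδ : 0# < 1# - y * δ
          0<1-yδ = <-≤-trans 0<1-y (≤-by (*-nonneg 0≤y (≤⇒0≤ δ≤1))
            (ring 2 (λ y δ → y :* (con 1ℤ :- δ) := (con 1ℤ :- y :* δ) :- (con 1ℤ :- y)) ≡.refl y δ))
          0≤1-bδ = ≤⇒0≤ (product≤1 0≤δ δ≤1 0≤b b≤1)
          i = (1# - y * δ) ⁻¹[ >⇒#0 0<1-yδ ]
          -- The N-th power of (1 - b δ) / (1 - y δ) tends to e / eʷ. A ratio such as 1 - (b - y) δ
          -- would call for exp (y - b) and for the functional equation.
          κ = (1# - b * δ) * i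
          κ-spec : κ * (1# - y * δ) ≈ 1# - b * δ
          κ-spec = trans (ring 3 (λ p i q → p :* i :* q := p :* (q :* i))
            ≡.refl (1# - b * δ) i (1# - y * δ))
            (trans (*-congˡ (*-inverseʳ (>⇒#0 0<1-yδ))) (*-identityʳ _))
          0≤κ : 0# ≤ κ
          0≤κ = *-nonneg 0≤1-bδ (<⇒≤ (inverse-pos 0<1-yδ (*-inverseʳ (>⇒#0 0<1-yδ))))
          κ≤1 : κ ≤ 1#
          κ≤1 = *-cancel-pos-≤ 0<1-yδ (≤-respˡ-≈ (trans (sym κ-spec) (*-comm _ _))
            (≤-by (*-nonneg (<⇒≤ 0<b-y) 0≤δ)
              (ring 3 (λ b y δ → (b :- y) :* δ
                := (con 1ℤ :- y :* δ) :* con 1ℤ :- (con 1ℤ :- b :* δ)) ≡.refl b y δ)))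
          u : ℕ → ℝ
          u k = V * κ ^ (N ℕ.∸ k)
          u₀ = V * κ ^ N
          0≤u : ∀ k → 0# ≤ u k
          0≤u k = *-nonneg 0≤V (^-nonneg 0≤κ (N ℕ.∸ k))
          0≤u₀ = *-nonneg 0≤V (^-nonneg 0≤κ N)
          u≤V : ∀ k → u k ≤ V
          u≤V k = ≤-respʳ-≈ (*-identityʳ V) (*-monoˡ-≤ 0≤V (^-≤1 0≤κ κ≤1 (N ℕ.∸ k)))
          geometric : ∀ k → k ℕ.≤ N → u₀ ≈ κ ^ k * u k
          geometric k k≤N = trans
            (*-congˡ (trans (reflexive (≡.cong (κ ^_) (≡.sym (ℕ.m+[n∸m]≡n k≤N))))
                            (^-homo-* κ k (N ℕ.∸ k))))
            (ring 3 (λ V p q → V :* (p :* q) := p :* (V :* q)) ≡.refl V (κ ^ k) (κ ^ (N ℕ.∸ k)))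
          power : V * (1# - b * δ) ^ N ≈ u₀ * (1# - y * δ) ^ N
          power = trans (*-congˡ (trans (^-congˡ N (sym κ-spec)) (^-distrib-* κ (1# - y * δ) N)))
            (sym (*-assoc V _ _))
          -- N δ = 1 and 1 - κ = (b - y) δ / (1 - y δ).
          b-y≤N[1-κ] : b - y ≤ (N · 1#) * (1# - κ)
          b-y≤N[1-κ] = ≤-by
            (+-nonneg (*-nonneg (*-nonneg (fromℕ-nonneg N) (≤⇒0≤ κ≤1)) (*-nonneg 0≤y 0≤δ))
              (+-nonneg (≈⇒0≤* (- (N · 1#)) κ-spec) (≈⇒0≤* (b - y) (*-1/[1+n] n))))
            (ring 5 (λ n κ y δ b → n :* (con 1ℤ :- κ) :* (y :* δ) :+
              ((:- n) :* (κ :* (con 1ℤ :- y :* δ) :- (con 1ℤ :- b :* δ)) :+ (b :- y) :*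
              (n :* δ :- con 1ℤ)) := n :* (con 1ℤ :- κ) :- (b :- y)) ≡.refl (N · 1#) κ y δ b)

        -- For each ε, `discretised` is taken at an n for which both powers are ε-close to their
        -- limits, so that all errors are multiples of ε.
        limit : (U - r * B) * eʷ ≤ V * lam * e
        limit = ≤-limit (+-nonneg (+-nonneg (0≤∣∣ (U - r * B)) 0≤1) (0≤∣∣ (V * lam))) λ ε 0<ε →
          let Nb , near-b = exp≈power 0≤b b≤1 exp-b ε 0<ε
              Ny , near-y = exp≈power 0≤y y≤1 exp-y ε 0<ε
              n   = Nb ℕ.+ Ny
              δ   = 1/[1+ n ]
              0≤δ = <⇒≤ (0<1/[1+n] n)
              δ≤1 = 1/[1+n]≤1 n
              c   = (1# - b * δ) ^ suc n
              a   = (1# - y * δ) ^ suc n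
              e~c = near-b (suc n) δ (ℕ.m≤n⇒m≤1+n (ℕ.m≤m+n Nb Ny)) 0≤δ δ≤1 (*-1/[1+n] n)
              eʷ~a = near-y (suc n) δ (ℕ.m≤n⇒m≤1+n (ℕ.m≤n+m Ny Nb)) 0≤δ δ≤1 (*-1/[1+n] n)
              0≤1-yδ = ≤⇒0≤ (product≤1 0≤δ δ≤1 0≤y y≤1)
              a≤1 = ^-≤1 0≤1-yδ (≤-by (*-nonneg 0≤y 0≤δ)
                (ring 2 (λ y δ → y :* δ := con 1ℤ :- (con 1ℤ :- y :* δ)) ≡.refl y δ)) (suc n)
          in ≤-by
            (+-nonneg
              (+-nonneg (≤⇒0≤ (Near-scale (U - r * B) eʷ~a)) (≤⇒0≤ (discretised n ε 0<ε)))
              (+-nonneg (*-nonneg (<⇒≤ 0<ε) (≤⇒0≤ a≤1))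
                        (≤⇒0≤ (Near-scale (V * lam) (Near-sym e~c)))))
            (ring 10 (λ s m k V l a c e eʷ ε →
              (s :* a :+ m :* ε :- s :* eʷ :+ (V :* c :* l :- (s :- ε) :* a)) :+
              (ε :* (con 1ℤ :- a) :+ (V :* l :* e :+ k :* ε :- V :* l :* c))
              := (V :* l :* e :+ (m :+ con 1ℤ :+ k) :* ε) :- s :* eʷ)
              ≡.refl (U - r * B) (∣ U - r * B ∣) (∣ V * lam ∣) V lam a c e eʷ ε)

      -- By `lambert`, V e / eʷ = y U, which turns `limit` into 1 - r b ≤ y (1 - r - θ). But the
      -- left side exceeds the right one by (1 - y) (1 - θ), which is positive since θ = r (b - y) <
      -- η (b - y) = 1.
      no-better-ratio : ⊥
      no-better-ratio = *-cancel-pos-≤ (*-pos 0<U 0<eʷ) (≤-by (+-nonneg (≤⇒0≤ limit)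
          (+-nonneg (≈⇒0≤* lam lambert) (≈⇒0≤* (- (r * eʷ)) B≈Ub)))
        (ring 9 (λ U r b B y e eʷ V l → (V :* l :* e :- (U :- r :* B) :* eʷ) :+
          (l :* (y :* eʷ :* U :- V :* e) :+ (:- (r :* eʷ)) :* (B :- U :* b))
          := U :* eʷ :* (y :* l) :- U :* eʷ :* (con 1ℤ :- r :* b)) ≡.refl U r b B y e eʷ V lam))
        (<-by (*-pos 0<1-y 0<1-θ)
          (ring 3 (λ b y r → (con 1ℤ :- y) :* (con 1ℤ :- r :* (b :- y))
            := (con 1ℤ :- r :* b) :- y :* (con 1ℤ :- r :- r :* (b :- y))) ≡.refl b y r))

-- Expectation as a monotone linear functional

module Expectation (R : Reals) (P : ProbabilitySpace R) where
  open Reals R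
  open RealOrder R
  open RealSum R
  open ProbabilitySpace P

  -- `𝔼` takes a proof of integrability; carrying it along keeps calculations free of such proofs,
  -- and `E-cong` shows that the expectation depends on the values alone.
  record RandomVariable : Set where
    constructor rv
    field
      value      : Ω → ℝ
      integrable : Integrable value

  open RandomVariable public

  E : RandomVariable → ℝ
  E X = 𝔼 (value X) (integrable X)

  E-mono : ∀ X Y → (∀ ω → value X ω ≤ value Y ω) → E X ≤ E Y
  E-mono X Y = 𝔼-mono (integrable X) (integrable Y)

  E-cong : ∀ X Y → (∀ ω → value X ω ≈ value Y ω) → E X ≈ E Y
  E-cong X Y p = ≤-antisym (E-mono X Y (λ ω → ≤-reflexive (p ω)))
                           (E-mono Y X (λ ω → ≤-reflexive (sym (p ω))))

  constant : ℝ → RandomVariable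
  constant a = rv (λ _ → a) (int-const a)

  infixl 6 _⊕_
  infixl 7 _⊛_
  _⊕_ : RandomVariable → RandomVariable → RandomVariable
  X ⊕ Y = rv (λ ω → value X ω + value Y ω) (int-+ (integrable X) (integrable Y))

  _⊛_ : ℝ → RandomVariable → RandomVariable
  a ⊛ X = rv (λ ω → a * value X ω) (int-* a (integrable X))

  ∑ : ∀ {n} → (Fin n → RandomVariable) → RandomVariable
  ∑ X = rv (λ ω → sum (λ i → value (X i) ω)) (integrable-sum X)
    where
    integrable-sum : ∀ {n} (X : Fin n → RandomVariable) →
                     Integrable (λ ω → sum (λ i → value (X i) ω))
    integrable-sum {zero}  X = int-const 0#
    integrable-sum {suc n} X = int-+ (integrable (X zero)) (integrable-sum (X ∘ suc))

  E-∑ : ∀ {n} (X : Fin n → RandomVariable) → E (∑ X) ≈ sum (λ i → E (X i))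
  E-∑ {zero}  X = 𝔼-const 0#
  E-∑ {suc n} X = trans (𝔼-+ (integrable (X zero)) (integrable (∑ (X ∘ suc))))
    (+-congˡ (E-∑ (X ∘ suc)))

  E-nonneg : ∀ X → (∀ ω → 0# ≤ value X ω) → 0# ≤ E X
  E-nonneg X p = ≤-respˡ-≈ (𝔼-const 0#) (E-mono (constant 0#) X p)

  E-⊕ : ∀ X Y → E (X ⊕ Y) ≈ E X + E Y
  E-⊕ X Y = 𝔼-+ (integrable X) (integrable Y)

  E-⊛ : ∀ a X → E (a ⊛ X) ≈ a * E X
  E-⊛ a X = 𝔼-* a (integrable X)

  E-constant : ∀ a → E (constant a) ≈ a
  E-constant = 𝔼-const

-- Moves and switches between two allocations

module Allocations (R : Reals) (L U τ D : Reals.ℝ R) where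
  open Reals R
  open RealRing R
  open RealOrder R
  open RealSum R
  open SOAD R L U τ D using (Allocation; on; off; loc; loc-full; on-range; off-range; norm)

  module _ {n : ℕ} where

    totalOn : Allocation n → ℝ
    totalOn x = sum (on x)

    onIn : (Fin n → Bool) → Allocation n → ℝ
    onIn G x = sum (λ u → ⟦ G u ⟧ * on x u)

    massIn : (Fin n → Bool) → Allocation n → ℝ
    massIn G x = sum (λ u → ⟦ G u ⟧ * (on x u + off x u))

    on≥0 : ∀ (x : Allocation n) u → 0# ≤ on x u
    on≥0 x u = proj₁ (on-range x u)

    off≥0 : ∀ (x : Allocation n) u → 0# ≤ off x u
    off≥0 x u = proj₁ (off-range x u)

    mass≥0 : ∀ (x : Allocation n) u → 0# ≤ on x u + off x u
    mass≥0 x u = +-nonneg (on≥0 x u) (off≥0 x u)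

    on+off≈1 : ∀ (x : Allocation n) → sum (on x) + sum (off x) ≈ 1#
    on+off≈1 x = trans (+-cong (sum-cong (λ u → sym (nonneg⇒∣∣≈ (on≥0 x u))))
                               (sum-cong (λ u → sym (nonneg⇒∣∣≈ (off≥0 x u)))))
                       (norm x)

    mass≈1 : ∀ (x : Allocation n) → sum (λ u → on x u + off x u) ≈ 1#
    mass≈1 x = trans (sum-+ (on x) (off x)) (on+off≈1 x)

    off≈1⇒totalOn≤0 : ∀ (x : Allocation n) {u} → off x u ≈ 1# → totalOn x ≤ 0#
    off≈1⇒totalOn≤0 x {u} p = ≤-by (≤⇒0≤ (≤-sum (off≥0 x) u))
      (trans (+-cong refl (-‿cong (trans p (sym (on+off≈1 x)))))
        (ring 2 (λ a b → b :- (a :+ b) := con 0ℤ :- a) ≡.refl (sum (on x)) (sum (off x))))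

    massIn≥0 : ∀ G (x : Allocation n) → 0# ≤ massIn G x
    massIn≥0 G x = sum-nonneg (λ u → *-nonneg (⟦⟧-nonneg (G u)) (mass≥0 x u))

    loc∈⇒1≤massIn : ∀ G (x : Allocation n) → G (loc x) ≡ true → 1# ≤ massIn G x
    loc∈⇒1≤massIn G x p = ≤-trans
      (≤-reflexive (sym (trans (*-cong (reflexive (≡.cong ⟦_⟧ p)) (loc-full x)) (*-identityˡ 1#))))
      (≤-sum (λ u → *-nonneg (⟦⟧-nonneg (G u)) (mass≥0 x u)) (loc x))

    onIn≤1 : ∀ G (x : Allocation n) → onIn G x ≤ 1#
    onIn≤1 G x = ≤-respʳ-≈ (mass≈1 x) (sum-mono λ u → ≤-trans (⟦⟧*≤ (G u) (on≥0 x u))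
      (≤-by (off≥0 x u) (ring 2 (λ a b → b := a :+ b :- a) ≡.refl (on x u) (off x u))))

    -- The location already holds the total mass 1, so nothing is left for a set that avoids it.
    loc∉⇒onIn≤0 : ∀ G (x : Allocation n) → G (loc x) ≡ false → onIn G x ≤ 0#
    loc∉⇒onIn≤0 G x p = ≤-by (≤⇒0≤ together) (trans (+-congʳ (mass≈1 x))
        (ring 1 (λ a → con 1ℤ :- (a :+ con 1ℤ) := con 0ℤ :- a) ≡.refl (onIn G x)))
      where
      δ : Fin n → ℝ
      δ u = ⟦ does (u Fin.≟ loc x) ⟧
      together : onIn G x + 1# ≤ sum (λ u → on x u + off x u)
      together = ≤-trans (≤-reflexive (trans
          (+-congˡ (sym (trans (sum-pick (loc x) (λ u → on x u + off x u)) (loc-full x))))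
          (sym (sum-+ (λ u → ⟦ G u ⟧ * on x u) (λ u → δ u * (on x u + off x u))))))
        (sum-mono λ u → pointwise u (u Fin.≟ loc x))
        where
        pointwise : ∀ u (q : Dec (u ≡ loc x)) →
          ⟦ G u ⟧ * on x u + ⟦ does q ⟧ * (on x u + off x u) ≤ on x u + off x u
        pointwise u (yes ≡.refl) = ≤-reflexive (trans
          (+-congʳ (*-congʳ (reflexive (≡.cong ⟦_⟧ p))))
          (ring 2 (λ a b → con 0ℤ :* a :+ con 1ℤ :* (a :+ b) := a :+ b)
            ≡.refl (on x (loc x)) (off x (loc x))))
        pointwise u (no _) = ≤-trans
          (≤-reflexive (ring 3 (λ g a b → g :* a :+ con 0ℤ :* (a :+ b) := g :* a)
            ≡.refl (⟦ G u ⟧) (on x u) (off x u)))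
          (≤-trans (⟦⟧*≤ (G u) (on≥0 x u))
            (≤-by (off≥0 x u) (ring 2 (λ a b → b := a :+ b :- a) ≡.refl (on x u) (off x u))))

    -- Working in G without having been there costs a move. If x is located outside G or y inside
    -- it, the left side is at most 0; otherwise the two locations differ.
    movement : ∀ (d : Fin n → Fin n → ℝ) {δ} → 0# ≤ δ → (∀ u v → 0# ≤ d u v) →
      (∀ {u v} → u ≢ v → δ ≤ d u v) → ∀ G (x y : Allocation n) →
      δ * (onIn G x - massIn G y) ≤ d (loc y) (loc x)
    movement d {δ} 0≤δ d≥0 d≥δ G x y = cases _ _ ≡.refl ≡.refl
      where
      a = onIn G x
      m = massIn G y
      cases : ∀ b b′ → G (loc x) ≡ b → G (loc y) ≡ b′ → δ * (a - m) ≤ d (loc y) (loc x)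
      cases false b′ p q = ≤-trans
        (≤-by (*-nonneg 0≤δ (+-nonneg (≤⇒0≤ (loc∉⇒onIn≤0 G x p)) (massIn≥0 G y)))
          (ring 3 (λ δ a m → δ :* (con 0ℤ :- a :+ m) := con 0ℤ :- δ :* (a :- m)) ≡.refl δ a m))
        (d≥0 _ _)
      cases true true p q = ≤-trans
        (≤-by (*-nonneg 0≤δ (+-nonneg (≤⇒0≤ (onIn≤1 G x)) (≤⇒0≤ (loc∈⇒1≤massIn G y q))))
          (ring 3 (λ δ a m → δ :* (con 1ℤ :- a :+ (m :- con 1ℤ)) := con 0ℤ :- δ :* (a :- m))
            ≡.refl δ a m))
        (d≥0 _ _)
      cases true false p q = ≤-trans
        (≤-by (*-nonneg 0≤δ (+-nonneg (≤⇒0≤ (onIn≤1 G x)) (massIn≥0 G y)))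
          (ring 3 (λ δ a m → δ :* (con 1ℤ :- a :+ m) := δ :- δ :* (a :- m)) ≡.refl δ a m))
        (d≥δ (λ e → true≢false (≡.trans (≡.sym p) (≡.trans (≡.cong G (≡.sym e)) q))))
        where
        true≢false : ¬ (true ≡ false)
        true≢false ()

    -- With a and b the ON parts of x and y at a point, the summand is 2 (a - b) + (b - a) = a - b
    -- inside G and b - a outside. An increase in G counts twice because the ON state has to be left
    -- again; the difference of totals telescopes over time.
    variation : ∀ G (x y : Allocation n) →
      (1# + 1#) * (onIn G x - onIn G y) + (totalOn y - totalOn x) ≤ sum (λ u → ∣ on x u - on y u ∣)
    variation G x y = ≤-respˡ-≈
      (trans (sum-linear (1# + 1#) (λ u → ⟦ G u ⟧ * on x u - ⟦ G u ⟧ * on y u)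
                         1# (λ u → on y u - on x u))
        (+-cong (*-congˡ (sum-minus (λ u → ⟦ G u ⟧ * on x u) (λ u → ⟦ G u ⟧ * on y u)))
                (trans (*-identityˡ _) (sum-minus (on y) (on x)))))
      (sum-mono λ u → pointwise (G u) (on x u) (on y u))
      where
      pointwise : ∀ g a b → (1# + 1#) * (⟦ g ⟧ * a - ⟦ g ⟧ * b) + 1# * (b - a) ≤ ∣ a - b ∣
      pointwise true a b = ≤-trans
        (≤-reflexive (ring 2 (λ a b → (con 1ℤ :+ con 1ℤ) :* (con 1ℤ :* a :- con 1ℤ :* b) :+ con 1ℤ
          :* (b :- a) := a :- b) ≡.refl a b))
        (≤∣∣ (a - b))
      pointwise false a b = ≤-trans
        (≤-reflexive (ring 2 (λ a b → (con 1ℤ :+ con 1ℤ) :* (con 0ℤ :* a :- con 0ℤ :* b) :+ con 1ℤ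
          :* (b :- a) := :- (a :- b)) ≡.refl a b))
        (neg≤∣∣ (a - b))

-- Spaces with a single distance, as weighted stars

module UniformSetup (R : Reals) (L U τ D : Reals.ℝ R) where
  open Reals R
  open RealRing R
  open RealOrder R
  open RealSum R
  open SOAD R L U τ D
  open Star R

  -- D has to be the exact supremum of the ratios, and distinct points have positive distance. So D
  -- > 0 calls for two points and D = 0 for a single one.
  Spread : ℕ → Set
  Spread n = (0# < D × ∃ λ (u : Fin n) → ∃ λ v → u ≢ v) ⊎ (D ≈ 0# × (∀ (u v : Fin n) → u ≡ v))

  module Leaves (n H : ℕ) (c : ℝ) (s : Fin n) (0≤τ : 0# ≤ τ) (0≤D : 0# ≤ D)
           (0<c : 0# < c) (c≤1 : c ≤ 1#) (enough : 1# ≤ H · c) (spread : Spread n) where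

    private
      0≤c = <⇒≤ 0<c
      0≤Dc = *-nonneg 0≤D 0≤c

      distance : ∀ {A : Set} → Dec A → ℝ
      distance (yes _) = 0#
      distance (no _)  = D * c

    dist : Fin n → Fin n → ℝ
    dist u v = distance (u Fin.≟ v)

    dist-elim : ∀ (P : ℝ → Set) u v → (u ≡ v → P 0#) → (u ≢ v → P (D * c)) → P (dist u v)
    dist-elim P u v f g = elim (u Fin.≟ v)
      where
      elim : ∀ q → P (distance q)
      elim (yes p) = f p
      elim (no ¬p) = g ¬p

    dist≥0 : ∀ u v → 0# ≤ dist u v
    dist≥0 u v = dist-elim (0# ≤_) u v (λ _ → ≤-refl) (λ _ → 0≤Dc)

    dist≤Dc : ∀ u v → dist u v ≤ D * c
    dist≤Dc u v = dist-elim (_≤ D * c) u v (λ _ → 0≤Dc) (λ _ → ≤-refl)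

    dist≈0 : ∀ {u v} → u ≡ v → dist u v ≈ 0#
    dist≈0 {u} {v} p = dist-elim (_≈ 0#) u v (λ _ → refl) (λ u≢v → ⊥-elim (u≢v p))

    dist≈Dc : ∀ {u v} → u ≢ v → dist u v ≈ D * c
    dist≈Dc {u} {v} p = dist-elim (_≈ D * c) u v (λ u≡v → ⊥-elim (p u≡v)) (λ _ → refl)

    private
      distinct⇒0<Dc : ∀ {u v : Fin n} → u ≢ v → 0# < D * c
      distinct⇒0<Dc {u} {v} u≢v =
        [ (λ (0<D , _) → *-pos 0<D 0<c) , (λ (_ , unique) → ⊥-elim (u≢v (unique u v))) ]′ spread

      dist-indiscernable : ∀ {u v} → dist u v ≈ 0# → u ≡ v
      dist-indiscernable {u} {v} = dist-elim (λ z → z ≈ 0# → u ≡ v) u v (λ p _ → p)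
        (λ u≢v Dc≈0 → ⊥-elim (<-irrefl (<-respʳ-≈ Dc≈0 (distinct⇒0<Dc u≢v))))

      dist-sym : ∀ u v → dist u v ≈ dist v u
      dist-sym u v = dist-elim (_≈ dist v u) u v (λ p → sym (dist≈0 (≡.sym p)))
        (λ u≢v → sym (dist≈Dc (u≢v ∘ ≡.sym)))

      dist-triangle : ∀ u v w → dist u w ≤ dist u v + dist v w
      dist-triangle u v w = dist-elim (λ z → dist u w ≤ z + dist v w) u v
        (λ p → ≤-reflexive (trans (reflexive (≡.cong (λ z → dist z w) p)) (sym (+-identityˡ _))))
        (λ _ → ≤-trans (dist≤Dc u w) (≤-by (dist≥0 v w)
          (ring 2 (λ a b → b := a :+ b :- a) ≡.refl (D * c) (dist v w))))

      c⊓c≈c : c ⊓ c ≈ c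
      c⊓c≈c = ≤-antisym (x∧y≤x c c) (∧-greatest ≤-refl ≤-refl)

      ratio≈D : ∀ {u v} → u ≢ v → (p : (c ⊓ c) # 0#) → dist u v * (c ⊓ c) ⁻¹[ p ] ≈ D
      ratio≈D u≢v p = trans (*-congʳ (trans (dist≈Dc u≢v) (*-congˡ (sym c⊓c≈c))))
        (trans (*-assoc D _ _) (trans (*-congˡ (*-inverseʳ p)) (*-identityʳ D)))

    setup₀ : Setup
    setup₀ = record
      { n = n ; T = H ; d = dist ; c = λ _ → c ; β = λ _ → τ * c ; s = s
      ; isMetric = record
        { isSemiMetric = record
          { isQuasiSemiMetric = record
            { isPreMetric = record
              { isProtoMetric = record
                { isPartialOrder  = ≤-isPartialOrder
                ; ≈-isEquivalence = ≡.isEquivalence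
                ; cong            = λ { ≡.refl ≡.refl → refl }
                ; nonNegative     = λ {u} {v} → dist≥0 u v
                }
              ; ≈⇒0 = dist≈0
              }
            ; 0⇒≈ = dist-indiscernable
            }
          ; sym = dist-sym
          }
        ; triangle = dist-triangle
        }
      ; c-pos    = λ _ → 0<c
      ; c≤1      = λ _ → c≤1
      ; β-nonneg = λ _ → *-nonneg 0≤τ 0≤c
      ; β≤τc     = λ _ → ≤-refl
      ; D-upper  = λ u v u≢v → ≤-reflexive (ratio≈D u≢v _)
      ; D-least  = λ b 0≤b bound →
          [ (λ (_ , u , v , u≢v) → ≤-respˡ-≈ (ratio≈D u≢v _) (bound u v u≢v))
          , (λ (D≈0 , _) → ≤-respˡ-≈ (sym D≈0) 0≤b) ]′ spread
      ; solvable = s , enough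
      }

    private
      module _ (δ : ℝ) (0<δ : 0# < δ) where

        length≥0 : ∀ {x y} (p : Walk {n} (λ _ → δ) x y) → 0# ≤ length p
        length≥0 stop       = ≤-refl
        length≥0 (up u p)   = +-nonneg (<⇒≤ 0<δ) (length≥0 p)
        length≥0 (down u p) = +-nonneg (<⇒≤ 0<δ) (length≥0 p)

        length-from-centre : ∀ {v} (p : Walk {n} (λ _ → δ) nothing (just v)) → δ ≤ length p
        length-from-centre (down u p) = ≤-by (length≥0 p)
          (ring 2 (λ δ l → l := δ :+ l :- δ) ≡.refl δ (length p))

        length-between : ∀ {u v} → u ≢ v → (p : Walk {n} (λ _ → δ) (just u) (just v)) → δ + δ ≤
          length p
        length-between u≢v stop     = ⊥-elim (u≢v ≡.refl)
        length-between u≢v (up u p) = +-mono-≤ ≤-refl (length-from-centre p)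

        isStar : (∀ {u v} → u ≢ v → δ + δ ≈ D * c) → IsWeightedStar dist
        isStar 2δ≈Dc = (λ _ → δ) , (λ _ → 0<δ) , λ u v →
            dist-elim (λ z → ∃[ p ] z ≈ length {w = λ _ → δ} {just u} {just v} p) u v
              (λ { ≡.refl → stop , refl })
              (λ u≢v → up u (down v stop) , trans (sym (2δ≈Dc u≢v)) (+-congˡ (sym (+-identityʳ δ))))
          , λ p → dist-elim (_≤ length p) u v (λ _ → length≥0 p)
              (λ u≢v → ≤-trans (≤-reflexive (sym (2δ≈Dc u≢v))) (length-between u≢v p))

    isWeightedStar : IsWeightedStar dist
    isWeightedStar =
      [ (λ (0<D , _) → isStar (½ * (D * c)) (*-pos 0<½ (*-pos 0<D 0<c)) (λ _ → half+half (D * c)))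
      , (λ (_ , unique) → isStar 1# 0<1 (λ {u} {v} u≢v → ⊥-elim (u≢v (unique u v)))) ]′ spread

-- Costs of schedules: lower bounds for the player, an upper bound for the optimum

module UniformCosts (R : Reals) where
  open Reals R
  open RealRing R
  open RealOrder R
  open RealSum R
  open Mult (CommutativeRing.semiring commutativeRing) using (×-homo-+)

  module At (L U τ D : ℝ) (0<L : 0# < L) (L<U : L < U) (0≤τ : 0# ≤ τ) (0≤D : 0# ≤ D)
            (n H : ℕ) (c : ℝ) (s : Fin n) (0<c : 0# < c) (c≤1 : c ≤ 1#)
            (enough : 1# ≤ H · c) (spread : UniformSetup.Spread R L U τ D n) where
    open Allocations R L U τ D
    open SOAD R L U τ D
    open UniformSetup.Leaves R L U τ D n H c s 0≤τ 0≤D 0<c c≤1 enough spread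
      using (dist; dist≥0; dist≈0; dist≈Dc; dist≤Dc)
    open UniformSetup.Leaves R L U τ D n H c s 0≤τ 0≤D 0<c c≤1 enough spread public
      using (isWeightedStar) renaming (setup₀ to S)

    private
      0≤c = <⇒≤ 0<c

    -- The factor c makes `p t` and U prices per unit of throughput.
    pulses : (p : Fin H → ℝ) → (∀ t → L ≤ p t) → (∀ t → p t ≤ U) → (Fin H → Fin n → Bool) → Costs S
    pulses p L≤p p≤U G = record
      { price = λ t u → c * (U - ⟦ G t u ⟧ * (U - p t))
      ; lower = λ t u → ≤-by
          (*-nonneg 0≤c (+-nonneg (*-nonneg (≤⇒0≤ (⟦⟧-≤1 (G t u))) (<⇒≤ (<⇒0< L<U)))
                                  (*-nonneg (⟦⟧-nonneg (G t u)) (≤⇒0≤ (L≤p t)))))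
          (ring 5 (λ c g U L p → c :* ((con 1ℤ :- g) :* (U :- L) :+ g :* (p :- L))
            := c :* (U :- g :* (U :- p)) :- c :* L) ≡.refl c (⟦ G t u ⟧) U L (p t))
      ; upper = λ t u → ≤-by
          (*-nonneg 0≤c (*-nonneg (⟦⟧-nonneg (G t u)) (≤⇒0≤ (p≤U t))))
          (ring 4 (λ c g U p → c :* (g :* (U :- p)) := c :* U :- c :* (U :- g :* (U :- p)))
            ≡.refl c (⟦ G t u ⟧) U (p t))
      }

    module _ (x : Schedule S) where
      open Schedule x

      before : Fin H → Allocation n
      before t = at (inject₁ (inject₁ t))

      totalOn-start≤0 : totalOn (at zero) ≤ 0#
      totalOn-start≤0 = off≈1⇒totalOn≤0 (at zero) starts

      totalOn-end≤0 : totalOn (at (fromℕ (suc H))) ≤ 0#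
      totalOn-end≤0 = off≈1⇒totalOn≤0 (at (fromℕ (suc H))) (proj₂ ends)

      demand-met : 1# ≤ c * sum (λ t → totalOn (step t))
      demand-met = ≤-respʳ-≈ (trans (sum-cong {H} (λ t → sum-* c (on (step t))))
        (sum-* {H} c (λ t → totalOn (step t))))
        demand

      service-split : ∀ p (L≤p : ∀ t → L ≤ p t) (p≤U : ∀ t → p t ≤ U) (G : Fin H → Fin n → Bool) t →
        service S (Costs.price (pulses p L≤p p≤U G) t) (step t)
          ≈ c * (U * totalOn (step t) + (- (U - p t)) * onIn (G t) (step t))
      service-split p L≤p p≤U G t = trans
        (sum-cong (λ u → ring 5 (λ c U g p o → c :* (U :- g :* (U :- p)) :* o
          := (c :* U) :* o :+ (c :* (:- (U :- p))) :* (g :* o))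
          ≡.refl c U (⟦ G t u ⟧) (p t) (on (step t) u)))
        (trans (sum-linear (c * U) (on (step t)) (c * (- (U - p t)))
          (λ u → ⟦ G t u ⟧ * on (step t) u))
          (ring 5 (λ c U p a b → c :* U :* a :+ c :* (:- (U :- p)) :* b
            := c :* (U :* a :+ (:- (U :- p)) :* b))
            ≡.refl c U (p t) (totalOn (step t)) (onIn (G t) (step t))))

      -- Combines `movement` at distance D c with `variation` at weight τ c. Work in G is thereby
      -- charged D + 2τ per unit, except for what was in G beforehand.
      switching-bound : ∀ G (t : Fin (suc H)) → let y = at (inject₁ t) ; z = at (suc t) in
        c * (D * (onIn G z - massIn G y) + (τ + τ) * (onIn G z - onIn G y))
          + (τ * c) * (totalOn y - totalOn z) ≤ switching S z y
      switching-bound G t = ≤-trans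
        (≤-reflexive (ring 8 (λ c D τ a m b o o′ → c :* (D :* (a :- m) :+ (τ :+ τ) :* (a :- b)) :+
          (τ :* c) :* (o :- o′) := D :* c :* (a :- m) :+ τ :* c :*
          ((con 1ℤ :+ con 1ℤ) :* (a :- b) :+ (o :- o′)))
          ≡.refl c D τ (onIn G z) (massIn G y) (onIn G y) (totalOn y) (totalOn z)))
        (+-mono-≤
          (movement dist (*-nonneg 0≤D 0≤c) dist≥0
            (λ u≢v → ≤-reflexive (sym (dist≈Dc u≢v))) G z y)
          (≤-trans (*-monoˡ-≤ (*-nonneg 0≤τ 0≤c) (variation G z y))
            (≤-reflexive (sym (sum-* (τ * c) (λ u → ∣ on z u - on y u ∣))))))
        where
        y = at (inject₁ t)
        z = at (suc t)

      switching≥0 : ∀ (t : Fin (suc H)) → 0# ≤ switching S (at (suc t)) (at (inject₁ t))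
      switching≥0 t = +-nonneg (dist≥0 (loc (at (inject₁ t))) (loc (at (suc t))))
        (sum-nonneg {n} {λ u → τ * c * ∣ on (at (suc t)) u - on (at (inject₁ t)) u ∣}
            (λ u → *-nonneg (*-nonneg 0≤τ 0≤c) (0≤∣∣ _)))

      -- The case of an empty G. It serves for the move to time T + 1, where no price is charged.
      idle-bound : ∀ (t : Fin (suc H)) →
        (τ * c) * (totalOn (at (inject₁ t)) - totalOn (at (suc t))) ≤ switching S (at (suc t))
          (at (inject₁ t))
      idle-bound t = ≤-respˡ-≈
        (trans (+-congʳ (trans (*-congˡ (+-cong
            (trans (*-congˡ (trans (+-cong (onIn≈0 z) (-‿cong (massIn≈0 y))) (-‿inverseʳ 0#)))
              (zeroʳ D))
            (trans (*-congˡ (trans (+-cong (onIn≈0 z) (-‿cong (onIn≈0 y))) (-‿inverseʳ 0#)))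
              (zeroʳ _))))
          (trans (*-congˡ (+-identityˡ 0#)) (zeroʳ c)))) (+-identityˡ _))
        (switching-bound (λ _ → false) t)
        where
        y = at (inject₁ t)
        z = at (suc t)
        onIn≈0 : ∀ x → onIn (λ _ → false) x ≈ 0#
        onIn≈0 x = sum-0 (λ u → zeroˡ (on x u))
        massIn≈0 : ∀ x → massIn (λ _ → false) x ≈ 0#
        massIn≈0 x = sum-0 (λ u → zeroˡ (on x u + off x u))

      -- The terms τ c (totalOn before - totalOn after) telescope to 0, as the player is OFF
      -- at both ends.
      cost-bound : ∀ p (L≤p : ∀ t → L ≤ p t) (p≤U : ∀ t → p t ≤ U) (G : Fin H → Fin n → Bool) →
        sum (λ t → c * ((U * totalOn (step t) + (- (U - p t - D - (τ + τ))) * onIn (G t) (step t))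
                        + (- 1#) * (D * massIn (G t) (before t) + (τ + τ) * onIn (G t) (before t))))
          ≤ cost S (pulses p L≤p p≤U G) x
      cost-bound p L≤p p≤U G = ≤-trans (sum-mono {H} pointwise) (≤-trans
        (≤-reflexive (sum-+ {H} paid (λ t → excess (inject₁ t))))
        (+-mono-≤ ≤-refl (≤-trans
          (≤-trans (≤-by (≤⇒0≤ (idle-bound (fromℕ H)))
              (ring 2 (λ a e → e := a :+ e :- a)
                ≡.refl (sum (λ (t : Fin H) → excess (inject₁ t))) (excess (fromℕ H))))
            (≤-reflexive (sym (sum-init-last {H} excess))))
          (≤-trans (≤-reflexive (sum-minus {suc H} moved (λ t → τ * c * drop t)))
            (≤-by (*-nonneg (*-nonneg 0≤τ 0≤c) 0≤drops) (trans
              (sym (sum-* {suc H} (τ * c) drop))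
              (ring 2 (λ m k → k := m :- (m :- k))
                ≡.refl (sum moved) (sum (λ (t : Fin (suc H)) → τ * c * drop t)))))))))
        where
        paid : Fin H → ℝ
        paid t = service S (Costs.price (pulses p L≤p p≤U G) t) (step t)
        moved drop excess : Fin (suc H) → ℝ
        moved t  = switching S (at (suc t)) (at (inject₁ t))
        drop t   = totalOn (at (inject₁ t)) - totalOn (at (suc t))
        excess t = moved t - τ * c * drop t
        0≤drops : 0# ≤ sum drop
        0≤drops = ≤-by
          (+-nonneg (sum-nonneg (on≥0 (at zero))) (≤⇒0≤ totalOn-end≤0))
          (trans (trans (ring 2 (λ a b → a :+ (con 0ℤ :- b) := :- (b :- a))
            ≡.refl (totalOn (at zero)) (totalOn (at (fromℕ (suc H)))))
            (-‿cong (sym (sum-telescope {suc H} (λ t → totalOn (at t))))))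
            (trans (sym (sum-neg {suc H} (λ t → totalOn (at (suc t)) - totalOn (at (inject₁ t)))))
              (trans
              (sum-cong {suc H} (λ t → ring 2 (λ a b → :- (b :- a) := a :- b)
                ≡.refl (totalOn (at (inject₁ t))) (totalOn (at (suc t)))))
              (ring 1 (λ a → a := a :- con 0ℤ) ≡.refl (sum drop)))))
        pointwise : ∀ t → c * ((U * totalOn (step t) + (- (U - p t - D - (τ + τ))) * onIn (G t)
          (step t))
            + (- 1#) * (D * massIn (G t) (before t) + (τ + τ) * onIn (G t) (before t)))
          ≤ paid t + excess (inject₁ t)
        pointwise t = ≤-trans
          (≤-by (≤⇒0≤ (switching-bound (G t) (inject₁ t)))
            (ring 11 (λ c U p D τ o o′ a m b w → w :-
              (c :* (D :* (a :- m) :+ (τ :+ τ) :* (a :- b)) :+ τ :* c :* (o′ :- o))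
              := (c :* (U :* o :+ (:- (U :- p)) :* a) :+ (w :- τ :* c :* (o′ :- o))) :- c :*
              ((U :* o :+ (:- (U :- p :- D :- (τ :+ τ))) :* a) :+ (:- con 1ℤ) :*
              (D :* m :+ (τ :+ τ) :* b))) ≡.refl c U (p t) D τ (totalOn (step t))
              (totalOn (before t)) (onIn (G t) (step t)) (massIn (G t) (before t))
              (onIn (G t) (before t)) (moved (inject₁ t))))
          (≤-reflexive (+-congʳ (sym (service-split p L≤p p≤U G t))))

      -- Besides making costs positive, this limits the work of a competitive player, on which the
      -- case D = 0 relies.
      work-bound : ∀ f → L * (c * sum (λ t → totalOn (step t))) ≤ cost S f x
      work-bound f = ≤-trans (≤-reflexive (trans
          (ring 3 (λ L c w → L :* (c :* w) := c :* L :* w)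
            ≡.refl L c (sum (λ (t : Fin H) → totalOn (step t))))
          (sym (sum-* {H} (c * L) (λ t → totalOn (step t))))))
        (≤-trans
          (sum-mono {H} (λ t → ≤-respˡ-≈ (sum-* (c * L) (on (step t)))
            (sum-mono (λ u → ≤-by (*-nonneg (≤⇒0≤ (Costs.lower f t u)) (on≥0 (step t) u))
              (ring 3 (λ a b o → (b :- a) :* o := b :* o :- a :* o)
                ≡.refl (c * L) (Costs.price f t u) (on (step t) u))))))
          (≤-by (sum-nonneg {suc H} switching≥0)
            (ring 2 (λ a b → b := a :+ b :- a)
              ≡.refl (sum (λ (t : Fin H) → service S (Costs.price f t) (step t)))
              (sum (λ (t : Fin (suc H)) → switching S (at (suc t)) (at (inject₁ t)))))))

    private
      -- Time j > 0 carries step j - 1, hence the shift. The schedule `interval` is ON to the extent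
      -- passed lo - passed hi, and passed lo + passed hi counts its switches.
      passed : ℕ → ℕ → ℝ
      passed k zero    = 0#
      passed k (suc j) = 1# - ⟦ j ℕ.<ᵇ k ⟧

      ⟦<ᵇ⟧-antitone : ∀ j k → ⟦ suc j ℕ.<ᵇ k ⟧ ≤ ⟦ j ℕ.<ᵇ k ⟧
      ⟦<ᵇ⟧-antitone j       zero          = ≤-refl
      ⟦<ᵇ⟧-antitone zero    (suc k)       = ⟦⟧-≤1 _
      ⟦<ᵇ⟧-antitone (suc j) (suc k)       = ⟦<ᵇ⟧-antitone j k

      passed-mono : ∀ k j → passed k j ≤ passed k (suc j)
      passed-mono k zero    = ≤⇒0≤ (⟦⟧-≤1 _)
      passed-mono k (suc j) = ≤-by (≤⇒0≤ (⟦<ᵇ⟧-antitone j k))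
        (ring 2 (λ a b → b :- a := con 1ℤ :- a :- (con 1ℤ :- b))
          ≡.refl (⟦ suc j ℕ.<ᵇ k ⟧) (⟦ j ℕ.<ᵇ k ⟧))

      passed≤1 : ∀ k j → passed k j ≤ 1#
      passed≤1 k zero    = 0≤1
      passed≤1 k (suc j) = ≤-by (⟦⟧-nonneg (j ℕ.<ᵇ k))
        (ring 1 (λ a → a := con 1ℤ :- (con 1ℤ :- a)) ≡.refl (⟦ j ℕ.<ᵇ k ⟧))

      ⟦≟⟧-self : ∀ {m} (v : Fin m) → ⟦ does (v Fin.≟ v) ⟧ ≈ 1#
      ⟦≟⟧-self v = self (v Fin.≟ v)
        where
        self : (q : Dec (v ≡ v)) → ⟦ does q ⟧ ≈ 1#
        self (yes _) = refl
        self (no q)  = ⊥-elim (q ≡.refl)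

      split : ∀ b q → ⟦ b ∧ q ⟧ + ⟦ not b ∧ q ⟧ ≈ ⟦ q ⟧
      split true  q = +-identityʳ _
      split false q = +-identityˡ _

    allAt : Bool → Fin n → Allocation n
    allAt b v = record
      { on        = λ u → ⟦ b ∧ does (u Fin.≟ v) ⟧
      ; off       = λ u → ⟦ not b ∧ does (u Fin.≟ v) ⟧
      ; on-range  = λ u → ⟦⟧-nonneg _ , ⟦⟧-≤1 _
      ; off-range = λ u → ⟦⟧-nonneg _ , ⟦⟧-≤1 _
      ; 0-or-1    = λ u → zero-or-one b (does (u Fin.≟ v))
      ; norm      = trans
          (+-cong (sum-cong (λ u → nonneg⇒∣∣≈ (⟦⟧-nonneg (b ∧ does (u Fin.≟ v)))))
                  (sum-cong (λ u → nonneg⇒∣∣≈ (⟦⟧-nonneg (not b ∧ does (u Fin.≟ v))))))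
          (trans (sym (sum-+ (λ u → ⟦ b ∧ does (u Fin.≟ v) ⟧) (λ u → ⟦ not b ∧ does (u Fin.≟ v) ⟧)))
            (trans (sum-cong (λ u → split b (does (u Fin.≟ v)))) (sum-≟ v)))
      ; loc       = v
      ; loc-full  = trans (split b _) (⟦≟⟧-self v)
      }
      where
      zero-or-one : ∀ b q → ⟦ b ∧ q ⟧ + ⟦ not b ∧ q ⟧ ≈ 0# ⊎ ⟦ b ∧ q ⟧ + ⟦ not b ∧ q ⟧ ≈ 1#
      zero-or-one b true  = inj₂ (split b true)
      zero-or-one b false = inj₁ (split b false)

    module _ (v : Fin n) (lo len : ℕ) (fits : lo ℕ.+ len ℕ.≤ H) (exact : c * (len · 1#) ≈ 1#) where
      private
        hi = lo ℕ.+ len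

        active : ℕ → Bool
        active zero    = false
        active (suc j) = not (j ℕ.<ᵇ lo) ∧ (j ℕ.<ᵇ hi)

        -- All travelling happens at time 1, so that the distance is paid once.
        place : ∀ {m} → Fin m → Fin n
        place zero    = s
        place (suc _) = v

        active≈ : ∀ j → ⟦ active j ⟧ ≈ passed lo j - passed hi j
        active≈ zero    = sym (-‿inverseʳ 0#)
        active≈ (suc j) = cases (j ℕ.<ᵇ lo) (j ℕ.<ᵇ hi) ≡.refl ≡.refl
          where
          cases : ∀ a b → (j ℕ.<ᵇ lo) ≡ a → (j ℕ.<ᵇ hi) ≡ b → ⟦ not a ∧ b ⟧ ≈ (1# - ⟦ a ⟧) -
            (1# - ⟦ b ⟧)
          cases true  true  _ _ = ring 0 (con 0ℤ := (con 1ℤ :- con 1ℤ) :- (con 1ℤ :- con 1ℤ)) ≡.refl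
          cases false true  _ _ = ring 0 (con 1ℤ := (con 1ℤ :- con 0ℤ) :- (con 1ℤ :- con 1ℤ)) ≡.refl
          cases false false _ _ = ring 0 (con 0ℤ := (con 1ℤ :- con 0ℤ) :- (con 1ℤ :- con 0ℤ)) ≡.refl
          cases true  false p q = ⊥-elim (≡.subst T q
            (ℕ.<⇒<ᵇ (ℕ.<-≤-trans (ℕ.<ᵇ⇒< j lo (≡.subst T (≡.sym p) _)) (ℕ.m≤m+n lo len))))

        at : Fin (suc (suc H)) → Allocation n
        at t = allAt (active (toℕ t)) (place t)

        δ : Fin n → ℝ
        δ u = ⟦ does (u Fin.≟ v) ⟧

        on-at : ∀ t u → on (at t) u ≈ ⟦ active (toℕ t) ⟧ * δ u
        on-at zero    u = sym (zeroˡ _)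
        on-at (suc t) u = ⟦∧⟧ (active (suc (toℕ t))) _

        totalOn-at : ∀ t → totalOn (at t) ≈ ⟦ active (toℕ t) ⟧
        totalOn-at t = trans (sum-cong (on-at t)) (trans (sum-* ⟦ active (toℕ t) ⟧ δ)
          (trans (*-congˡ (sum-≟ v)) (*-identityʳ _)))

        activeAt : Fin H → ℝ
        activeAt t = ⟦ active (suc (toℕ t)) ⟧

        active-step : ∀ (t : Fin H) → ⟦ active (toℕ (suc (inject₁ t))) ⟧ ≈ activeAt t
        active-step t = reflexive (≡.cong (λ j → ⟦ active (suc j) ⟧) (Fin.toℕ-inject₁ t))

        sum-active : c * sum activeAt ≈ 1#
        sum-active = trans (*-congˡ (trans (sum-cong {H} (λ t → trans (active≈ (suc (toℕ t)))
            (ring 2 (λ a b → (con 1ℤ :- a) :- (con 1ℤ :- b) := b :- a)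
              ≡.refl (⟦ toℕ t ℕ.<ᵇ lo ⟧) (⟦ toℕ t ℕ.<ᵇ hi ⟧))))
          (trans (sum-minus {H} (λ t → ⟦ toℕ t ℕ.<ᵇ hi ⟧) (λ t → ⟦ toℕ t ℕ.<ᵇ lo ⟧))
            (trans (+-cong (trans (sum-<ᵇ H fits) (×-homo-+ 1# lo len))
                           (-‿cong (sum-<ᵇ H (ℕ.≤-trans (ℕ.m≤m+n lo len) fits))))
              (ring 2 (λ a b → a :+ b :- a := b) ≡.refl (lo · 1#) (len · 1#))))))
          exact

      interval : Schedule S
      interval = record
        { at     = at
        ; starts = ⟦≟⟧-self s
        ; ends   = v , trans (reflexive (≡.cong (λ b → ⟦ not b ∧ does (v Fin.≟ v) ⟧) inactive))
          (⟦≟⟧-self v)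
        ; demand = ≤-reflexive (sym (trans
            (trans (sum-cong {H} (λ t → trans (sum-* c (on (at (suc (inject₁ t)))))
                     (*-congˡ (trans (totalOn-at (suc (inject₁ t))) (active-step t)))))
                   (sum-* {H} c activeAt))
            sum-active))
        }
        where
        inactive : active (toℕ (fromℕ (suc H))) ≡ false
        inactive = ≡.trans (≡.cong (λ j → active (suc j)) (Fin.toℕ-fromℕ H))
          (outside (H ℕ.<ᵇ hi) ≡.refl)
          where
          outside : ∀ b → (H ℕ.<ᵇ hi) ≡ b → not (H ℕ.<ᵇ lo) ∧ b ≡ false
          outside false _ = Bool.∧-zeroʳ _
          outside true  p = ⊥-elim (ℕ.<-irrefl ≡.refl
            (ℕ.<-≤-trans (ℕ.<ᵇ⇒< H hi (≡.subst T (≡.sym p) _)) fits))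

      -- One unit of work, one move by at most D c, and two switches at τ c each, where τ c is
      -- rounded up to τ.
      interval-cost : ∀ (f : Costs S) (p : ℝ) →
        (∀ t → lo ℕ.≤ toℕ t → toℕ t ℕ.< hi → Costs.price f t v ≤ c * p) →
        cost S f interval ≤ p + (τ + τ) + D * c
      interval-cost f p cheap = ≤-trans (+-mono-≤ service-cost switching-cost)
        (≤-by (*-nonneg (+-nonneg 0≤τ 0≤τ) (≤⇒0≤ c≤1))
          (ring 4 (λ p c τ D → (τ :+ τ) :* (con 1ℤ :- c)
            := (p :+ (τ :+ τ) :+ D :* c) :- (p :+ (D :* c :+ τ :* c :* (con 1ℤ :+ con 1ℤ))))
            ≡.refl p c τ D))
        where
        x = interval
        service-cost : sum (λ (t : Fin H) → service S (Costs.price f t) (at (suc (inject₁ t)))) ≤ p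
        service-cost = ≤-trans (sum-mono {H} pointwise)
          (≤-reflexive (trans (sum-* {H} (c * p) activeAt)
            (trans (ring 3 (λ c p a → c :* p :* a := c :* a :* p) ≡.refl c p (sum activeAt))
              (trans (*-congʳ sum-active) (*-identityˡ p)))))
          where
          when-active : ∀ t b → active (suc (toℕ t)) ≡ b → ⟦ b ⟧ * Costs.price f t v ≤ c * p * ⟦ b ⟧
          when-active t false _ = ≤-reflexive (trans (zeroˡ _) (sym (zeroʳ _)))
          when-active t true  q = ≤-trans (≤-reflexive (*-identityˡ _))
            (≤-respʳ-≈ (sym (*-identityʳ _)) (range (toℕ t ℕ.<ᵇ lo) (toℕ t ℕ.<ᵇ hi) ≡.refl
              ≡.refl q))
            where
            range : ∀ a b → (toℕ t ℕ.<ᵇ lo) ≡ a → (toℕ t ℕ.<ᵇ hi) ≡ b → not a ∧ b ≡ true →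
                    Costs.price f t v ≤ c * p
            range false true a≡ b≡ _ = cheap t
              (ℕ.≮⇒≥ (λ t<lo → ≡.subst T a≡ (ℕ.<⇒<ᵇ t<lo)))
              (ℕ.<ᵇ⇒< (toℕ t) hi (≡.subst T (≡.sym b≡) _))
          pointwise : ∀ t → service S (Costs.price f t) (at (suc (inject₁ t))) ≤ c * p * activeAt t
          pointwise t = ≤-trans (≤-reflexive (trans
              (sum-cong (λ u → trans (*-congˡ (trans (on-at (suc (inject₁ t)) u)
                (*-congʳ (active-step t))))
                (ring 3 (λ q a d → q :* (a :* d) := d :* (a :* q))
                  ≡.refl (Costs.price f t u) (activeAt t) (δ u))))
              (sum-pick v (λ u → activeAt t * Costs.price f t u))))
            (when-active t _ ≡.refl)
        -- Both summands increase, so the variation of their difference is at most the increase of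
        -- `change`, which telescopes to at most 2.
        change : ℕ → ℝ
        change j = passed lo j + passed hi j
        switching-cost : sum (λ (t : Fin (suc H)) → switching S (at (suc t)) (at (inject₁ t)))
                           ≤ D * c + τ * c * (1# + 1#)
        switching-cost = ≤-trans
          (≤-reflexive (sum-+ {suc H} (λ t → dist (place (inject₁ t)) v) variationAt))
          (+-mono-≤
            (≤-trans (≤-reflexive (trans (+-congˡ (sum-0 {H} (λ t → dist≈0 {v} ≡.refl)))
                       (+-identityʳ _)))
                     (dist≤Dc s v))
            (≤-trans (sum-mono {suc H} pointwise)
              (≤-trans (≤-reflexive (trans (sum-* {suc H} (τ * c)
                (λ t → change (toℕ (suc t)) - change (toℕ (inject₁ t))))
                          (*-congˡ (sum-telescope {suc H} (λ t → change (toℕ t))))))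
                (*-monoˡ-≤ (*-nonneg 0≤τ 0≤c)
                  (≤-trans (≤-reflexive (ring 1 (λ a → a :- (con 0ℤ :+ con 0ℤ) := a)
                    ≡.refl (change (toℕ (fromℕ (suc H))))))
                    (+-mono-≤ (passed≤1 lo (suc (toℕ (fromℕ H))))
                      (passed≤1 hi (suc (toℕ (fromℕ H))))))))))
          where
          variationAt : Fin (suc H) → ℝ
          variationAt t = sum (λ u → τ * c * ∣ on (at (suc t)) u - on (at (inject₁ t)) u ∣)
          variation-at : ∀ (t : Fin (suc H)) u →
            ∣ on (at (suc t)) u - on (at (inject₁ t)) u ∣ ≤
              (change (toℕ (suc t)) - change (toℕ (inject₁ t))) * δ u
          variation-at t u = ∣∣≤
            (≤-by (*-nonneg (⟦⟧-nonneg _) (+-nonneg (≤⇒0≤ monoʰ) (≤⇒0≤ monoʰ)))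
              (trans (ring 5 (λ d a a′ b b′ → d :* ((b′ :- b) :+ (b′ :- b))
                := ((a′ :+ b′) :- (a :+ b)) :* d :- ((a′ :- b′) :* d :- (a :- b) :* d))
                ≡.refl (δ u) a a′ b b′)
                (+-congˡ (-‿cong (sym difference)))))
            (≤-by (*-nonneg (⟦⟧-nonneg _) (+-nonneg (≤⇒0≤ monoˡ) (≤⇒0≤ monoˡ)))
              (trans (ring 5 (λ d a a′ b b′ → d :* ((a′ :- a) :+ (a′ :- a))
                := ((a′ :+ b′) :- (a :+ b)) :* d :- (:- ((a′ :- b′) :* d :- (a :- b) :* d)))
                ≡.refl (δ u) a a′ b b′)
                (+-congˡ (-‿cong (-‿cong (sym difference))))))
            where
            a  = passed lo (toℕ (inject₁ t))
            b  = passed hi (toℕ (inject₁ t))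
            a′ = passed lo (toℕ (suc t))
            b′ = passed hi (toℕ (suc t))
            later : ∀ k → passed k (toℕ (inject₁ t)) ≤ passed k (toℕ (suc t))
            later k = ≤-respˡ-≈ (reflexive (≡.cong (passed k) (≡.sym (Fin.toℕ-inject₁ t))))
              (passed-mono k (toℕ t))
            monoˡ = later lo
            monoʰ = later hi
            difference : on (at (suc t)) u - on (at (inject₁ t)) u ≈ (a′ - b′) * δ u - (a - b) * δ u
            difference = +-cong (trans (on-at (suc t) u) (*-congʳ (active≈ (toℕ (suc t)))))
              (-‿cong (trans (on-at (inject₁ t) u) (*-congʳ (active≈ (toℕ (inject₁ t))))))
          pointwise : ∀ (t : Fin (suc H)) →
            variationAt t ≤ τ * c * (change (toℕ (suc t)) - change (toℕ (inject₁ t)))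
          pointwise t = ≤-trans
            (≤-reflexive (sum-* (τ * c) (λ u → ∣ on (at (suc t)) u - on (at (inject₁ t)) u ∣)))
            (*-monoˡ-≤ (*-nonneg 0≤τ 0≤c)
            (≤-trans (sum-mono (variation-at t))
              (≤-reflexive (trans (sum-* (change (toℕ (suc t)) - change (toℕ (inject₁ t))) δ)
                (trans (*-congˡ (sum-≟ v)) (*-identityʳ _))))))

-- The expected behaviour of an online algorithm

module AgainstAlgorithm (R : Reals) where
  open Reals R
  open RealRing R
  open RealOrder R
  open RealSum R
  open Threshold R

  module At (L U τ D : ℝ) (0<L : 0# < L) (L<U : L < U) (0≤τ : 0# ≤ τ) (0≤D : 0# ≤ D)
            (n H : ℕ) (c : ℝ) (s : Fin n) (0<c : 0# < c) (c≤1 : c ≤ 1#)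
            (enough : 1# ≤ H · c) (spread : UniformSetup.Spread R L U τ D n) where
    open Allocations R L U τ D
    open SOAD R L U τ D
    open UniformCosts.At R L U τ D 0<L L<U 0≤τ 0≤D n H c s 0<c c≤1 enough spread

    private
      0≤c = <⇒≤ 0<c
      0≤U = <⇒≤ (<-trans 0<L L<U)

    module _ (A : RandomizedAlgorithm S) where
      private
        module A = RandomizedAlgorithm A
        open Expectation R A.space

        On Off : Costs S → Fin (suc (suc H)) → Fin n → RandomVariable
        On  f t u = rv (λ ω → on  (Schedule.at (A.run ω f) t) u) (A.on-integrable f t u)
        Off f t u = rv (λ ω → off (Schedule.at (A.run ω f) t) u) (A.off-integrable f t u)

      eOn eOff : Costs S → Fin (suc (suc H)) → Fin n → ℝ
      eOn  f t u = E (On f t u)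
      eOff f t u = E (Off f t u)

      eTotal : Costs S → Fin (suc (suc H)) → ℝ
      eTotal f t = sum (eOn f t)

      eOnIn eMassIn : (Fin n → Bool) → Costs S → Fin (suc (suc H)) → ℝ
      eOnIn G f t = sum (λ u → ⟦ G u ⟧ * eOn f t u)
      eMassIn G f t = sum (λ u → ⟦ G u ⟧ * (eOn f t u + eOff f t u))

      -- The price with index t is revealed at time t + 1: the allocation at `stepAt t` may depend
      -- on it, the one at `beforeAt t` may not.
      stepAt beforeAt : Fin H → Fin (suc (suc H))
      stepAt t = suc (inject₁ t)
      beforeAt t = inject₁ (inject₁ t)

      work : Costs S → ℝ
      work f = c * sum (λ t → eTotal f (stepAt t))

      private
        Total : Costs S → Fin (suc (suc H)) → RandomVariable
        Total f t = ∑ (On f t)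

        OnIn MassIn : (Fin n → Bool) → Costs S → Fin (suc (suc H)) → RandomVariable
        OnIn G f t = ∑ (λ u → ⟦ G u ⟧ ⊛ On f t u)
        MassIn G f t = ∑ (λ u → ⟦ G u ⟧ ⊛ (On f t u ⊕ Off f t u))

        E-OnIn : ∀ G f t → E (OnIn G f t) ≈ eOnIn G f t
        E-OnIn G f t = trans (E-∑ (λ u → ⟦ G u ⟧ ⊛ On f t u))
          (sum-cong (λ u → E-⊛ ⟦ G u ⟧ (On f t u)))

        E-MassIn : ∀ G f t → E (MassIn G f t) ≈ eMassIn G f t
        E-MassIn G f t = trans (E-∑ (λ u → ⟦ G u ⟧ ⊛ (On f t u ⊕ Off f t u)))
          (sum-cong (λ u → trans (E-⊛ ⟦ G u ⟧ (On f t u ⊕ Off f t u))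
            (*-congˡ (E-⊕ (On f t u) (Off f t u)))))

        Work : Costs S → RandomVariable
        Work f = c ⊛ ∑ (λ (t : Fin H) → Total f (stepAt t))

        E-Work : ∀ f → E (Work f) ≈ work f
        E-Work f = trans (E-⊛ c (∑ (λ t → Total f (stepAt t))))
          (*-congˡ (trans (E-∑ (λ t → Total f (stepAt t)))
          (sum-cong {H} (λ t → E-∑ (On f (stepAt t))))))

      eOn≥0 : ∀ f t u → 0# ≤ eOn f t u
      eOn≥0 f t u = E-nonneg (On f t u) (λ ω → on≥0 (Schedule.at (A.run ω f) t) u)

      eOff≥0 : ∀ f t u → 0# ≤ eOff f t u
      eOff≥0 f t u = E-nonneg (Off f t u) (λ ω → off≥0 (Schedule.at (A.run ω f) t) u)

      eMass≈1 : ∀ f t → sum (λ u → eOn f t u + eOff f t u) ≈ 1#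
      eMass≈1 f t = trans (sum-cong (λ u → sym (E-⊕ (On f t u) (Off f t u))))
        (trans (sym (E-∑ (λ u → On f t u ⊕ Off f t u)))
          (trans (E-cong (∑ (λ u → On f t u ⊕ Off f t u)) (constant 1#)
            (λ ω → mass≈1 (Schedule.at (A.run ω f) t)))
            (E-constant 1#)))

      eOnIn≥0 : ∀ G f t → 0# ≤ eOnIn G f t
      eOnIn≥0 G f t = sum-nonneg (λ u → *-nonneg (⟦⟧-nonneg (G u)) (eOn≥0 f t u))

      eMassIn≥0 : ∀ G f t → 0# ≤ eMassIn G f t
      eMassIn≥0 G f t = sum-nonneg (λ u → *-nonneg (⟦⟧-nonneg (G u))
        (+-nonneg (eOn≥0 f t u) (eOff≥0 f t u)))

      eOnIn≤eTotal : ∀ G f t → eOnIn G f t ≤ eTotal f t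
      eOnIn≤eTotal G f t = sum-mono (λ u → ⟦⟧*≤ (G u) (eOn≥0 f t u))

      eTotal≥0 : ∀ f t → 0# ≤ eTotal f t
      eTotal≥0 f t = sum-nonneg (eOn≥0 f t)

      eTotal-start≤0 : ∀ f → eTotal f zero ≤ 0#
      eTotal-start≤0 f = ≤-respˡ-≈ (E-∑ (On f zero)) (≤-respʳ-≈ (E-constant 0#)
        (E-mono (Total f zero) (constant 0#) (λ ω → totalOn-start≤0 (A.run ω f))))

      1≤work : ∀ f → 1# ≤ work f
      1≤work f = ≤-respˡ-≈ (E-constant 1#) (≤-respʳ-≈ (E-Work f)
        (E-mono (constant 1#) (Work f) (λ ω → demand-met (A.run ω f))))

      L*work≤cost : ∀ f → L * work f ≤ expectedCost A f
      L*work≤cost f = ≤-respˡ-≈ (trans (E-⊛ L (Work f)) (*-congˡ (E-Work f)))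
        (E-mono (L ⊛ Work f) (rv _ (A.cost-integrable f)) (λ ω → work-bound (A.run ω f) f))

      eCost-bound : ∀ p (L≤p : ∀ t → L ≤ p t) (p≤U : ∀ t → p t ≤ U) (G : Fin H → Fin n → Bool) →
        let f = pulses p L≤p p≤U G in
        sum (λ t → c * ((U * eTotal f (stepAt t) + (- (U - p t - D - (τ + τ))) * eOnIn (G t) f
          (stepAt t))
                        + (- 1#) * (D * eMassIn (G t) f (beforeAt t) + (τ + τ) * eOnIn (G t) f
                          (beforeAt t))))
          ≤ expectedCost A f
      eCost-bound p L≤p p≤U G = ≤-trans (≤-reflexive (sym (trans (E-∑ X) (sum-cong {H} E-X))))
        (E-mono (∑ X) (rv _ (A.cost-integrable f)) (λ ω → cost-bound (A.run ω f) p L≤p p≤U G))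
        where
        f = pulses p L≤p p≤U G
        v : Fin H → ℝ
        v t = - (U - p t - D - (τ + τ))
        Paid Lost X : Fin H → RandomVariable
        Paid t = U ⊛ Total f (stepAt t) ⊕ v t ⊛ OnIn (G t) f (stepAt t)
        Lost t = D ⊛ MassIn (G t) f (beforeAt t) ⊕ (τ + τ) ⊛ OnIn (G t) f (beforeAt t)
        X t = c ⊛ (Paid t ⊕ (- 1#) ⊛ Lost t)
        E-linear : ∀ a b X Y {x y} → E X ≈ x → E Y ≈ y → E (a ⊛ X ⊕ b ⊛ Y) ≈ a * x + b * y
        E-linear a b X Y p q = trans (E-⊕ (a ⊛ X) (b ⊛ Y))
          (+-cong (trans (E-⊛ a X) (*-congˡ p)) (trans (E-⊛ b Y) (*-congˡ q)))
        E-X : ∀ t → E (X t) ≈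
          c * ((U * eTotal f (stepAt t) + v t * eOnIn (G t) f (stepAt t))
               + (- 1#) * (D * eMassIn (G t) f (beforeAt t) + (τ + τ) * eOnIn (G t) f (beforeAt t)))
        E-X t = trans (E-⊛ c (Paid t ⊕ (- 1#) ⊛ Lost t))
          (*-congˡ (trans (E-⊕ (Paid t) ((- 1#) ⊛ Lost t))
          (+-cong
            (E-linear U (v t) (Total f (stepAt t)) (OnIn (G t) f (stepAt t))
              (E-∑ (On f (stepAt t))) (E-OnIn (G t) f (stepAt t)))
            (trans (E-⊛ (- 1#) (Lost t)) (*-congˡ
              (E-linear D (τ + τ) (MassIn (G t) f (beforeAt t)) (OnIn (G t) f (beforeAt t))
                (E-MassIn (G t) f (beforeAt t)) (E-OnIn (G t) f (beforeAt t))))))))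

      -- The price with index i belongs to time i + 1, so this covers what is revealed up to and
      -- including time t.
      AgreeBefore : Fin (suc (suc H)) → Costs S → Costs S → Set
      AgreeBefore t f f′ = ∀ i u → suc (toℕ i) ℕ.≤ toℕ t → Costs.price f i u ≈ Costs.price f′ i u

      eOn-cong : ∀ t f f′ → AgreeBefore t f f′ → ∀ u → eOn f t u ≈ eOn f′ t u
      eOn-cong t f f′ agree u = E-cong (On f t u) (On f′ t u)
        (λ ω → proj₁ (A.nonanticipating ω t f f′ agree u))

      eOff-cong : ∀ t f f′ → AgreeBefore t f f′ → ∀ u → eOff f t u ≈ eOff f′ t u
      eOff-cong t f f′ agree u = E-cong (Off f t u) (Off f′ t u)
        (λ ω → proj₂ (A.nonanticipating ω t f f′ agree u))

      eTotal-cong : ∀ t f f′ → AgreeBefore t f f′ → eTotal f t ≈ eTotal f′ t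
      eTotal-cong t f f′ agree = sum-cong (eOn-cong t f f′ agree)

      eOnIn-cong : ∀ G t f f′ → AgreeBefore t f f′ → eOnIn G f t ≈ eOnIn G f′ t
      eOnIn-cong G t f f′ agree = sum-cong (λ u → *-congˡ (eOn-cong t f f′ agree u))

      eMassIn-cong : ∀ G t f f′ → AgreeBefore t f f′ → eMassIn G f t ≈ eMassIn G f′ t
      eMassIn-cong G t f f′ agree = sum-cong (λ u → *-congˡ
        (+-cong (eOn-cong t f f′ agree u) (eOff-cong t f f′ agree u)))

    module Stages (stage : ℕ → ℕ) (stage-mono : ∀ {i j} → i ℕ.≤ j → stage i ℕ.≤ stage j)
                  (u : ℕ → ℝ) (0≤u : ∀ k → 0# ≤ u k) (u≤ : ∀ k → u k ≤ U - D - L - (τ + τ)) where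

      reduced : ℕ → ℝ
      reduced k = U - D - (τ + τ) - u k

      L≤reduced : ∀ k → L ≤ reduced k
      L≤reduced k = ≤-by (≤⇒0≤ (u≤ k))
        (ring 5 (λ U D L τ u → U :- D :- L :- (τ :+ τ) :- u := U :- D :- (τ :+ τ) :- u :- L)
          ≡.refl U D L τ (u k))

      reduced≤U : ∀ k → reduced k ≤ U
      reduced≤U k = ≤-by (+-nonneg 0≤D (+-nonneg (+-nonneg 0≤τ 0≤τ) (0≤u k)))
        (ring 4 (λ U D τ u → D :+ (τ :+ τ :+ u) := U :- (U :- D :- (τ :+ τ) :- u))
          ≡.refl U D τ (u k))

      truncated : (Fin H → Fin n → Bool) → ℕ → Fin H → Fin n → Bool
      truncated good k t v = (stage (toℕ t) ℕ.<ᵇ k) ∧ good t v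

      stageCosts : (Fin H → Fin n → Bool) → ℕ → Costs S
      stageCosts good k = pulses (λ t → reduced (stage (toℕ t))) (λ t → L≤reduced _)
        (λ t → reduced≤U _)
        (truncated good k)

      stageCosts-agree : ∀ good good′ k k′ (i : Fin H) →
        (∀ v → truncated good k i v ≡ truncated good′ k′ i v) →
        ∀ v → Costs.price (stageCosts good k) i v ≈ Costs.price (stageCosts good′ k′) i v
      stageCosts-agree good good′ k k′ i same v =
        reflexive (≡.cong (λ b → c * (U - ⟦ b ⟧ * (U - reduced (stage (toℕ i))))) (same v))

      started : ∀ {i k} → stage i ℕ.< k → (stage i ℕ.<ᵇ k) ≡ true
      started p = Equivalence.to Bool.T-≡ (ℕ.<⇒<ᵇ p)

      module _ (K : ℕ) (stage<K : ∀ (t : Fin H) → stage (toℕ t) ℕ.< K)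
               (A : RandomizedAlgorithm S) (good : Fin H → Fin n → Bool) where

        full : Costs S
        full = stageCosts good K

        -- What `switching-bound` fails to charge: presence in the good points beforehand spares the
        -- move, and being ON there spares the two switches.
        leak : Fin H → ℝ
        leak t = D * eMassIn A (good t) full (beforeAt A t) + (τ + τ) * eOnIn A (good t) full
          (beforeAt A t)

        leak≥0 : ∀ t → 0# ≤ leak t
        leak≥0 t = +-nonneg (*-nonneg 0≤D (eMassIn≥0 A (good t) full (beforeAt A t)))
          (*-nonneg (+-nonneg 0≤τ 0≤τ) (eOnIn≥0 A (good t) full (beforeAt A t)))

        private
          y : Fin H → ℝ
          y t = eOnIn A (good t) full (stepAt A t)

          y≥0 : ∀ t → 0# ≤ y t
          y≥0 t = eOnIn≥0 A (good t) full (stepAt A t)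

          isActive : ℕ → Fin H → ℝ
          isActive k t = ⟦ stage (toℕ t) ℕ.<ᵇ k ⟧

          isStage : ℕ → Fin H → ℝ
          isStage k t = ⟦ stage (toℕ t) ℕ.≡ᵇ k ⟧

          x S′ C M : ℕ → ℝ
          x k  = c * sum (λ t → isStage k t * y t)
          S′ k = c * sum (λ t → isActive k t * y t)
          C k  = c * sum (λ t → isActive k t * (u (stage (toℕ t)) * y t))
          M k  = 1# ⊔ S′ k

          additive : ∀ k (z : Fin H → ℝ) → c * sum (λ t → isActive (suc k) t * z t)
            ≈ c * sum (λ t → isActive k t * z t) + c * sum (λ t → isStage k t * z t)
          additive k z = trans (*-congˡ (trans
            (sum-cong {H} (λ t → trans (*-congʳ (⟦<ᵇ-suc⟧ (stage (toℕ t)) k)) (distribʳ (z t) _ _)))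
            (sum-+ {H} (λ t → isActive k t * z t) (λ t → isStage k t * z t)))) (distribˡ c _ _)

          C-suc : ∀ k → C (suc k) ≈ C k + u k * x k
          C-suc k = trans (additive k (λ t → u (stage (toℕ t)) * y t)) (+-congˡ (trans
            (*-congˡ (trans (sum-cong {H} (λ t → trans (current (stage (toℕ t) ℕ.≡ᵇ k) ≡.refl)
                (ring 3 (λ i u y → i :* (u :* y) := u :* (i :* y))
                  ≡.refl (isStage k t) (u k) (y t))))
              (sum-* {H} (u k) (λ t → isStage k t * y t))))
            (ring 3 (λ c u z → c :* (u :* z) := u :* (c :* z))
              ≡.refl c (u k) (sum (λ t → isStage k t * y t)))))
            where
            current : ∀ {j z} b → (j ℕ.≡ᵇ k) ≡ b → ⟦ b ⟧ * (u j * z) ≈ ⟦ b ⟧ * (u k * z)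
            current false _ = trans (zeroˡ _) (sym (zeroˡ _))
            current {j} {z} true p = *-congˡ (reflexive (≡.cong (λ i → u i * z)
              (ℕ.≡ᵇ⇒≡ j k (≡.subst T (≡.sym p) _))))

          S′-mono : ∀ k → S′ k ≤ S′ (suc k)
          S′-mono k = ≤-respʳ-≈ (sym (additive k y)) (≤-by
            (*-nonneg 0≤c (sum-nonneg {H} (λ t → *-nonneg (⟦⟧-nonneg (stage (toℕ t) ℕ.≡ᵇ k))
              (y≥0 t))))
            (ring 2 (λ a b → b := a :+ b :- a) ≡.refl (S′ k) (x k)))

          -- `stage` is monotone, so if step t precedes the truncation, all earlier steps do. The
          -- expectations under `full` therefore serve every truncation.
          agree : ∀ k t j → stage (toℕ t) ℕ.< k → toℕ j ℕ.≤ suc (toℕ t) → AgreeBefore A j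
            (stageCosts good k) full
          agree k t j t<k j≤t i v i<j = stageCosts-agree good good k K i
            (λ v → ≡.cong (_∧ good i v) (≡.trans (started (earlier t<k))
              (≡.sym (started (earlier (stage<K t)))))) v
            where
            earlier : ∀ {m} → stage (toℕ t) ℕ.< m → stage (toℕ i) ℕ.< m
            earlier = ℕ.≤-<-trans (stage-mono (ℕ.s≤s⁻¹ (ℕ.≤-trans i<j j≤t)))

          stepAt≤ : ∀ t → toℕ (stepAt A t) ℕ.≤ suc (toℕ t)
          stepAt≤ t = ℕ.≤-reflexive (≡.cong suc (Fin.toℕ-inject₁ t))

          beforeAt≤ : ∀ t → toℕ (beforeAt A t) ℕ.≤ suc (toℕ t)
          beforeAt≤ t = ℕ.≤-trans (ℕ.≤-reflexive
            (≡.trans (Fin.toℕ-inject₁ (inject₁ t)) (Fin.toℕ-inject₁ t))) (ℕ.n≤1+n _)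

          -- A truncated set is empty from stage k on, so agreement with `full` is only called for
          -- where the bracket is true.
          gate : ∀ {z : Fin n → ℝ} {z′ : ℝ} t b →
                 (b ≡ true → sum (λ v → ⟦ good t v ⟧ * z v) ≈ z′) →
                 sum (λ v → ⟦ b ∧ good t v ⟧ * z v) ≈ ⟦ b ⟧ * z′
          gate t true  p = trans (p ≡.refl) (sym (*-identityˡ _))
          gate {z} t false p = trans (sum-0 {n} (λ v → zeroˡ (z v))) (sym (zeroˡ _))

          <ᵇ⇒< : ∀ {j k} → (j ℕ.<ᵇ k) ≡ true → j ℕ.< k
          <ᵇ⇒< {j} {k} p = ℕ.<ᵇ⇒< j k (≡.subst T (≡.sym p) _)

          onIn-step : ∀ k t → eOnIn A (truncated good k t) (stageCosts good k) (stepAt A t) ≈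
            isActive k t * y t
          onIn-step k t = gate t _ λ p →
            eOnIn-cong A (good t) (stepAt A t) (stageCosts good k) full
              (agree k t (stepAt A t) (<ᵇ⇒< p) (stepAt≤ t))

          onIn-before : ∀ k t → eOnIn A (truncated good k t) (stageCosts good k) (beforeAt A t)
            ≈ isActive k t * eOnIn A (good t) full (beforeAt A t)
          onIn-before k t = gate t _ λ p →
            eOnIn-cong A (good t) (beforeAt A t) (stageCosts good k) full
              (agree k t (beforeAt A t) (<ᵇ⇒< p) (beforeAt≤ t))

          massIn-before : ∀ k t → eMassIn A (truncated good k t) (stageCosts good k) (beforeAt A t)
            ≈ isActive k t * eMassIn A (good t) full (beforeAt A t)
          massIn-before k t = gate t _ λ p →
            eMassIn-cong A (good t) (beforeAt A t) (stageCosts good k) full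
              (agree k t (beforeAt A t) (<ᵇ⇒< p) (beforeAt≤ t))

          S′≤work : ∀ k → S′ k ≤ work A (stageCosts good k)
          S′≤work k = *-monoˡ-≤ 0≤c (sum-mono {H} (λ t → ≤-respˡ-≈ (onIn-step k t)
            (eOnIn≤eTotal A (truncated good k t) (stageCosts good k) (stepAt A t))))

          -- The leaks of all stages are subtracted, including those after the truncation, which
          -- makes the error the same for all k.
          cost≥ : ∀ k → U * work A (stageCosts good k) - C k - c * sum leak ≤ expectedCost A
            (stageCosts good k)
          cost≥ k = ≤-trans
            (≤-trans (≤-reflexive (trans
                (ring 5 (λ U c w l z → U :* (c :* w) :- c :* z :- c :* l
                  := c :* U :* w :+ (:- c) :* z :+ (:- c) :* l)
                  ≡.refl U c (sum W) (sum leak) (sum Z))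
                (trans (+-cong (sym (sum-linear {H} (c * U) W (- c) Z))
                  (sym (sum-* {H} (- c) leak)))
                  (sym (sum-+ {H} (λ t → c * U * W t + (- c) * Z t) (λ t → (- c) * leak t))))))
              (sum-mono {H} pointwise))
            (eCost-bound A (λ t → reduced (stage (toℕ t))) (λ t → L≤reduced _) (λ t → reduced≤U _)
              (truncated good k))
            where
            f = stageCosts good k
            W Z : Fin H → ℝ
            W t = eTotal A f (stepAt A t)
            Z t = isActive k t * (u (stage (toℕ t)) * y t)
            pointwise : ∀ t → c * U * W t + (- c) * Z t + (- c) * leak t
              ≤ c * ((U * eTotal A f (stepAt A t)
                      + (- (U - reduced (stage (toℕ t)) - D - (τ + τ))) * eOnIn A
                        (truncated good k t) f (stepAt A t))
                     + (- 1#) * (D * eMassIn A (truncated good k t) f (beforeAt A t)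
                                 + (τ + τ) * eOnIn A (truncated good k t) f (beforeAt A t)))
            pointwise t = ≤-respʳ-≈ (sym (*-congˡ (+-cong (+-congˡ (*-congˡ (onIn-step k t)))
                (*-congˡ (+-cong (*-congˡ (massIn-before k t)) (*-congˡ (onIn-before k t)))))))
              (≤-by (*-nonneg 0≤c (*-nonneg (≤⇒0≤ (⟦⟧-≤1 (stage (toℕ t) ℕ.<ᵇ k))) (leak≥0 t)))
                (ring 10 (λ c U D τ w i u y m q → c :*
                  ((con 1ℤ :- i) :* (D :* m :+ (τ :+ τ) :* q))
                  := c :* ((U :* w :+ (:- (U :- (U :- D :- (τ :+ τ) :- u) :- D :- (τ :+ τ))) :*
                  (i :* y)) :+ (:- con 1ℤ) :* (D :* (i :* m) :+ (τ :+ τ) :* (i :* q))) :-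
                  (c :* U :* w :+ (:- c) :* (i :* (u :* y)) :+ (:- c) :*
                  (D :* m :+ (τ :+ τ) :* q))) ≡.refl c U D τ (W t) (isActive k t)
                  (u (stage (toℕ t))) (y t) (eMassIn A (good t) full (beforeAt A t))
                  (eOnIn A (good t) full (beforeAt A t))))

        -- The demand and the work at reduced prices both bound the total work from below, so M is
        -- their maximum. The error ε absorbs the leaks and the travel cost of the optimum.
        feasible : ∀ {r ε} →
          (∀ k → k ℕ.< K → expectedCost A (stageCosts good (suc k)) ≤ r *
            (reduced k + (τ + τ) + D * c)) →
          r * (D * c) + c * sum leak ≤ ε → Feasible U (U - D) r ε K u
        feasible {r} {ε} competitive small = record
          { x = x ; S = S′ ; C = C ; M = M
          ; S-zero = vanish (λ t → zeroˡ _)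
          ; S-suc  = λ k → additive k y
          ; C-zero = vanish (λ t → zeroˡ _)
          ; C-suc  = C-suc
          ; 1≤M    = λ k → x≤x∨y 1# (S′ k)
          ; M-mono = λ k → ∨-least (x≤x∨y 1# (S′ (suc k)))
            (≤-trans (S′-mono k) (y≤x∨y 1# (S′ (suc k))))
          ; S≤M    = y≤x∨y 1# (S′ K)
          ; constraint = λ k k<K → let f = stageCosts good (suc k) in ≤-by
              (+-nonneg
                (+-nonneg (*-nonneg 0≤U (≤⇒0≤ (∨-least (1≤work A f) (S′≤work (suc k)))))
                          (≤⇒0≤ (cost≥ (suc k))))
                (+-nonneg (≤⇒0≤ (competitive k k<K)) (≤⇒0≤ small)))
              (ring 12 (λ U D r ε τ c u M w C l a →
                (U :* (w :- M) :+ (a :- (U :* w :- C :- c :* l))) :+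
                ((r :* (U :- D :- (τ :+ τ) :- u :+ (τ :+ τ) :+ D :* c) :- a) :+
                (ε :- (r :* (D :* c) :+ c :* l))) := (r :* (U :- D :- u) :+ ε) :- (U :* M :- C))
                ≡.refl U D r ε τ c (u k) (M (suc k)) (work A f) (C (suc k)) (sum leak)
                (expectedCost A f))
          }
          where
          vanish : ∀ {z : Fin H → ℝ} → (∀ t → z t ≈ 0#) → c * sum z ≈ 0#
          vanish p = trans (*-congˡ (sum-0 {H} p)) (zeroʳ c)

-- Greedy choice of the reductions against the player

infixl 8 _[_]≔_
_[_]≔_ : ∀ {Q} {A : Set} → Vector A Q → Fin Q → A → Vector A Q
a [ q ]≔ o = updateAt a q (λ _ → o)

updated : ∀ {Q} {A : Set} (a : Vector A Q) q o → (a [ q ]≔ o) q ≡ o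
updated a q o = updateAt-updates q a

unchanged : ∀ {Q} {A : Set} (a : Vector A Q) {q o i} → i ≢ q → (a [ q ]≔ o) i ≡ a i
unchanged a {q} {o} {i} = updateAt-minimal i q a

/-unique : ∀ ℓ .{{_ : NonZero ℓ}} {k j} → k ℕ.* ℓ ℕ.≤ j → j ℕ.< k ℕ.* ℓ ℕ.+ ℓ → j ℕ./ ℓ ≡ k
/-unique ℓ {k} {j} lo hi = ℕ.≤-antisym
  (ℕ.s≤s⁻¹ (ℕ.m<n*o⇒m/o<n {j} {suc k} {ℓ} (ℕ.<-≤-trans hi (ℕ.≤-reflexive (ℕ.+-comm (k ℕ.* ℓ) ℓ)))))
  (ℕ.≤-trans (ℕ.≤-reflexive (≡.sym (ℕ.m*n/n≡m k ℓ))) (ℕ./-monoˡ-≤ ℓ lo))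

module AdaptiveChoice (R : Reals) where
  open Reals R
  open RealRing R
  open RealOrder R
  open RealSum R

  sum-partition : ∀ {n b} (g : Fin n → Fin b) (z : Fin n → ℝ) →
    sum (λ o → sum (λ v → ⟦ does (g v Fin.≟ o) ⟧ * z v)) ≈ sum z
  sum-partition {n} {b} g z = trans (∑-comm {b} {n} (λ o v → ⟦ does (g v Fin.≟ o) ⟧ * z v))
    (sum-cong {n} (λ v → trans
      (sum-cong {b} (λ o → *-comm (⟦ does (g v Fin.≟ o) ⟧) (z v)))
      (trans (sum-* {b} (z v) (λ o → ⟦ does (g v Fin.≟ o) ⟧))
        (trans (*-congˡ (sum-≟ʳ (g v))) (*-identityʳ (z v))))))

  -- If no o worked, summing C′ ≤ (b + 1) f o over all o would give C′ ≤ C.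
  pigeonhole : ∀ {b C C′} (f : Fin (suc b) → ℝ) → sum f ≤ C → C < C′ →
    ¬ ¬ ∃ λ o → (suc b · 1#) * f o ≤ C′
  pigeonhole {b} {C} {C′} f Σf≤C C<C′ none = *-cancel-pos-≤ (0<n·1 b)
    (≤-respˡ-≈ (sum-const (suc b) C′)
      (≤-trans (sum-mono {suc b} (λ o bfo<C′ → none (o , <⇒≤ bfo<C′)))
        (≤-trans (≤-reflexive (sum-* {suc b} (suc b · 1#) f)) (*-monoˡ-≤ (<⇒≤ (0<n·1 b)) Σf≤C))))
    C<C′

  -- With the earlier entries fixed, averaging over the b + 1 options yields a good entry q. Later
  -- choices do not spoil it, as `err a q` ignores later entries.
  adaptive-choice : ∀ {b Q C C′} (err : (Fin Q → Fin (suc b)) → Fin Q → ℝ) →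
    (∀ {a a′} q → (∀ i → toℕ i ℕ.≤ toℕ q → a i ≡ a′ i) → err a q ≈ err a′ q) →
    (∀ a q → sum (λ o → err (a [ q ]≔ o) q) ≤ C) → C < C′ →
    ¬ ¬ ∃ λ a → ∀ q → (suc b · 1#) * err a q ≤ C′
  adaptive-choice {b} {Q} {C} {C′} err local bound C<C′ none =
    upTo Q λ (a , p) → none (a , λ q → p q (Fin.toℕ<n q))
    where
    Good : ℕ → (Fin Q → Fin (suc b)) → Set
    Good k a = ∀ q → toℕ q ℕ.< k → (suc b · 1#) * err a q ≤ C′
    upTo : ∀ k → ¬ ¬ ∃ (Good k)
    upTo zero    none = none ((λ _ → zero) , λ _ ())
    upTo (suc k) none = upTo k λ (a , p) → extend a p (k ℕ.<? Q)
      where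
      extend : ∀ a → Good k a → Dec (k ℕ.< Q) → ⊥
      extend a p (no k≮Q) = none (a , λ q _ → p q (ℕ.<-≤-trans (Fin.toℕ<n q) (ℕ.≮⇒≥ k≮Q)))
      extend a p (yes k<Q) = pigeonhole (λ o → err (a [ q₀ ]≔ o) q₀) (bound a q₀) C<C′
        λ (o , small) → none (a [ q₀ ]≔ o , λ q q<1+k → [ earlier o q , now o small q ]′
          (ℕ.m<1+n⇒m<n∨m≡n q<1+k))
        where
        q₀ = fromℕ< k<Q
        toℕ-q₀ : toℕ q₀ ≡ k
        toℕ-q₀ = Fin.toℕ-fromℕ< k<Q
        earlier : ∀ o q → toℕ q ℕ.< k → (suc b · 1#) * err (a [ q₀ ]≔ o) q ≤ C′
        earlier o q q<k = ≤-respˡ-≈ (*-congˡ (local q (λ i i≤q → ≡.sym (unchanged a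
          (λ i≡q₀ → ℕ.<⇒≢ (ℕ.≤-<-trans i≤q q<k) (≡.trans (≡.cong toℕ i≡q₀) toℕ-q₀)))))) (p q q<k)
        now : ∀ o → (suc b · 1#) * err (a [ q₀ ]≔ o) q₀ ≤ C′ →
              ∀ q → toℕ q ≡ k → (suc b · 1#) * err (a [ q₀ ]≔ o) q ≤ C′
        now o small q q≡k = ≡.subst (λ q → (suc b · 1#) * err (a [ q₀ ]≔ o) q ≤ C′)
          (Fin.toℕ-injective (≡.trans toℕ-q₀ (≡.sym q≡k))) small

-- The two kinds of star instances, for D > 0 and for D = 0

module StarInstances (R : Reals) where
  open Reals R
  open RealRing R
  open RealOrder R
  open RealSum R
  open Exponential R using (1/[1+_]; *-1/[1+n]; 0<1/[1+n]; 1/[1+n]≤1)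
  open Threshold R
  open AdaptiveChoice R

  ·-as-* : ∀ n x → n · x ≈ (n · 1#) * x
  ·-as-* zero    x = sym (zeroˡ x)
  ·-as-* (suc n) x = trans (+-congˡ (·-as-* n x))
    (ring 2 (λ x n → x :+ n :* x := (con 1ℤ :+ n) :* x) ≡.refl x (n · 1#))

  module Against (L U τ D : ℝ) (0<L : 0# < L) (L<U : L < U) (0≤τ : 0# ≤ τ) (0≤D : 0# ≤ D)
    (OPT : SOAD.Instance R L U τ D → ℝ)
    (optimal : ∀ I → SOAD.IsOptimalCost R L U τ D (SOAD.setup I) (SOAD.costs I) (OPT I))
    (A : SOAD.OnlineAlgorithm R L U τ D) (r : ℝ)
    (bounded : SOAD.RatioBound R L U τ D OPT A
                 (λ I → Star.IsWeightedStar R (SOAD.Instance.d I)) r) where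
    open SOAD R L U τ D hiding (costs)

    module Setting (n H : ℕ) (c : ℝ) (s : Fin n) (0<c : 0# < c) (c≤1 : c ≤ 1#)
                   (enough : 1# ≤ H · c) (spread : UniformSetup.Spread R L U τ D n) where
      open UniformCosts.At R L U τ D 0<L L<U 0≤τ 0≤D n H c s 0<c c≤1 enough spread public
      open AgainstAlgorithm.At R L U τ D 0<L L<U 0≤τ 0≤D n H c s 0<c c≤1 enough spread public

      instanceOf : Costs S → Instance
      instanceOf f = record { setup = S ; costs = f }

      private
        0≤OPT : ∀ f → 0# ≤ OPT (instanceOf f)
        0≤OPT f = proj₂ (optimal (instanceOf f)) 0# λ z (x , z≈cost) →
          ≤-respʳ-≈ (sym z≈cost) (≤-trans (*-nonneg (<⇒≤ 0<L) (≤-trans 0≤1 (demand-met x)))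
            (work-bound x f))

      -- The player pays at least L > 0, but a negative r would bound this by r OPT ≤ 0.
      0≤ratio : Costs S → 0# ≤ r
      0≤ratio f r<0 = ≤-trans
        (≤-trans (≤-respˡ-≈ (*-identityʳ L) (*-monoˡ-≤ (<⇒≤ 0<L) (1≤work (A S) f)))
          (L*work≤cost (A S) f))
        (≤-trans (bounded (instanceOf f) isWeightedStar)
          (≤-by (*-nonneg (<⇒≤ (<⇒0< r<0)) (0≤OPT f))
            (ring 2 (λ r o → (con 0ℤ :- r) :* o := con 0ℤ :- r :* o)
              ≡.refl r (OPT (instanceOf f)))))
        0<L

      competitive : ∀ (f : Costs S) v lo len (fits : lo ℕ.+ len ℕ.≤ H)
        (exact : c * (len · 1#) ≈ 1#) p →
        (∀ t → lo ℕ.≤ toℕ t → toℕ t ℕ.< lo ℕ.+ len → Costs.price f t v ≤ c * p) →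
        expectedCost (A S) f ≤ r * (p + (τ + τ) + D * c)
      competitive f v lo len fits exact p cheap = ≤-trans (bounded (instanceOf f) isWeightedStar)
        (*-monoˡ-≤ (0≤ratio f) (≤-trans
          (proj₁ (optimal (instanceOf f)) _ (interval v lo len fits exact , refl))
          (interval-cost v lo len fits exact f p cheap)))

    module Spread (0<D : 0# < D) (N : ℕ) (u : ℕ → ℝ) (ε : ℝ) (0≤u : ∀ k → 0# ≤ u k)
                  (u≤ : ∀ k → u k ≤ U - D - L - (τ + τ)) (0<ε : 0# < ε) where
      private
        0<½ε : 0# < ½ * ε
        0<½ε = *-pos 0<½ 0<ε
        -- A unit of work takes ℓ = 1 / c steps, and r D ≤ ½ ε ℓ keeps the travel cost of the
        -- optimum, times r, below ½ ε. The losses of the H steps, at most C′ / (b + 1) each, stay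
        -- below the other ½ ε. As b is at least 1, there are two digits and hence two distinct
        -- points.
        m ℓ K H b n : ℕ
        m = proj₁ (archimedean′ (r * D) 0<½ε)
        ℓ = suc m
        K = suc N
        H = K ℕ.* ℓ
        c C′ wasted : ℝ
        c = 1/[1+ m ]
        0<c : 0# < c
        0<c = 0<1/[1+n] m
        -- The bound of `loss-sum` plus 1, as `pigeonhole` asks for a strict inequality.
        C′ = D + (τ + τ) + 1#
        wasted = c * ((H · 1#) * C′)
        b = suc (proj₁ (archimedean′ wasted 0<½ε))
        n = suc b ℕ.^ H

        stage : ℕ → ℕ
        stage j = j ℕ./ ℓ

        digit : Fin n → Fin H → Fin (suc b)
        digit = finToFun

        point : (Fin H → Fin (suc b)) → Fin n
        point = funToFin

        enough : 1# ≤ H · c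
        enough = ≤-trans (≤-reflexive (sym (*-1/[1+n] m)))
          (≤-trans (≤-by (*-nonneg (≤⇒0≤ (fromℕ-mono (ℕ.m≤m+n ℓ (N ℕ.* ℓ)))) (<⇒≤ 0<c))
              (ring 3 (λ a b c → (b :- a) :* c := b :* c :- a :* c) ≡.refl (ℓ · 1#) (H · 1#) c))
            (≤-reflexive (sym (·-as-* H c))))

        zeros ones : Fin H → Fin (suc b)
        zeros _ = zero
        ones _  = suc zero

        distinct : point zeros ≢ point ones
        distinct eq = Fin.0≢1+n (≡.trans (≡.sym (Fin.finToFun-funToFin zeros zero))
          (≡.trans (≡.cong (λ v → digit v zero) eq) (Fin.finToFun-funToFin ones zero)))

      open Setting n H c (point zeros) 0<c (1/[1+n]≤1 m) enough
        (inj₁ (0<D , point zeros , point ones , distinct))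
      open Stages stage (ℕ./-monoˡ-≤ ℓ) u 0≤u u≤

      private
        stage<K : ∀ (t : Fin H) → stage (toℕ t) ℕ.< K
        stage<K t = ℕ.m<n*o⇒m/o<n {toℕ t} {K} {ℓ} (Fin.toℕ<n t)

        -- The points whose t-th digit is a t.  The location before step t is independent of
        -- a t, so for a suitable a t it is rarely one of them.
        good : (Fin H → Fin (suc b)) → Fin H → Fin n → Bool
        good a t v = does (digit v t Fin.≟ a t)

        loss : (Fin H → Fin (suc b)) → Fin H → ℝ
        loss a t = leak K stage<K (A S) (good a) t

        -- The digit `a t` first shows in the price of step t, which is revealed after `beforeAt t`.
        same-before : ∀ a a′ t → (∀ i → toℕ i ℕ.< toℕ t → a i ≡ a′ i) →
          AgreeBefore (A S) (beforeAt (A S) t) (stageCosts (good a) K) (stageCosts (good a′) K)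
        same-before a a′ t same i v i<t = stageCosts-agree (good a) (good a′) K K i
          (λ v → ≡.cong (λ o → (stage (toℕ i) ℕ.<ᵇ K) ∧ does (digit v i Fin.≟ o))
            (same i (ℕ.≤-trans i<t (ℕ.≤-reflexive
              (≡.trans (Fin.toℕ-inject₁ (inject₁ t)) (Fin.toℕ-inject₁ t))))))
          v

        loss-local : ∀ {a a′} t → (∀ i → toℕ i ℕ.≤ toℕ t → a i ≡ a′ i) → loss a t ≈ loss a′ t
        loss-local {a} {a′} t same = +-cong
          (*-congˡ (trans (eMassIn-cong (A S) (good a t) prior f f′ agree)
            (sum-cong {n} (λ v → *-congʳ (same-good v)))))
          (*-congˡ (trans (eOnIn-cong (A S) (good a t) prior f f′ agree)
            (sum-cong {n} (λ v → *-congʳ (same-good v)))))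
          where
          prior = beforeAt (A S) t
          f  = stageCosts (good a) K
          f′ = stageCosts (good a′) K
          agree = same-before a a′ t (λ i i<t → same i (ℕ.<⇒≤ i<t))
          same-good : ∀ v → ⟦ good a t v ⟧ ≈ ⟦ good a′ t v ⟧
          same-good v = reflexive (≡.cong (λ o → ⟦ does (digit v t Fin.≟ o) ⟧) (same t ℕ.≤-refl))

        -- The player has not yet seen the digit, so its distribution is the same for all o. The
        -- points with t-th digit o partition the space, so the losses add up to that of the whole
        -- space, where the mass is 1.
        loss-sum : ∀ a t → sum (λ o → loss (a [ t ]≔ o) t) ≤ D + (τ + τ)
        loss-sum a t = ≤-trans (≤-reflexive (trans (sum-cong {suc b} loss-at)
            (trans (sum-linear {suc b} D massAt (τ + τ) onAt)
              (+-cong (*-congˡ (trans (sum-partition (λ v → digit v t) mass)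
                (eMass≈1 (A S) f₀ prior)))
                      (*-congˡ (sum-partition (λ v → digit v t) (eOn (A S) f₀ prior)))))))
          (≤-by (*-nonneg (+-nonneg 0≤τ 0≤τ) (≤⇒0≤ on≤1))
            (ring 3 (λ D τ e → (τ :+ τ) :* (con 1ℤ :- e)
              := (D :+ (τ :+ τ)) :- (D :* con 1ℤ :+ (τ :+ τ) :* e))
              ≡.refl D τ (eTotal (A S) f₀ prior)))
          where
          prior = beforeAt (A S) t
          f₀ = stageCosts (good a) K
          f : Fin (suc b) → Costs S
          f o = stageCosts (good (a [ t ]≔ o)) K
          mass : Fin n → ℝ
          mass v = eOn (A S) f₀ prior v + eOff (A S) f₀ prior v
          massAt onAt : Fin (suc b) → ℝ
          massAt o = sum (λ v → ⟦ does (digit v t Fin.≟ o) ⟧ * mass v)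
          onAt o   = sum (λ v → ⟦ does (digit v t Fin.≟ o) ⟧ * eOn (A S) f₀ prior v)
          on≤1 : eTotal (A S) f₀ prior ≤ 1#
          on≤1 = ≤-respʳ-≈ (eMass≈1 (A S) f₀ prior) (sum-mono {n} (λ v →
            ≤-by (eOff≥0 (A S) f₀ prior v)
              (ring 2 (λ x y → y := x :+ y :- x)
                ≡.refl (eOn (A S) f₀ prior v) (eOff (A S) f₀ prior v))))
          agree : ∀ o → AgreeBefore (A S) prior (f o) f₀
          agree o = same-before (a [ t ]≔ o) a t
            (λ i i<t → unchanged a (λ i≡t → ℕ.<⇒≢ i<t (≡.cong toℕ i≡t)))
          chosen : ∀ o v → ⟦ good (a [ t ]≔ o) t v ⟧ ≈ ⟦ does (digit v t Fin.≟ o) ⟧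
          chosen o v = reflexive (≡.cong (λ o → ⟦ does (digit v t Fin.≟ o) ⟧) (updated a t o))
          loss-at : ∀ o → loss (a [ t ]≔ o) t ≈ D * massAt o + (τ + τ) * onAt o
          loss-at o = +-cong
            (*-congˡ (trans (eMassIn-cong (A S) (good (a [ t ]≔ o) t) prior (f o) f₀ (agree o))
              (sum-cong {n} (λ v → *-congʳ (chosen o v)))))
            (*-congˡ (trans (eOnIn-cong (A S) (good (a [ t ]≔ o) t) prior (f o) f₀ (agree o))
              (sum-cong {n} (λ v → *-congʳ (chosen o v)))))

        small : ∀ a → (∀ t → (suc b · 1#) * loss a t ≤ C′) → r * (D * c) + c * sum (loss a) ≤ ε
        small a p = ≤-respʳ-≈ (half+half ε) (+-mono-≤ moving leaking)
          where
          moving : r * (D * c) ≤ ½ * ε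
          moving = ≤-trans (≤-by (*-nonneg (≤⇒0≤ (proj₂ (archimedean′ (r * D) 0<½ε))) (<⇒≤ 0<c))
              (ring 5 (λ r D c h l → (l :* h :- r :* D) :* c := l :* c :* h :- r :* (D :* c))
                ≡.refl r D c (½ * ε) (ℓ · 1#)))
            (≤-reflexive (trans (*-congʳ (*-1/[1+n] m)) (*-identityˡ _)))
          leaking : c * sum (loss a) ≤ ½ * ε
          leaking = *-cancel-pos-≤ (0<n·1 b) (≤-trans
            (≤-by (*-nonneg (<⇒≤ 0<c) (≤⇒0≤ (≤-respˡ-≈ (sum-* {H} (suc b · 1#) (loss a))
                    (≤-respʳ-≈ (sum-const H C′) (sum-mono {H} p)))))
              (ring 4 (λ c b l w → c :* (w :- b :* l) := c :* w :- b :* (c :* l))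
                ≡.refl c (suc b · 1#) (sum (loss a)) ((H · 1#) * C′)))
            (≤-trans (proj₂ (archimedean′ wasted 0<½ε))
              (≤-by (<⇒≤ 0<½ε) (ring 2 (λ h b → h := (con 1ℤ :+ b) :* h :- b :* h)
                ≡.refl (½ * ε) (b · 1#)))))

        -- All digits of `point a` agree with a, so it is cheap in every step before the truncation;
        -- the ℓ steps of stage k suffice for the demand.
        stage-competitive : ∀ a k → k ℕ.< K →
          expectedCost (A S) (stageCosts (good a) (suc k)) ≤ r * (reduced k + (τ + τ) + D * c)
        stage-competitive a k k<K = competitive (stageCosts (good a) (suc k)) (point a) (k ℕ.* ℓ) ℓ
          (ℕ.≤-trans (ℕ.≤-reflexive (ℕ.+-comm (k ℕ.* ℓ) ℓ)) (ℕ.*-monoˡ-≤ ℓ k<K))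
          (trans (*-comm c _) (*-1/[1+n] m)) (reduced k) cheap
          where
          cheap : ∀ t → k ℕ.* ℓ ℕ.≤ toℕ t → toℕ t ℕ.< k ℕ.* ℓ ℕ.+ ℓ →
                  Costs.price (stageCosts (good a) (suc k)) t (point a) ≤ c * reduced k
          cheap t lo hi = ≤-reflexive (trans
            (reflexive (≡.cong₂ (λ g j → c * (U - ⟦ g ⟧ * (U - reduced j)))
              (≡.cong₂ _∧_ (started {toℕ t} {suc k} (ℕ.s≤s (ℕ.≤-reflexive (/-unique ℓ {k} lo hi))))
                (≡.trans (≡.cong (λ o → does (o Fin.≟ a t)) (Fin.finToFun-funToFin a t))
                  (dec-true (a t Fin.≟ a t) ≡.refl)))
              (/-unique ℓ {k} lo hi)))
            (ring 3 (λ c U p → c :* (U :- con 1ℤ :* (U :- p)) := c :* p) ≡.refl c U (reduced k)))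

      spread-0≤r : 0# ≤ r
      spread-0≤r = 0≤ratio (stageCosts (λ _ _ → false) 0)

      spread-feasible : ¬ ¬ Feasible U (U - D) r ε K u
      spread-feasible none = adaptive-choice loss loss-local loss-sum
        (<-by 0<1 (ring 1 (λ x → con 1ℤ := x :+ con 1ℤ :- x) ≡.refl (D + (τ + τ))))
        λ (a , p) → none (feasible K stage<K (A S) (good a) (stage-competitive a) (small a p))

    module Single (D≈0 : D ≈ 0#) (N : ℕ) (u : ℕ → ℝ) (ε : ℝ) (0≤u : ∀ k → 0# ≤ u k)
                  (u≤ : ∀ k → u k ≤ U - D - L - (τ + τ)) (0<ε : 0# < ε) where
      private
        0≤2τ : 0# ≤ τ + τ
        0≤2τ = +-nonneg 0≤τ 0≤τ
        -- Working in the first step, at a price of at most U, bounds OPT for any costs; r times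
        -- this bound is `maxCost`, and division by L bounds the expected work. C is 2τ times the
        -- latter. Some step of a stage then has a loss of at most C′ / ℓ, and ℓ is so large that K
        -- such losses stay below ε.
        1/L maxCost C C′ wasted : ℝ
        1/L     = L ⁻¹[ >⇒#0 0<L ]
        maxCost = r * (U + (τ + τ) + D * 1#)
        C       = (τ + τ) * (1/L * maxCost)
        C′      = C + 1#
        K b ℓ H : ℕ
        K       = suc N
        wasted  = (K · 1#) * C′
        b       = proj₁ (archimedean′ wasted 0<ε)
        ℓ       = suc b
        H       = K ℕ.* ℓ

        stage : ℕ → ℕ
        stage j = j ℕ./ ℓ

        one-point : (v v′ : Fin 1) → v ≡ v′
        one-point zero zero = ≡.refl

      open Setting 1 H 1# zero 0<1 ≤-refl (1≤fromℕ-suc (b ℕ.+ N ℕ.* ℓ))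
        (inj₂ (D≈0 , one-point))
      open Stages stage (ℕ./-monoˡ-≤ ℓ) u 0≤u u≤

      private
        stage<K : ∀ (t : Fin H) → stage (toℕ t) ℕ.< K
        stage<K t = ℕ.m<n*o⇒m/o<n {toℕ t} {K} {ℓ} (Fin.toℕ<n t)

        slot : Fin H → Fin K
        slot t = proj₁ (remQuot {K} ℓ t)

        offset : Fin H → Fin ℓ
        offset t = proj₂ (remQuot {K} ℓ t)

        time : Fin K → Fin ℓ → Fin H
        time = combine

        time-slot-offset : ∀ t → time (slot t) (offset t) ≡ t
        time-slot-offset t = Fin.combine-remQuot {K} ℓ t

        slot-time : ∀ q o → slot (time q o) ≡ q
        slot-time q o = ≡.cong proj₁ (Fin.remQuot-combine q o)

        offset-time : ∀ q o → offset (time q o) ≡ o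
        offset-time q o = ≡.cong proj₂ (Fin.remQuot-combine {K} q o)

        toℕ-time : ∀ q o → toℕ (time q o) ≡ toℕ q ℕ.* ℓ ℕ.+ toℕ o
        toℕ-time q o = ≡.trans (Fin.toℕ-combine q o) (≡.cong (ℕ._+ toℕ o) (ℕ.*-comm ℓ (toℕ q)))

        stage≡slot : ∀ t → stage (toℕ t) ≡ toℕ (slot t)
        stage≡slot t = /-unique ℓ {toℕ (slot t)}
          (ℕ.≤-trans (ℕ.m≤m+n _ (toℕ (offset t))) (ℕ.≤-reflexive split))
          (ℕ.≤-<-trans (ℕ.≤-reflexive (≡.sym split)) (ℕ.+-monoʳ-< _ (Fin.toℕ<n (offset t))))
          where
          split : toℕ (slot t) ℕ.* ℓ ℕ.+ toℕ (offset t) ≡ toℕ t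
          split = ≡.trans (≡.sym (toℕ-time (slot t) (offset t))) (≡.cong toℕ (time-slot-offset t))

        slot-mono : ∀ {i t} → toℕ i ℕ.≤ toℕ t → toℕ (slot i) ℕ.≤ toℕ (slot t)
        slot-mono {i} {t} i≤t = ≡.subst₂ ℕ._≤_ (stage≡slot i) (stage≡slot t) (ℕ./-monoˡ-≤ ℓ i≤t)

        -- The price is reduced at one time step a q of stage q, chosen such that the player
        -- is hardly ever ON just before it.
        good : (Fin K → Fin ℓ) → Fin H → Fin 1 → Bool
        good a t _ = does (offset t Fin.≟ a (slot t))

        prior : Fin H → Fin (suc (suc H))
        prior = beforeAt (A S)

        toℕ-prior : ∀ t → toℕ (prior t) ≡ toℕ t
        toℕ-prior t = ≡.trans (Fin.toℕ-inject₁ (inject₁ t)) (Fin.toℕ-inject₁ t)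

        full′ : (Fin K → Fin ℓ) → Costs S
        full′ a = stageCosts (good a) K

        ready : (Fin K → Fin ℓ) → Fin K → Fin ℓ → ℝ
        ready a q o = (τ + τ) * eTotal (A S) (full′ a) (prior (time q o))

        loss : (Fin K → Fin ℓ) → Fin K → ℝ
        loss a q = ready a q (a q)

        -- With D = 0 only being ON beforehand leaks, and only at the chosen offset of a stage.
        leak-time : ∀ a q o → leak K stage<K (A S) (good a) (time q o) ≈ ⟦ does (o Fin.≟ a q) ⟧ *
          ready a q o
        leak-time a q o = trans
          (+-cong (trans (*-congʳ D≈0) (zeroˡ _))
            (*-congˡ (trans
              (sum-cong {1} {λ v → ⟦ good a (time q o) v ⟧ * e v}
                {λ v → ⟦ does (o Fin.≟ a q) ⟧ * e v}
                (λ v → *-congʳ (reflexive same)))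
              (sum-* {1} ⟦ does (o Fin.≟ a q) ⟧ e))))
          (ring 3 (λ τ g e → con 0ℤ :+ (τ :+ τ) :* (g :* e) := g :* ((τ :+ τ) :* e))
            ≡.refl τ (⟦ does (o Fin.≟ a q) ⟧) (eTotal (A S) (full′ a) (prior (time q o))))
          where
          e : Fin 1 → ℝ
          e = eOn (A S) (full′ a) (prior (time q o))
          same : ⟦ does (offset (time q o) Fin.≟ a (slot (time q o))) ⟧ ≡ ⟦ does (o Fin.≟ a q) ⟧
          same = ≡.cong₂ (λ i j → ⟦ does (i Fin.≟ a j) ⟧) (offset-time q o) (slot-time q o)

        sum-leak : ∀ a → sum (leak K stage<K (A S) (good a)) ≈ sum (loss a)
        sum-leak a = trans (sum-combine K {ℓ} (leak K stage<K (A S) (good a)))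
          (sum-cong {K} (λ q → trans (sum-cong {ℓ} (leak-time a q)) (sum-pick (a q) (ready a q))))

        ready-local : ∀ {a a′} q → (∀ i → toℕ i ℕ.≤ toℕ q → a i ≡ a′ i) → ∀ o → ready a q o ≈
          ready a′ q o
        ready-local {a} {a′} q same o = *-congˡ
          (eTotal-cong (A S) (prior (time q o)) (full′ a) (full′ a′)
          λ i v i<t → stageCosts-agree (good a) (good a′) K K i
            (λ _ → ≡.cong (λ o → (stage (toℕ i) ℕ.<ᵇ K) ∧ does (offset i Fin.≟ o))
              (same (slot i) (ℕ.≤-trans
                (slot-mono (ℕ.<⇒≤ (ℕ.≤-trans i<t (ℕ.≤-reflexive (toℕ-prior (time q o))))))
                (ℕ.≤-reflexive (≡.cong toℕ (slot-time q o)))))) v)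

        loss-local : ∀ {a a′} q → (∀ i → toℕ i ℕ.≤ toℕ q → a i ≡ a′ i) → loss a q ≈ loss a′ q
        loss-local {a} {a′} q same = trans (ready-local q same (a q))
          (reflexive (≡.cong (ready a′ q) (same q ℕ.≤-refl)))

        -- A shift by one step: the player starts OFF, and the last step only adds to the right
        -- side, where c = 1.
        sum-prior≤work : ∀ f → sum (λ t → eTotal (A S) f (prior t)) ≤ work (A S) f
        sum-prior≤work f = ≤-trans
          (≤-by (eTotal≥0 (A S) f (inject₁ (fromℕ H)))
            (ring 2 (λ a e → e := a :+ e :- a)
              ≡.refl (sum (λ t → eTotal (A S) f (prior t))) (eTotal (A S) f (inject₁ (fromℕ H)))))
          (≤-trans (≤-reflexive (sym (sum-init-last {H} (λ t → eTotal (A S) f (inject₁ t)))))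
            (≤-by (≤⇒0≤ (eTotal-start≤0 (A S) f))
              (ring 2 (λ a w → con 0ℤ :- a := con 1ℤ :* w :- (a :+ w))
                ≡.refl (eTotal (A S) f zero) (sum
                (λ (t : Fin H) → eTotal (A S) f (suc (inject₁ t)))))))

        work≤ : ∀ f → work (A S) f ≤ 1/L * maxCost
        work≤ f = *-cancel-pos-≤ 0<L (≤-trans (L*work≤cost (A S) f)
          (≤-trans (competitive f zero 0 1 (ℕ.s≤s ℕ.z≤n)
            (ring 0 (con 1ℤ :* (con 1ℤ :+ con 0ℤ) := con 1ℤ) ≡.refl) U
                     (λ t _ _ → Costs.upper f t zero))
            (≤-reflexive (sym (trans (sym (*-assoc L 1/L maxCost))
              (trans (*-congʳ (*-inverseʳ (>⇒#0 0<L))) (*-identityˡ maxCost)))))))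

        ≮⇒false : ∀ {j k} → ¬ (j ℕ.< k) → (j ℕ.<ᵇ k) ≡ false
        ≮⇒false {j} {k} j≮k = Bool.¬-not λ p → j≮k (ℕ.<ᵇ⇒< j k (Equivalence.from Bool.T-≡ p))

        -- Until the reduction of stage q comes, the prices are those of `f₀`, which reduces nothing
        -- from stage q on. All options o are thus measured in one instance, where their sum is at
        -- most 2τ times the total work.
        loss-sum : ∀ a q → sum (λ o → loss (a [ q ]≔ o) q) ≤ C
        loss-sum a q = ≤-trans (≤-reflexive (trans (sum-cong {ℓ} loss-at)
          (sum-* {ℓ} (τ + τ) (λ o → h (time q o)))))
          (*-monoˡ-≤ 0≤2τ (≤-trans
            (≤-sum {K} {λ q → sum (λ o → h (time q o))}
              (λ q → sum-nonneg {ℓ} (λ o → eTotal≥0 (A S) f₀ (prior (time q o)))) q)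
            (≤-trans (≤-reflexive (sym (sum-combine K {ℓ} h)))
              (≤-trans (sum-prior≤work f₀) (work≤ f₀)))))
          where
          f₀ = stageCosts (good a) (toℕ q)
          h : Fin H → ℝ
          h t = eTotal (A S) f₀ (prior t)
          same : ∀ o i → toℕ i ℕ.< toℕ (time q o) → ∀ v →
                 truncated (good (a [ q ]≔ o)) K i v ≡ truncated (good a) (toℕ q) i v
          same o i i<t v = cases (slot i Fin.≟ q)
            where
            cases : Dec (slot i ≡ q) → truncated (good (a [ q ]≔ o)) K i v ≡ truncated (good a)
              (toℕ q) i v
            -- Earlier steps of stage q have an offset other than o, so neither instance reduces the
            -- price there.
            cases (yes i∈q) = ≡.trans
              (≡.cong₂ _∧_ (started {toℕ i} {K} (stage<K i))
                (dec-false (offset i Fin.≟ (a [ q ]≔ o) (slot i)) other))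
              (≡.sym (≡.cong (_∧ good a i v) (≮⇒false
                (λ p → ℕ.<-irrefl (≡.trans (stage≡slot i) (≡.cong toℕ i∈q)) p))))
              where
              other : offset i ≢ (a [ q ]≔ o) (slot i)
              other eq = ℕ.<⇒≢ i<t (≡.cong toℕ (≡.trans (≡.sym (time-slot-offset i))
                (≡.cong₂ time i∈q (≡.trans eq (≡.trans (≡.cong (a [ q ]≔ o) i∈q)
                  (updated a q o))))))
            cases (no i∉q) = ≡.cong₂ _∧_
              (≡.trans (started {toℕ i} {K} (stage<K i)) (≡.sym (started {toℕ i} {toℕ q}
                (≡.subst (ℕ._< toℕ q) (≡.sym (stage≡slot i)) (ℕ.≤∧≢⇒<
                  (ℕ.≤-trans (slot-mono (ℕ.<⇒≤ i<t)) (ℕ.≤-reflexive (≡.cong toℕ (slot-time q o))))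
                  (i∉q ∘ Fin.toℕ-injective))))))
              (≡.cong (λ o → does (offset i Fin.≟ o)) (unchanged a i∉q))
          loss-at : ∀ o → loss (a [ q ]≔ o) q ≈ (τ + τ) * h (time q o)
          loss-at o = trans (reflexive (≡.cong (ready (a [ q ]≔ o) q) (updated a q o)))
            (*-congˡ (eTotal-cong (A S) (prior (time q o)) (full′ (a [ q ]≔ o)) f₀
              λ i v i<t → stageCosts-agree (good (a [ q ]≔ o)) (good a) K (toℕ q) i
                (same o i (ℕ.≤-trans i<t (ℕ.≤-reflexive (toℕ-prior (time q o))))) v))

        small : ∀ a → (∀ q → (ℓ · 1#) * loss a q ≤ C′) →
                r * (D * 1#) + 1# * sum (leak K stage<K (A S) (good a)) ≤ ε
        small a p = ≤-trans
          (≤-reflexive (trans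
            (+-cong (trans (*-congˡ (trans (*-congʳ D≈0) (zeroˡ 1#))) (zeroʳ r))
                    (trans (*-identityˡ _) (sum-leak a)))
            (+-identityˡ _)))
          (*-cancel-pos-≤ (0<n·1 b) (≤-trans
            (≤-respˡ-≈ (sum-* {K} (ℓ · 1#) (loss a)) (≤-respʳ-≈ (sum-const K C′) (sum-mono {K} p)))
            (proj₂ (archimedean′ wasted 0<ε))))

        stage-competitive : ∀ a k → k ℕ.< K →
          expectedCost (A S) (stageCosts (good a) (suc k)) ≤ r * (reduced k + (τ + τ) + D * 1#)
        stage-competitive a k k<K = competitive (stageCosts (good a) (suc k)) zero lo 1 fits
          (ring 0 (con 1ℤ :* (con 1ℤ :+ con 0ℤ) := con 1ℤ) ≡.refl) (reduced k) cheap
          where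
          q = fromℕ< k<K
          toℕ-q : toℕ q ≡ k
          toℕ-q = Fin.toℕ-fromℕ< k<K
          lo = k ℕ.* ℓ ℕ.+ toℕ (a q)
          toℕ-pulse : toℕ (time q (a q)) ≡ lo
          toℕ-pulse = ≡.trans (toℕ-time q (a q)) (≡.cong (λ k → k ℕ.* ℓ ℕ.+ toℕ (a q)) toℕ-q)
          fits : lo ℕ.+ 1 ℕ.≤ H
          fits = ℕ.≤-trans (ℕ.≤-reflexive (≡.trans (ℕ.+-comm lo 1) (≡.cong suc (≡.sym toℕ-pulse))))
            (Fin.toℕ<n (time q (a q)))
          at-pulse : Costs.price (stageCosts (good a) (suc k)) (time q (a q)) zero ≤ 1# * reduced k
          at-pulse = ≤-reflexive (trans
            (reflexive (≡.cong₂ (λ g j → 1# * (U - ⟦ g ⟧ * (U - reduced j)))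
              (≡.cong₂ _∧_ (started {toℕ (time q (a q))} {suc k} (ℕ.s≤s (ℕ.≤-reflexive stage≡k)))
                (≡.trans (≡.cong₂ (λ o i → does (o Fin.≟ a i)) (offset-time q (a q))
                  (slot-time q (a q)))
                  (dec-true (a q Fin.≟ a q) ≡.refl)))
              stage≡k))
            (ring 2 (λ U p → con 1ℤ :* (U :- con 1ℤ :* (U :- p)) := con 1ℤ :* p)
              ≡.refl U (reduced k)))
            where
            stage≡k : stage (toℕ (time q (a q))) ≡ k
            stage≡k = ≡.trans (stage≡slot (time q (a q)))
              (≡.trans (≡.cong toℕ (slot-time q (a q))) toℕ-q)
          cheap : ∀ t → lo ℕ.≤ toℕ t → toℕ t ℕ.< lo ℕ.+ 1 →
                  Costs.price (stageCosts (good a) (suc k)) t zero ≤ 1# * reduced k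
          cheap t lo≤t t<lo+1 = ≡.subst
            (λ t → Costs.price (stageCosts (good a) (suc k)) t zero ≤ 1# * reduced k)
            (Fin.toℕ-injective (≡.trans toℕ-pulse (ℕ.≤-antisym lo≤t
              (ℕ.s≤s⁻¹ (ℕ.≤-trans t<lo+1 (ℕ.≤-reflexive (ℕ.+-comm lo 1)))))))
            at-pulse

      single-0≤r : 0# ≤ r
      single-0≤r = 0≤ratio (stageCosts (λ _ _ → false) 0)

      single-feasible : ¬ ¬ Feasible U (U - D) r ε K u
      single-feasible none = adaptive-choice loss loss-local loss-sum
        (<-by 0<1 (ring 1 (λ x → con 1ℤ := x :+ con 1ℤ :- x) ≡.refl C))
        λ (a , p) → none (feasible K stage<K (A S) (good a) (stage-competitive a) (small a p))

theorem3p3 :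
    ∀ (R : Reals) → let open Reals R in
    ∀ (L U τ D : ℝ) (0<L : 0# < L) (L<U : L < U) →
    0# ≤ τ → 0# ≤ D → D < U - L → D + 2 · τ ≤ U - L →
    let open SOAD R L U τ D
        open Star R
        U#0 = >⇒#0 (<-trans 0<L L<U)
    in
    ∀ (e w η : ℝ) →
    IsExp ((D - U) / U [ U#0 ]) e →
    IsLambertW (((D + L - U + 2 · τ) * e) / U [ U#0 ]) w →
    η * (w + (U - D) / U [ U#0 ]) ≈ 1# →
    ∀ (OPT : Instance → ℝ) →
    (∀ I → IsOptimalCost (setup I) (costs I) (OPT I)) →
    ∃ λ (𝓕 : Pred Instance 0ℓ) → ((∀ I → 𝓕 I → IsWeightedStar (Instance.d I)) ×
            (∀ (A : OnlineAlgorithm) (r : ℝ) → RatioBound OPT A 𝓕 r → η ≤ r))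
theorem3p3 R L U τ D 0<L L<U 0≤τ 0≤D D<U-L D+2τ≤U-L e w η exp-b (-1≤w , eʷ , exp-w , w*eʷ≈) η*≈1
  OPT optimal =
  -- The instances that refute r < η depend on the algorithm and on r, so the family comprises all
  -- stars.
  (λ I → IsWeightedStar (Instance.d I)) , (λ I star → star) , λ A r bounded r<η →
    let open Against L U τ D 0<L L<U 0≤τ 0≤D OPT optimal A r bounded
        no-ratio : 0# ≤ r → _ → ⊥
        no-ratio 0≤r = no-better-ratio 0<U 0≤V V≤U U-D≈Ub 0≤b b≤1 0≤-w 0≤r
          (trans (*-congˡ (ring 2 (λ b w → b :- (:- w) := w :+ b) ≡.refl b w)) η*≈1) r<η
          (IsExp-resp (ring 3 (λ D U i → (D :- U) :* i := :- ((U :- D) :* i)) ≡.refl D U i) exp-b)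
          (IsExp-resp (ring 1 (λ w → w := :- (:- w)) ≡.refl w) exp-w) lambert
        -- Refuting 0 < D first makes D = 0 available without deciding the sign of D.
        D≤0 : D ≤ 0#
        D≤0 = λ 0<D → no-ratio
          -- Any instance gives 0 ≤ r; these arguments just pick one.
          (Spread.spread-0≤r 0<D 0 (λ _ → 0#) 1# (λ _ → ≤-refl) (λ _ → 0≤V) 0<1)
          (λ N u ε 0≤u u≤V 0<ε → Spread.spread-feasible 0<D N u ε 0≤u u≤V 0<ε)
        D≈0 = ≤-antisym D≤0 0≤D
    in no-ratio
      (Single.single-0≤r D≈0 0 (λ _ → 0#) 1# (λ _ → ≤-refl) (λ _ → 0≤V) 0<1)
      (λ N u ε 0≤u u≤V 0<ε → Single.single-feasible D≈0 N u ε 0≤u u≤V 0<ε)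
  where
  open Reals R
  open RealRing R
  open RealOrder R
  open Exponential R
  open Threshold R
  open StarInstances R
  open SOAD R L U τ D
  open Star R
  0<U = <-trans 0<L L<U
  U#0 = >⇒#0 0<U
  i = U ⁻¹[ U#0 ]
  U*i≈1 : U * i ≈ 1#
  U*i≈1 = *-inverseʳ U#0
  0<i : 0# < i
  0<i = inverse-pos 0<U U*i≈1
  b = (U - D) * i
  V = U - D - L - (τ + τ)
  0≤V : 0# ≤ V
  0≤V = ≤-respʳ-≈ (ring 4 (λ U L D τ → U :- L :- (D :+ (τ :+ (τ :+ con 0ℤ)))
    := U :- D :- L :- (τ :+ τ)) ≡.refl U L D τ) (≤⇒0≤ D+2τ≤U-L)
  V≤U : V ≤ U
  V≤U = ≤-by (+-nonneg 0≤D (+-nonneg (<⇒≤ 0<L) (+-nonneg 0≤τ 0≤τ)))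
    (ring 4 (λ U L D τ → D :+ (L :+ (τ :+ τ)) := U :- (U :- D :- L :- (τ :+ τ))) ≡.refl U L D τ)
  U-D≈Ub : U - D ≈ U * b
  U-D≈Ub = sym (trans (ring 3 (λ U D i → U :* ((U :- D) :* i) := (U :- D) :* (U :* i))
    ≡.refl U D i) (trans (*-congˡ U*i≈1) (*-identityʳ _)))
  0≤b : 0# ≤ b
  0≤b = *-nonneg (≤-respʳ-≈ (ring 3 (λ U L D → U :- L :- D :+ L := U :- D) ≡.refl U L D)
    (+-nonneg (<⇒≤ (<⇒0< D<U-L)) (<⇒≤ 0<L))) (<⇒≤ 0<i)
  b≤1 : b ≤ 1#
  b≤1 = ≤-by (*-nonneg 0≤D (<⇒≤ 0<i))
    (trans (ring 3 (λ U D i → D :* i := U :* i :- (U :- D) :* i) ≡.refl U D i) (+-congʳ U*i≈1))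
  0≤e : 0# ≤ e
  0≤e = ≤-trans (≤⇒0≤ b≤1) (1-y≤exp[-y] 0≤b b≤1
    (IsExp-resp (ring 3 (λ D U i → (D :- U) :* i := :- ((U :- D) :* i)) ≡.refl D U i) exp-b))
  -- With y = - w, the equation of W reads y exp (-y) = V e / U, where V is the value that the
  -- sequence u reaches in the last stage.
  lambert : (- w) * eʷ * U ≈ V * e
  lambert = trans (ring 3 (λ w x U → (:- w) :* x :* U := :- (w :* x :* U)) ≡.refl w eʷ U)
    (trans (-‿cong (*-congʳ w*eʷ≈))
    (trans (ring 6 (λ D L U τ e i → :- ((D :+ L :- U :+ (τ :+ (τ :+ con 0ℤ))) :* e :* i :* U)
      := (U :- D :- L :- (τ :+ τ)) :* e :* (U :* i)) ≡.refl D L U τ e i)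
      (trans (*-congˡ U*i≈1) (*-identityʳ _))))
  -- For w > 0, `1≤exp` would make w eʷ positive, whereas it equals - V e / U ≤ 0.
  w≤0 : w ≤ 0#
  w≤0 0<w = *-nonneg 0≤V 0≤e (<-by
    (*-pos (*-pos 0<w (<-≤-trans 0<1 (1≤exp (<⇒≤ 0<w) exp-w))) 0<U)
    (trans (ring 3 (λ w x U → w :* x :* U := con 0ℤ :- (:- w) :* x :* U) ≡.refl w eʷ U)
      (+-congˡ (-‿cong lambert))))
  0≤-w : 0# ≤ - w
  0≤-w = neg-nonneg w≤0
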